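{- For every graph class $\mathcal{C}$ of bounded expansion and every $d\in\mathbb{N}$, there exist a constant $c$ and a linear-time algorithm that, given a graph $H\in\overline{\mathcal{C}^d}$, computes a proper coloring of $H$ using at most $c\cdot\chi(H)$ colors.
   Context: All graphs are finite, simple and undirected. $G^d$ is the graph on $V(G)$ where distinct $u,v$ are adjacent iff their distance in $G$ is at most $d$; $\mathcal{C}^d=\{G^d:G\in\mathcal{C}\}$; $\overline{\mathcal{D}}$ denotes the class of all induced subgraphs of graphs in $\mathcal{D}$. $\chi$ is the chromatic number. Running time is measured in the input size $|V(H)|+|E(H)|$. A graph is a depth-$r$ minor of $G$ if it is obtained from a subgraph of $G$ by contracting pairwise disjoint connected subgraphs of radius at most $r$; a class $\mathcal{C}$ has bounded expansion if for every $r\in\mathbb{N}$ the ratio of edges to vertices of depth-$r$ minors of graphs in $\mathcal{C}$ is bounded. -}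

module Defs where

open import Data.Nat using (ℕ; zero; suc; _+_; _*_; _∸_; _≤_; _<_; _<ᵇ_)
open import Data.Fin using (Fin; toℕ)
open import Data.Bool using (Bool; true; false; if_then_else_)
open import Data.List using (List; []; _∷_; length)
open import Data.List.Relation.Unary.All using (All)
open import Data.List.Relation.Unary.Unique.Propositional using (Unique)
open import Data.List.Membership.Propositional using (_∈_)
open import Data.Maybe using (Maybe; just; nothing)
open import Data.Product using (Σ; ∃; ∃-syntax; _×_; _,_; proj₁; proj₂)
open import Data.Unit using (⊤; tt)
open import Data.Empty using (⊥)
open import Relation.Nullary using (¬_)
open import Relation.Binary.PropositionalEquality using (_≡_; _≢_; refl; sym)

record Graph : Set₁ where
  field
    n     : ℕ
    Adj   : Fin n → Fin n → Set
    adj-sym : ∀ {u v} → Adj u v → Adj v u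
    irrefl : ∀ {u} → ¬ Adj u u
open Graph public

data WalkIn (G : Graph) (P : Fin (n G) → Set) : Fin (n G) → Fin (n G) → ℕ → Set where
  here : ∀ {u} → P u → WalkIn G P u u 0
  step : ∀ {u v w k} → P u → Adj G u v → WalkIn G P v w k → WalkIn G P u w (suc k)

walk-snoc : ∀ {G P u v w k} → WalkIn G P u v k → Adj G v w → P w → WalkIn G P u w (suc k)
walk-snoc (here pu) a pw = step pu a (here pw)
walk-snoc (step pu a r) b pw = step pu a (walk-snoc r b pw)

walk-start : ∀ {G P u v k} → WalkIn G P u v k → P u
walk-start (here p) = p
walk-start (step p _ _) = p

walk-rev : ∀ {G P u v k} → WalkIn G P u v k → WalkIn G P v u k
walk-rev (here p) = here p
walk-rev {G} (step pu a r) = walk-snoc (walk-rev r) (adj-sym G a) pu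

DistLE : (G : Graph) → ℕ → Fin (n G) → Fin (n G) → Set
DistLE G d u v = ∃[ k ] (k ≤ d × WalkIn G (λ _ → ⊤) u v k)

power : Graph → ℕ → Graph
power G d = record
  { n = n G
  ; Adj = λ u v → u ≢ v × DistLE G d u v
  ; adj-sym = λ { (u≢v , k , k≤d , w) → (λ e → u≢v (sym e)) , k , k≤d , walk-rev w }
  ; irrefl = λ { (u≢u , _) → u≢u refl }
  }

InducedSub : Graph → Graph → Set
InducedSub H G =
  Σ (Fin (n H) → Fin (n G)) λ φ →
    (∀ u v → φ u ≡ φ v → u ≡ v) ×
    (∀ u v → Adj H u v → Adj G (φ u) (φ v)) ×
    (∀ u v → Adj G (φ u) (φ v) → Adj H u v)

InClosurePower : (Graph → Set) → ℕ → Graph → Set₁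
InClosurePower C d H = Σ Graph λ G → C G × InducedSub H (power G d)

-- branch-set model: σ v = just x means v lies in the branch set of x
-- (branch sets are disjoint by construction).  Each branch set has a
-- centre from which every vertex of it is reachable inside the set by
-- a walk of length ≤ r (so it is connected of radius ≤ r), and every
-- edge of H is witnessed by an edge of G between the branch sets.
DepthMinor : ℕ → Graph → Graph → Set
DepthMinor r H G =
  Σ (Fin (n G) → Maybe (Fin (n H))) λ σ →
    (∀ x → ∃[ c ] (σ c ≡ just x ×
       (∀ v → σ v ≡ just x →
          ∃[ k ] (k ≤ r × WalkIn G (λ w → σ w ≡ just x) c v k)))) ×
    (∀ x y → Adj H x y →
       ∃[ u ] ∃[ v ] (σ u ≡ just x × σ v ≡ just y × Adj G u v))

EdgeList : (H : Graph) → List (Fin (n H) × Fin (n H)) → Set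
EdgeList H es =
  Unique es × All (λ e → toℕ (proj₁ e) < toℕ (proj₂ e) × Adj H (proj₁ e) (proj₂ e)) es

EdgeListing : (H : Graph) → List (Fin (n H) × Fin (n H)) → Set
EdgeListing H es =
  EdgeList H es × (∀ u v → Adj H u v → toℕ u < toℕ v → (u , v) ∈ es)

BoundedExpansion : (Graph → Set) → Set₁
BoundedExpansion C =
  ∀ (r : ℕ) → ∃[ b ] (∀ G → C G → ∀ M → DepthMinor r M G →
      ∀ es → EdgeList M es → length es ≤ b * n M)

Proper : (H : Graph) → (Fin (n H) → ℕ) → Set
Proper H f = ∀ u v → Adj H u v → f u ≢ f v

Colourable : Graph → ℕ → Set
Colourable H k = Σ (Fin (n H) → Fin k) λ f → ∀ u v → Adj H u v → f u ≢ f v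

IsChromaticNumber : Graph → ℕ → Set
IsChromaticNumber H k = Colourable H k × (∀ j → Colourable H j → k ≤ j)

UsesAtMost : (H : Graph) → ℕ → (Fin (n H) → ℕ) → Set
UsesAtMost H k f = ∃[ L ] (length L ≤ k × (∀ v → f v ∈ L))

-- Model of computation: unit-cost RAM with registers indexed by ℕ

data Instr : Set where
  const  : ℕ → ℕ → Instr          -- R[i] := c
  add    : ℕ → ℕ → ℕ → Instr      -- R[i] := R[j] + R[k]
  sub    : ℕ → ℕ → ℕ → Instr      -- R[i] := R[j] ∸ R[k]
  load   : ℕ → ℕ → Instr          -- R[i] := R[R[j]]
  store  : ℕ → ℕ → Instr          -- R[R[i]] := R[j]
  jmpLt  : ℕ → ℕ → ℕ → Instr      -- if R[i] < R[j] then goto l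
  halt   : Instr

Program : Set
Program = List Instr

record State : Set where
  constructor ⟨_,_⟩
  field
    pc  : ℕ
    mem : ℕ → ℕ
open State public

nth : {A : Set} → List A → ℕ → Maybe A
nth []       _       = nothing
nth (x ∷ xs) zero    = just x
nth (x ∷ xs) (suc i) = nth xs i

update : (ℕ → ℕ) → ℕ → ℕ → (ℕ → ℕ)
update m i x j = if (j Data.Nat.≡ᵇ i) then x else m j

-- one step; nothing means the machine has halted
-- (halt instruction, or pc outside the program)
stepRAM : Program → State → Maybe State
stepRAM P ⟨ p , m ⟩ with nth P p
... | nothing = nothing
... | just halt = nothing
... | just (const i c) = just ⟨ suc p , update m i c ⟩
... | just (add i j k) = just ⟨ suc p , update m i (m j + m k) ⟩
... | just (sub i j k) = just ⟨ suc p , update m i (m j ∸ m k) ⟩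
... | just (load i j) = just ⟨ suc p , update m i (m (m j)) ⟩
... | just (store i j) = just ⟨ suc p , update m (m i) (m j) ⟩
... | just (jmpLt i j l) = just ⟨ (if m i <ᵇ m j then l else suc p) , m ⟩

-- run for at most t steps; just s' iff the machine halts within t steps
-- in final state s'
run : Program → ℕ → State → Maybe State
run P t s with stepRAM P s
... | nothing = just s
run P zero s | just _ = nothing
run P (suc t) s | just s' = run P t s'

-- input encoding: R[0] = |V|, R[1] = |E|, R[2+2i], R[3+2i] = endpoints
-- of the i-th edge, all other registers 0
encodeEdges : {n : ℕ} → List (Fin n × Fin n) → ℕ → ℕ
encodeEdges []             _                   = 0
encodeEdges ((u , v) ∷ es) zero                = toℕ u
encodeEdges ((u , v) ∷ es) (suc zero)          = toℕ v
encodeEdges ((u , v) ∷ es) (suc (suc j))       = encodeEdges es j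

initMem : (H : Graph) → List (Fin (n H) × Fin (n H)) → ℕ → ℕ
initMem H es zero = n H
initMem H es (suc zero) = length es
initMem H es (suc (suc j)) = encodeEdges es j

initState : (H : Graph) → List (Fin (n H) × Fin (n H)) → State
initState H es = ⟨ 0 , initMem H es ⟩

outColouring : (H : Graph) → State → Fin (n H) → ℕ
outColouring H s v = mem s (toℕ v)

{-# OPTIONS --safe #-}
module Submission where

-- Colour H = Gᵈ[A] greedily along a smallest-last order: every vertex gets a colour ≤ t + 1 for some t such that H
-- has an induced subgraph H[S] of minimum degree ≥ t, so it suffices that such a t is O(χ(H)).
--
-- Fix a proper k-colouring of H and two colour classes I, J of S.  In G the vertices of I are pairwise at distance
-- > d, and so are those of J.  Join the ends of every H-edge between I and J by a path of length ≤ d in G and cut it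
-- into two halves of length ≤ r = ⌊d/2⌋.  Colour V(G) by two colours uniformly at random: an edge survives, with
-- probability ≥ 2⁻ᵈ⁻¹, if its half at I has the first and its half at J the second colour.  The halves of surviving
-- edges, grouped by their ends, are disjoint and form a depth-r minor of G on I ∪ J, so at most
-- 2ᵈ⁺¹ b (|I| + |J|) edges of H run between I and J.  Summing over the pairs of classes, H[S] has average
-- degree O(k).
--
-- The order is computed in linear time with buckets: at a level t, which never decreases, a vertex v waits in bucket
-- max(t, deg v), with stale entries left behind; the set of vertices present when level t starts has minimum
-- degree ≥ t.

open import Defs
open import Data.Bool as Bool using (Bool; true; false; if_then_else_; _∧_)
import Data.Bool.Properties as Bool
open import Data.Empty using (⊥)
open import Data.Fin as Fin using (Fin; toℕ; fromℕ<; _↑ˡ_; _↑ʳ_; splitAt; join)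
import Data.Fin.Properties as Fin
open import Data.List using (List; []; _∷_; _++_; length; map; filter; foldr; concatMap; replicate; lookup; allFin; upTo; cartesianProduct)
open import Data.List.Membership.Propositional using (_∈_; _∉_; find; lose)
open import Data.List.Membership.Propositional.Properties
import Data.List.Membership.DecPropositional as DecMembership
open import Data.List.Properties using (length-++; length-map; length-replicate; length-tabulate; length-upTo; ++-assoc)
open import Data.List.Relation.Unary.All as All using (All; []; _∷_)
import Data.List.Relation.Unary.All.Properties as All
open import Data.List.Relation.Unary.AllPairs as AllPairs using (AllPairs; []; _∷_)
import Data.List.Relation.Unary.AllPairs.Properties as AllPairs
open import Data.List.Relation.Unary.Any as Any using (Any; here; there)
open import Data.List.Relation.Unary.Any.Properties using (lookup-index)
open import Data.List.Relation.Unary.Unique.Propositional using (Unique)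
import Data.List.Relation.Unary.Unique.Propositional.Properties as Unique
open import Data.Maybe using (Maybe; just; nothing)
open import Data.Nat using (ℕ; zero; suc; _+_; _*_; _∸_; _^_; _≤_; _<_; _<ᵇ_; _≤ᵇ_; _≡ᵇ_; z≤n; s≤s; z<s; >-nonZero)
open import Data.Nat.DivMod using (_%_; [m+kn]%n≡m%n; m<n⇒m%n≡m)
open import Data.Nat.Induction using (<-wellFounded)
open import Data.Nat.Properties
open import Data.Nat.Solver using (module +-*-Solver)
open import Data.Product using (Σ; ∃-syntax; _×_; _,_; proj₁; proj₂)
open import Data.Sum using (_⊎_; inj₁; inj₂; [_,_]′)
open import Data.Unit using (⊤; tt)
open import Function using (_∘_; id)
open import Induction.WellFounded using (Acc; acc)
open import Relation.Binary.Definitions using (tri<; tri≈; tri>)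
open import Relation.Binary.PropositionalEquality
  using (_≡_; _≢_; refl; sym; trans; cong; cong₂; subst; subst₂; module ≡-Reasoning)
open import Relation.Nullary using (¬_; Dec; yes; no; contradiction)
open import Relation.Nullary.Decidable using (_⊎-dec_; _×-dec_)

-- Sums over lists

-- Two ends in the same class cannot share a vertex of their halves, for that would put them within
-- `r + r ≤ d` of each other; this is why the paths are cut in the middle. Ends in different classes
-- may share one, and the colouring of V(G) is there to forbid just this. It does not control the
-- colour of an end without surviving edges, so a separate argument keeps such an end off the halves
-- of the other side. The depth `r` depends on `d` alone, so one bound of the class serves all pairs
-- of colour classes.
--
-- The graph class, `d` and χ(H) enter the analysis only: one program with one time factor serves
-- them all. The code around the algorithm is due to the machine model. The input fills the
-- registers that a program would use as variables, and the colours must end in registers 0 to n -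
-- 1. The algorithm proper therefore works on arrays beyond the input, after the input has been
-- moved there and before the colours are written back.

Σl : {A : Set} → (A → ℕ) → List A → ℕ
Σl f []       = 0
Σl f (x ∷ xs) = f x + Σl f xs

⟦_⟧ : {P : Set} → Dec P → ℕ
⟦ yes _ ⟧ = 1
⟦ no  _ ⟧ = 0

+-interchange : ∀ a b c d → (a + b) + (c + d) ≡ (a + c) + (b + d)
+-interchange = solve 4 (λ a b c d → (a :+ b) :+ (c :+ d) := (a :+ c) :+ (b :+ d)) refl
  where open +-*-Solver

Σl-cong : {A : Set} {f g : A → ℕ} → (∀ x → f x ≡ g x) → ∀ xs → Σl f xs ≡ Σl g xs
Σl-cong e []       = refl
Σl-cong e (x ∷ xs) = cong₂ _+_ (e x) (Σl-cong e xs)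

Σl-mono : {A : Set} {f g : A → ℕ} → (∀ x → f x ≤ g x) → ∀ xs → Σl f xs ≤ Σl g xs
Σl-mono e []       = z≤n
Σl-mono e (x ∷ xs) = +-mono-≤ (e x) (Σl-mono e xs)

Σl-mono-∈ : {A : Set} {f g : A → ℕ} → ∀ xs → (∀ x → x ∈ xs → f x ≤ g x) → Σl f xs ≤ Σl g xs
Σl-mono-∈ []       e = z≤n
Σl-mono-∈ (x ∷ xs) e = +-mono-≤ (e x (here refl)) (Σl-mono-∈ xs (λ y y∈ → e y (there y∈)))

Σl-+ : {A : Set} (f g : A → ℕ) → ∀ xs → Σl (λ x → f x + g x) xs ≡ Σl f xs + Σl g xs
Σl-+ f g []       = refl
Σl-+ f g (x ∷ xs) rewrite Σl-+ f g xs = +-interchange (f x) (g x) (Σl f xs) (Σl g xs)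

Σl-*ˡ : {A : Set} (c : ℕ) (f : A → ℕ) → ∀ xs → Σl (λ x → c * f x) xs ≡ c * Σl f xs
Σl-*ˡ c f []       = sym (*-zeroʳ c)
Σl-*ˡ c f (x ∷ xs) rewrite Σl-*ˡ c f xs = sym (*-distribˡ-+ c (f x) (Σl f xs))

Σl-const : {A : Set} (c : ℕ) (xs : List A) → Σl (λ _ → c) xs ≡ length xs * c
Σl-const c []       = refl
Σl-const c (x ∷ xs) = cong (c +_) (Σl-const c xs)

Σl-swap : {A B : Set} (f : A → B → ℕ) → ∀ xs ys →
  Σl (λ x → Σl (f x) ys) xs ≡ Σl (λ y → Σl (λ x → f x y) xs) ys
Σl-swap f []       ys = sym (trans (Σl-const 0 ys) (*-zeroʳ (length ys)))
Σl-swap f (x ∷ xs) ys rewrite Σl-swap f xs ys = sym (Σl-+ (f x) (λ y → Σl (λ x → f x y) xs) ys)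

Σl-++ : {A : Set} (f : A → ℕ) → ∀ xs ys → Σl f (xs ++ ys) ≡ Σl f xs + Σl f ys
Σl-++ f []       ys = refl
Σl-++ f (x ∷ xs) ys rewrite Σl-++ f xs ys = sym (+-assoc (f x) (Σl f xs) (Σl f ys))

Σl-map : {A B : Set} (f : B → ℕ) (h : A → B) → ∀ xs → Σl f (map h xs) ≡ Σl (f ∘ h) xs
Σl-map f h []       = refl
Σl-map f h (x ∷ xs) = cong (f (h x) +_) (Σl-map f h xs)

Σl-cartesianProduct : {A B : Set} (f : A × B → ℕ) → ∀ xs ys →
  Σl f (cartesianProduct xs ys) ≡ Σl (λ x → Σl (λ y → f (x , y)) ys) xs
Σl-cartesianProduct f []       ys = refl
Σl-cartesianProduct f (x ∷ xs) ys =
  trans (Σl-++ f (map (x ,_) ys) (cartesianProduct xs ys))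
        (cong₂ _+_ (Σl-map f (x ,_) ys) (Σl-cartesianProduct f xs ys))

Σl-filter : {A : Set} {P : A → Set} (P? : ∀ x → Dec (P x)) (g : A → ℕ) → ∀ xs →
  Σl g (filter P? xs) ≡ Σl (λ x → ⟦ P? x ⟧ * g x) xs
Σl-filter P? g []       = refl
Σl-filter P? g (x ∷ xs) with P? x
... | yes _ = cong₂ _+_ (sym (+-identityʳ (g x))) (Σl-filter P? g xs)
... | no  _ = Σl-filter P? g xs

length-filter-Σl : {A : Set} {P : A → Set} (P? : ∀ x → Dec (P x)) → ∀ xs →
  length (filter P? xs) ≡ Σl (λ x → ⟦ P? x ⟧) xs
length-filter-Σl P? []       = refl
length-filter-Σl P? (x ∷ xs) with P? x
... | yes _ = cong suc (length-filter-Σl P? xs)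
... | no  _ = length-filter-Σl P? xs

unique-⊆-length : {A : Set} {xs ys : List A} → Unique xs → (∀ {x} → x ∈ xs → x ∈ ys) → length xs ≤ length ys
unique-⊆-length [] incl = z≤n
unique-⊆-length {xs = x ∷ xs} {ys} (x∉ ∷ u) incl with ∈-∃++ (incl (here refl))
... | as , bs , refl = subst (suc (length xs) ≤_) (sym eq) (s≤s (subst (length xs ≤_) (length-++ as) (unique-⊆-length u incl′)))
  where
  eq : length (as ++ x ∷ bs) ≡ suc (length as + length bs)
  eq = trans (length-++ as) (+-suc (length as) (length bs))
  incl′ : ∀ {y} → y ∈ xs → y ∈ as ++ bs
  incl′ {y} y∈ with ∈-++⁻ as (incl (there y∈))
  ... | inj₁ p = ∈-++⁺ˡ p
  ... | inj₂ (here refl) = contradiction refl (All.lookup x∉ y∈)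
  ... | inj₂ (there p) = ∈-++⁺ʳ as p

-- Walks and their halves

Walk : (G : Graph) → Fin (n G) → Fin (n G) → ℕ → Set
Walk G = WalkIn G (λ _ → ⊤)

verts : ∀ {G P u v k} → WalkIn G P u v k → List (Fin (n G))
verts (here {u} _)     = u ∷ []
verts (step {u} _ _ w) = u ∷ verts w

length-verts : ∀ {G P u v k} (w : WalkIn G P u v k) → length (verts w) ≡ suc k
length-verts (here _)     = refl
length-verts (step _ _ w) = cong suc (length-verts w)

start∈verts : ∀ {G P u v k} (w : WalkIn G P u v k) → u ∈ verts w
start∈verts (here _)     = here refl
start∈verts (step _ _ _) = here refl

end∈verts : ∀ {G P u v k} (w : WalkIn G P u v k) → v ∈ verts w
end∈verts (here _)     = here refl
end∈verts (step _ _ w) = there (end∈verts w)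

restrict : ∀ {G P Q u v k} (w : WalkIn G P u v k) → (∀ x → x ∈ verts w → Q x) → WalkIn G Q u v k
restrict (here _)     q = here (q _ (here refl))
restrict (step _ a w) q = step (q _ (here refl)) a (restrict w (λ x x∈ → q x (there x∈)))

prefix : ∀ {G P u v k x} (w : WalkIn G P u v k) → x ∈ verts w →
  ∃[ j ] (j ≤ k × Σ (WalkIn G P u x j) λ w′ → ∀ y → y ∈ verts w′ → y ∈ verts w)
prefix (here p)     (here refl) = 0 , z≤n , here p , λ _ y∈ → y∈
prefix (step p a w) (here refl) = 0 , z≤n , here p , λ { _ (here refl) → here refl }
prefix (step p a w) (there x∈) with prefix w x∈
... | j , j≤ , w′ , incl = suc j , s≤s j≤ , step p a w′ ,
  λ { _ (here refl) → here refl ; y (there y∈) → there (incl y y∈) }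

suffix : ∀ {G P u v k x} (w : WalkIn G P u v k) → x ∈ verts w →
  ∃[ j ] (j ≤ k × Σ (WalkIn G P x v j) λ w′ → Unique (verts w) → Unique (verts w′))
suffix (here p)     (here refl) = 0 , z≤n , here p , λ u → u
suffix (step p a w) (here refl) = _ , ≤-refl , step p a w , λ u → u
suffix (step p a w) (there x∈) with suffix w x∈
... | j , j≤ , w′ , uq = j , m≤n⇒m≤1+n j≤ , w′ , λ { (_ ∷ u) → uq u }

walk-++ : ∀ {G P u v w j k} → WalkIn G P u v j → WalkIn G P v w k → WalkIn G P u w (j + k)
walk-++ (here _)     q = q
walk-++ (step p a w) q = step p a (walk-++ w q)

verts-snoc : ∀ {G P u v x k} (w : WalkIn G P u v k) (a : Adj G v x) (p : P x) →
  verts (walk-snoc {G} w a p) ≡ verts w ++ x ∷ []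
verts-snoc (here _)     a p = refl
verts-snoc (step _ _ w) a p = cong (_ ∷_) (verts-snoc w a p)

verts-rev : ∀ {G P u v k} (w : WalkIn G P u v k) → ∀ x → x ∈ verts (walk-rev w) → x ∈ verts w
verts-rev (here _) x x∈ = x∈
verts-rev {G} (step p a w) x x∈ with ∈-++⁻ (verts (walk-rev w)) (subst (x ∈_) (verts-snoc (walk-rev w) (adj-sym G a) p) x∈)
... | inj₁ q           = there (verts-rev w x q)
... | inj₂ (here refl) = here refl

-- Loop erasure: when the start recurs, the walk from its later occurrence is taken. Repeated
-- vertices have to go because the two halves of a path must be disjoint.
simplePath : ∀ {G P u v k} → WalkIn G P u v k →
  ∃[ j ] (j ≤ k × Σ (WalkIn G P u v j) λ w → Unique (verts w))
simplePath (here p) = 0 , z≤n , here p , ([] ∷ [])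
simplePath {u = u} (step p a w) with simplePath w
... | j , j≤ , w′ , uq with DecMembership._∈?_ Fin._≟_ u (verts w′)
... | yes u∈ = let i , i≤ , w″ , uq′ = suffix w′ u∈ in i , ≤-trans i≤ (m≤n⇒m≤1+n j≤) , w″ , uq′ uq
... | no u∉ = suc j , s≤s j≤ , step p a w′ , (All.¬Any⇒All¬ _ u∉ ∷ uq)

-- A walk of length 1 ≤ k ≤ a + b + 1 cut at an edge into a walk of length ≤ a from
-- its start and, reversed, one of length ≤ b from its end.
record Halves (G : Graph) (d a b : ℕ) (u v : Fin (n G)) (vs : List (Fin (n G))) : Set where
  field
    {mid mid′}  : Fin (n G)
    {len len′}  : ℕ
    len≤     : len ≤ a
    len′≤    : len′ ≤ b
    total    : len + suc len′ ≤ d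
    left     : Walk G u mid len
    right    : Walk G v mid′ len′
    bridge   : Adj G mid mid′
    right⊆   : ∀ x → x ∈ verts right → x ∈ vs
    disjoint : ∀ x → x ∈ verts left → x ∉ verts right

-- The walk is cut at the edge after its first `a` edges, or at its last edge if it is shorter. As
-- no vertex repeats, the two pieces are disjoint.
halves : ∀ {G u v k} a b → (w : Walk G u v k) → Unique (verts w) → u ≢ v → k ≤ suc (a + b) →
  Halves G k a b u v (verts w)
halves a b (here _) uq u≢v k≤ = contradiction refl u≢v
halves zero b (step p e w) (u∉ ∷ uq) u≢v (s≤s k≤) = record
  { len≤ = z≤n ; len′≤ = k≤ ; total = ≤-refl ; left = here p ; right = walk-rev w ; bridge = e
  ; right⊆ = λ x x∈ → there (verts-rev w x x∈)
  ; disjoint = λ { x (here refl) x∈ → All.lookup u∉ (verts-rev w x x∈) refl } }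
halves (suc a) b (step p e (here q)) (u∉ ∷ uq) u≢v k≤ = record
  { len≤ = z≤n ; len′≤ = z≤n ; total = ≤-refl ; left = here p ; right = here q ; bridge = e
  ; right⊆ = λ x x∈ → there x∈
  ; disjoint = λ { x (here refl) x∈ → All.lookup u∉ x∈ refl } }
halves {G} (suc a) b (step p e w@(step _ _ w₁)) (u∉ ∷ uq@(v∉ ∷ _)) u≢v (s≤s k≤)
  = record
  { len≤ = s≤s len≤ ; len′≤ = len′≤ ; total = s≤s total ; left = step p e left ; right = right ; bridge = bridge
  ; right⊆ = λ x x∈ → there (right⊆ x x∈)
  ; disjoint = λ { x (here refl) x∈ → All.lookup u∉ (right⊆ x x∈) refl ; x (there x∈) → disjoint x x∈ } }
  where
  h = halves a b w uq (λ { refl → All.lookup v∉ (end∈verts w₁) refl }) k≤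
  open Halves h

-- Averaging over all two-colourings

-- A pattern `Fin N → Maybe Bool` is a partial two-colouring; `nothing` leaves a vertex free.
agrees : Bool → Maybe Bool → Bool
agrees _     nothing      = true
agrees true  (just true)  = true
agrees false (just false) = true
agrees _     _            = false

compatible : ∀ {N} → (Fin N → Bool) → (Fin N → Maybe Bool) → Bool
compatible {zero}  f q = true
compatible {suc N} f q = agrees (f Fin.zero) (q Fin.zero) ∧ compatible (f ∘ Fin.suc) (q ∘ Fin.suc)

free : ∀ {N} → (Fin N → Maybe Bool) → ℕ
free {zero}  q = 0
free {suc N} q = ⟦ q Fin.zero ⟧ᶠ + free (q ∘ Fin.suc)
  where
  ⟦_⟧ᶠ : Maybe Bool → ℕ
  ⟦ nothing ⟧ᶠ = 1
  ⟦ just _ ⟧ᶠ  = 0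

bit : Bool → ℕ
bit true  = 1
bit false = 0

consᶠ : ∀ {N} → Bool → (Fin N → Bool) → Fin (suc N) → Bool
consᶠ b f Fin.zero   = b
consᶠ b f (Fin.suc i) = f i

-- Double counting of the pairs (f, x) with f compatible with q x: there are 2 ^ free (q x) such f for each x.
averaging : ∀ N {X : Set} (xs : List X) (q : X → Fin N → Maybe Bool) (w : X → ℕ) (B : ℕ) →
  (∀ f → Σl (λ x → w x * bit (compatible f (q x))) xs ≤ B) →
  Σl (λ x → w x * 2 ^ free (q x)) xs ≤ 2 ^ N * B
averaging zero xs q w B bound = ≤-trans (bound (λ ())) (≤-reflexive (sym (*-identityˡ B)))
averaging (suc N) {X} xs q w B bound = begin
  Σl (λ x → w x * 2 ^ free (q x)) xs
    ≡⟨ Σl-cong split xs ⟩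
  Σl (λ x → wᵇ true x * 2 ^ free (q x ∘ Fin.suc) + wᵇ false x * 2 ^ free (q x ∘ Fin.suc)) xs
    ≡⟨ Σl-+ _ _ xs ⟩
  Σl (λ x → wᵇ true x * 2 ^ free (q x ∘ Fin.suc)) xs + Σl (λ x → wᵇ false x * 2 ^ free (q x ∘ Fin.suc)) xs
    ≤⟨ +-mono-≤ (half true) (half false) ⟩
  2 ^ N * B + 2 ^ N * B
    ≡⟨ sym (trans (*-distribʳ-+ B (2 ^ N) (2 ^ N + 0)) (cong (λ z → 2 ^ N * B + z * B) (+-identityʳ (2 ^ N)))) ⟩
  2 ^ suc N * B ∎
  where
  open ≤-Reasoning
  -- The weights carry the induction: once the first vertex has colour `b`, every `x` whose pattern
  -- forbids this gets weight 0, and the rest of the patterns is averaged over the other vertices.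
  wᵇ : Bool → X → ℕ
  wᵇ b x = w x * bit (agrees b (q x Fin.zero))
  split : ∀ x → w x * 2 ^ free (q x) ≡ wᵇ true x * 2 ^ free (q x ∘ Fin.suc) + wᵇ false x * 2 ^ free (q x ∘ Fin.suc)
  split x with q x Fin.zero
  ... | nothing rewrite *-identityʳ (w x) | +-identityʳ (2 ^ free (q x ∘ Fin.suc)) = *-distribˡ-+ (w x) _ _
  ... | just true rewrite *-identityʳ (w x) | *-zeroʳ (w x) = sym (+-identityʳ _)
  ... | just false rewrite *-identityʳ (w x) | *-zeroʳ (w x) = refl
  merge : ∀ a b c → a * bit (b ∧ c) ≡ a * bit b * bit c
  merge a true c rewrite *-identityʳ a = refl
  merge a false c rewrite *-zeroʳ a = refl
  half : ∀ b → Σl (λ x → wᵇ b x * 2 ^ free (q x ∘ Fin.suc)) xs ≤ 2 ^ N * B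
  half b = averaging N xs (λ x → q x ∘ Fin.suc) (wᵇ b) B (λ f →
    ≤-trans (≤-reflexive (Σl-cong (λ x → sym (merge (w x) (agrees b (q x Fin.zero)) (compatible f (q x ∘ Fin.suc)))) xs))
            (bound (consᶠ b f)))

compatible-just : ∀ {N} (f : Fin N → Bool) (q : Fin N → Maybe Bool) → compatible f q ≡ true →
  ∀ x {c} → q x ≡ just c → f x ≡ c
compatible-just f q eq Fin.zero e rewrite e with f Fin.zero
compatible-just f q eq Fin.zero {true} e | true = refl
compatible-just f q eq Fin.zero {false} e | false = refl
compatible-just f q eq (Fin.suc x) e with agrees (f Fin.zero) (q Fin.zero)
... | true = compatible-just (f ∘ Fin.suc) (q ∘ Fin.suc) eq x e

prescribe : ∀ {N} → Fin N → Bool → (Fin N → Maybe Bool) → Fin N → Maybe Bool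
prescribe y c q x with x Fin.≟ y
... | yes _ = just c
... | no _  = q x

free-cong : ∀ {N} {q q′ : Fin N → Maybe Bool} → (∀ x → q x ≡ q′ x) → free q ≡ free q′
free-cong {zero}  e = refl
free-cong {suc N} e rewrite e Fin.zero = cong₂ _+_ refl (free-cong (e ∘ Fin.suc))

prescribe-suc : ∀ {N} (y : Fin N) c q x → prescribe (Fin.suc y) c q (Fin.suc x) ≡ prescribe y c (q ∘ Fin.suc) x
prescribe-suc y c q x with x Fin.≟ y
... | yes _ = refl
... | no _  = refl

free-prescribe : ∀ {N} (y : Fin N) c q → free q ≤ suc (free (prescribe y c q))
free-prescribe {suc N} Fin.zero c q with q Fin.zero
... | nothing = ≤-refl
... | just _  = n≤1+n _
free-prescribe {suc N} (Fin.suc y) c q with free-prescribe y c (q ∘ Fin.suc)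
... | ih rewrite free-cong (prescribe-suc y c q) with q Fin.zero
... | nothing = s≤s ih
... | just _  = ih

prescribeAll : ∀ {N} → Bool → List (Fin N) → (Fin N → Maybe Bool) → Fin N → Maybe Bool
prescribeAll c ys q = foldr (λ y → prescribe y c) q ys

free-prescribeAll : ∀ {N} c (ys : List (Fin N)) q → free q ≤ length ys + free (prescribeAll c ys q)
free-prescribeAll c [] q = ≤-refl
free-prescribeAll c (y ∷ ys) q = begin
  free q                                              ≤⟨ free-prescribeAll c ys q ⟩
  length ys + free (prescribeAll c ys q)              ≤⟨ +-monoʳ-≤ (length ys) (free-prescribe y c _) ⟩
  length ys + suc (free (prescribeAll c (y ∷ ys) q))  ≡⟨ +-suc (length ys) _ ⟩
  suc (length ys + free (prescribeAll c (y ∷ ys) q))  ∎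
  where open ≤-Reasoning

prescribeAll-∈ : ∀ {N} c {ys : List (Fin N)} q {x} → x ∈ ys → prescribeAll c ys q x ≡ just c
prescribeAll-∈ c {y ∷ ys} q {x} x∈ with x Fin.≟ y
... | yes _ = refl
prescribeAll-∈ c {y ∷ ys} q (here refl) | no x≢ = contradiction refl x≢
prescribeAll-∈ c {y ∷ ys} q (there x∈)  | no x≢ = prescribeAll-∈ c q x∈

prescribeAll-∉ : ∀ {N} c {ys : List (Fin N)} q {x} → x ∉ ys → prescribeAll c ys q x ≡ q x
prescribeAll-∉ c {[]} q x∉ = refl
prescribeAll-∉ c {y ∷ ys} q {x} x∉ with x Fin.≟ y
... | yes refl = contradiction (here refl) x∉
... | no _ = prescribeAll-∉ c q (x∉ ∘ there)

free-nothing : ∀ N → free {N} (λ _ → nothing) ≡ N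
free-nothing zero    = refl
free-nothing (suc N) = cong suc (free-nothing N)

-- The minor formed by surviving edges

-- `α` and `β` place two colour classes of H in G. All that the minor needs of the colouring is that
-- each class is `d`-separated, so H itself does not occur here.
module Bipartite (G : Graph) (d r p q : ℕ) (2r≤d : r + r ≤ d)
  (α : Fin p → Fin (n G)) (β : Fin q → Fin (n G))
  (sepα : ∀ i i′ → DistLE G d (α i) (α i′) → i ≡ i′)
  (sepβ : ∀ j j′ → DistLE G d (β j) (β j′) → j ≡ j′)
  (disj : ∀ i j → α i ≢ β j) where

  record Edge : Set where
    constructor edge
    field
      src : Fin p
      tgt : Fin q
      {onPath} : List (Fin (n G))
      path : Halves G d r r (α src) (β tgt) onPath
    open Halves path public
    ends : Fin p × Fin q
    ends = src , tgt
  open Edge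

  Vertex : Set
  Vertex = Fin p ⊎ Fin q

  centre : Vertex → Fin (n G)
  centre = [ α , β ]′

  side : Vertex → Bool
  side (inj₁ _) = true
  side (inj₂ _) = false

  separated : ∀ z z′ → side z ≡ side z′ → DistLE G d (centre z) (centre z′) → z ≡ z′
  separated (inj₁ i) (inj₁ i′) _ δ = cong inj₁ (sepα i i′ δ)
  separated (inj₂ j) (inj₂ j′) _ δ = cong inj₂ (sepβ j j′ δ)

  centres-distinct : ∀ z z′ → side z ≢ side z′ → centre z ≢ centre z′
  centres-distinct (inj₁ i) (inj₁ i′) s = contradiction refl s
  centres-distinct (inj₁ i) (inj₂ j)  s = disj i j
  centres-distinct (inj₂ j) (inj₁ i)  s = disj i j ∘ sym
  centres-distinct (inj₂ j) (inj₂ j′) s = contradiction refl s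

  module Survivors (f : Fin (n G) → Bool) (es : List Edge)
    (sat : ∀ e → e ∈ es → (∀ x → x ∈ verts (left e) → f x ≡ true) × (∀ x → x ∈ verts (right e) → f x ≡ false)) where

    open DecMembership {A = Fin (n G)} Fin._≟_ using (_∈?_)

    -- A centre belongs to its own branch set even if no surviving edge ends there, since every
    -- vertex of the minor needs a nonempty branch set.
    Owns : Fin (n G) → Vertex → Set
    Owns w (inj₁ i) = w ≡ α i ⊎ Any (λ e → src e ≡ i × w ∈ verts (left e)) es
    Owns w (inj₂ j) = w ≡ β j ⊎ Any (λ e → tgt e ≡ j × w ∈ verts (right e)) es

    owns? : ∀ w z → Dec (Owns w z)
    owns? w (inj₁ i) = (w Fin.≟ α i) ⊎-dec Any.any? (λ e → (src e Fin.≟ i) ×-dec (w ∈? verts (left e))) es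
    owns? w (inj₂ j) = (w Fin.≟ β j) ⊎-dec Any.any? (λ e → (tgt e Fin.≟ j) ×-dec (w ∈? verts (right e))) es

    owns-centre : ∀ z → Owns (centre z) z
    owns-centre (inj₁ i) = inj₁ refl
    owns-centre (inj₂ j) = inj₁ refl

    owns-walk : ∀ w z → Owns w z →
      ∃[ k ] (k ≤ r × Σ (Walk G (centre z) w k) λ ω → ∀ y → y ∈ verts ω → Owns y z)
    owns-walk w (inj₁ i) (inj₁ refl) = 0 , z≤n , here tt , λ { _ (here refl) → inj₁ refl }
    owns-walk w (inj₂ j) (inj₁ refl) = 0 , z≤n , here tt , λ { _ (here refl) → inj₁ refl }
    owns-walk w (inj₁ i) (inj₂ o) with find o
    ... | e , e∈ , refl , w∈ with prefix (left e) w∈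
    ... | k , k≤ , ω , incl = k , ≤-trans k≤ (len≤ e) , ω , λ y y∈ → inj₂ (lose e∈ (refl , incl y y∈))
    owns-walk w (inj₂ j) (inj₂ o) with find o
    ... | e , e∈ , refl , w∈ with prefix (right e) w∈
    ... | k , k≤ , ω , incl = k , ≤-trans k≤ (len′≤ e) , ω , λ y y∈ → inj₂ (lose e∈ (refl , incl y y∈))

    -- A bare centre may have the wrong colour under `f`, so colours alone do not separate the
    -- sides. But no centre of the other side lies on a half: followed along the path, it would be
    -- within `d` of the path's end on its own side, hence equal to that end, which lies on the
    -- other half.
    owns-coloured : ∀ w z → Owns w z →
      w ≡ centre z ⊎ (f w ≡ side z × (∀ z′ → side z ≢ side z′ → w ≢ centre z′))
    owns-coloured w (inj₁ i) (inj₁ e) = inj₁ e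
    owns-coloured w (inj₂ j) (inj₁ e) = inj₁ e
    owns-coloured w (inj₁ i) (inj₂ o) with find o
    ... | e , e∈ , refl , w∈ = inj₂ (proj₁ (sat e e∈) w w∈ , λ
      { (inj₁ _) s → contradiction refl s
      ; (inj₂ j′) _ w≡ → case-β j′ w≡ })
      where
      case-β : ∀ j′ → w ≢ β j′
      case-β j′ refl with suffix (left e) w∈
      ... | k , k≤ , ω , _ with sepβ j′ (tgt e) (_ , ≤-trans (+-monoˡ-≤ _ k≤) (total e) ,
                                  walk-++ ω (step tt (bridge e) (walk-rev (right e))))
      ... | refl = disjoint e w w∈ (start∈verts (right e))
    owns-coloured w (inj₂ j) (inj₂ o) with find o
    ... | e , e∈ , refl , w∈ = inj₂ (proj₂ (sat e e∈) w w∈ , λ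
      { (inj₂ _) s → contradiction refl s
      ; (inj₁ i′) _ w≡ → case-α i′ w≡ })
      where
      case-α : ∀ i′ → w ≢ α i′
      case-α i′ refl with suffix (right e) w∈
      ... | k , k≤ , ω , _ with sepα (src e) i′ (_ , ≤-trans (+-monoʳ-≤ (len e) (s≤s k≤)) (total e) ,
                                  walk-++ (left e) (step tt (bridge e) (walk-rev ω)))
      ... | refl = disjoint e w (start∈verts (left e)) w∈

    -- On one side, two owners would be joined by two walks of length at most `r`, against
    -- separation. On opposite sides, the colours under `f` tell the halves apart and
    -- `owns-coloured` deals with the centres.
    owner-unique : ∀ w z z′ → Owns w z → Owns w z′ → z ≡ z′
    owner-unique w z z′ o o′ with side z Bool.≟ side z′
    ... | yes s with owns-walk w z o | owns-walk w z′ o′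
    ... | k , k≤ , ω , _ | k′ , k′≤ , ω′ , _ =
      separated z z′ s (_ , ≤-trans (+-mono-≤ k≤ k′≤) 2r≤d , walk-++ ω (walk-rev ω′))
    owner-unique w z z′ o o′ | no s with owns-coloured w z o | owns-coloured w z′ o′
    ... | inj₁ e        | inj₁ e′        = contradiction (trans (sym e) e′) (centres-distinct z z′ s)
    ... | inj₁ e        | inj₂ (_ , ne)  = contradiction e (ne z (s ∘ sym))
    ... | inj₂ (_ , ne) | inj₁ e′        = contradiction e′ (ne z′ s)
    ... | inj₂ (c , _)  | inj₂ (c′ , _)  = contradiction (trans (sym c) c′) s

    branch : Fin (n G) → Maybe (Fin (p + q))
    branch w with Fin.any? (λ x → owns? w (splitAt p x))
    ... | yes (x , _) = just x
    ... | no _        = nothing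

    owns⇒branch : ∀ w z → Owns w z → branch w ≡ just (join p q z)
    owns⇒branch w z o with Fin.any? (λ x → owns? w (splitAt p x))
    ... | yes (x , o′) = cong just (trans (sym (Fin.join-splitAt p q x)) (cong (join p q) (owner-unique w _ _ o′ o)))
    ... | no none = contradiction (join p q z , subst (Owns w) (sym (Fin.splitAt-join p q z)) o) none

    branch⇒owns : ∀ w x → branch w ≡ just x → Owns w (splitAt p x)
    branch⇒owns w x e with Fin.any? (λ x → owns? w (splitAt p x))
    branch⇒owns w x refl | yes (_ , o) = o

    sourceᴹ targetᴹ : Edge → Fin (p + q)
    sourceᴹ e = src e ↑ˡ q
    targetᴹ e = p ↑ʳ tgt e

    -- `EdgeList` wants every edge listed from its smaller end; laying the first class below the
    -- second in `Fin (p + q)` orients all edges alike.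
    source<target : ∀ e → toℕ (sourceᴹ e) < toℕ (targetᴹ e)
    source<target e rewrite Fin.toℕ-↑ˡ (src e) q | Fin.toℕ-↑ʳ p (tgt e) =
      ≤-trans (Fin.toℕ<n (src e)) (m≤m+n p _)

    minor : Graph
    minor = record
      { n = p + q
      ; Adj = λ x y → Any (λ e → (x ≡ sourceᴹ e × y ≡ targetᴹ e) ⊎ (y ≡ sourceᴹ e × x ≡ targetᴹ e)) es
      ; adj-sym = Any.map [ inj₂ , inj₁ ]′
      ; irrefl = λ a → let e , _ , s = find a in
          <⇒≢ (source<target e) (cong toℕ ([ (λ { (a , b) → trans (sym a) b }) , (λ { (a , b) → trans (sym a) b }) ]′ s))
      }

    depthMinor : DepthMinor r minor G
    depthMinor = branch , centred , edges
      where
      branch≡ : ∀ w x → Owns w (splitAt p x) → branch w ≡ just x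
      branch≡ w x o = trans (owns⇒branch w _ o) (cong just (Fin.join-splitAt p q x))
      centred : ∀ x → ∃[ c ] (branch c ≡ just x × (∀ v → branch v ≡ just x →
                  ∃[ k ] (k ≤ r × WalkIn G (λ w → branch w ≡ just x) c v k)))
      centred x = centre (splitAt p x) , branch≡ _ x (owns-centre _) , λ v bv →
        let k , k≤ , ω , own = owns-walk v _ (branch⇒owns v x bv)
        in k , k≤ , restrict ω (λ y y∈ → branch≡ y x (own y y∈))
      edges : ∀ x y → Adj minor x y → ∃[ u ] ∃[ v ] (branch u ≡ just x × branch v ≡ just y × Adj G u v)
      edges x y a with find a
      ... | e , e∈ , inj₁ (refl , refl) = mid e , mid′ e ,
        owns⇒branch _ (inj₁ (src e)) (inj₂ (lose e∈ (refl , end∈verts (left e)))) ,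
        owns⇒branch _ (inj₂ (tgt e)) (inj₂ (lose e∈ (refl , end∈verts (right e)))) , bridge e
      ... | e , e∈ , inj₂ (refl , refl) = mid′ e , mid e ,
        owns⇒branch _ (inj₂ (tgt e)) (inj₂ (lose e∈ (refl , end∈verts (right e)))) ,
        owns⇒branch _ (inj₁ (src e)) (inj₂ (lose e∈ (refl , end∈verts (left e)))) , adj-sym G (bridge e)

    edgesᴹ : List (Fin (p + q) × Fin (p + q))
    edgesᴹ = map (λ e → sourceᴹ e , targetᴹ e) es

    edgeList : AllPairs (λ e e′ → ends e ≢ ends e′) es → EdgeList minor edgesᴹ
    edgeList uniq =
      AllPairs.map⁺ (AllPairs.map (λ ne eq → ne (cong₂ _,_ (Fin.↑ˡ-injective q _ _ (cong proj₁ eq))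
                                                           (Fin.↑ʳ-injective p _ _ (cong proj₂ eq)))) uniq) ,
      All.map⁺ (All.tabulate (λ {e} e∈ → source<target e , lose e∈ (inj₁ (refl , refl))))

  pattern-of : Edge → Fin (n G) → Maybe Bool
  pattern-of e = prescribeAll true (verts (left e)) (prescribeAll false (verts (right e)) (λ _ → nothing))

  -- The halves have `len + 1` and `len′ + 1` vertices, and `total` bounds `len + len′ + 1` by `d`.
  pattern-free : ∀ e → n G ≤ suc d + free (pattern-of e)
  pattern-free e = begin
    n G ≡⟨ sym (free-nothing (n G)) ⟩
    free {n G} (λ _ → nothing) ≤⟨ free-prescribeAll false R _ ⟩
    length R + free (prescribeAll false R (λ _ → nothing)) ≤⟨ +-monoʳ-≤ (length R) (free-prescribeAll true L _) ⟩
    length R + (length L + φ) ≡⟨ sym (+-assoc (length R) (length L) φ) ⟩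
    (length R + length L) + φ ≤⟨ +-monoˡ-≤ φ short ⟩
    suc d + φ ∎
    where
    open ≤-Reasoning
    L = verts (left e)
    R = verts (right e)
    φ = free (pattern-of e)
    short : length R + length L ≤ suc d
    short rewrite length-verts (left e) | length-verts (right e) | +-suc (len′ e) (len e)
                | +-comm (len′ e) (len e) | sym (+-suc (len e) (len′ e)) = s≤s (total e)

  -- Every two-colouring leaves at most `b * (p + q)` survivors, by sparsity of the minor, while
  -- every edge survives in at least a fraction `1 / 2 ^ suc d` of the `2 ^ n G` colourings. Both
  -- counts concern the same pairs, and `2 ^ n G` cancels.
  edges≤ : ∀ b → (∀ M → DepthMinor r M G → ∀ es → EdgeList M es → length es ≤ b * n M) →
    ∀ es → AllPairs (λ e e′ → ends e ≢ ends e′) es → length es ≤ 2 ^ suc d * (b * (p + q))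
  edges≤ b sparse es uniq = *-cancelˡ-≤ (2 ^ n G) ⦃ m^n≢0 2 (n G) ⦄ (begin
    2 ^ n G * length es
      ≡⟨ *-comm (2 ^ n G) (length es) ⟩
    length es * 2 ^ n G
      ≡⟨ sym (Σl-const (2 ^ n G) es) ⟩
    Σl (λ _ → 2 ^ n G) es
      ≤⟨ Σl-mono (λ e → ≤-trans (^-monoʳ-≤ 2 (pattern-free e))
           (≤-reflexive (^-distribˡ-+-* 2 (suc d) (free (pattern-of e))))) es ⟩
    Σl (λ e → 2 ^ suc d * 2 ^ free (pattern-of e)) es
      ≡⟨ Σl-*ˡ (2 ^ suc d) _ es ⟩
    2 ^ suc d * Σl (λ e → 2 ^ free (pattern-of e)) es
      ≡⟨ cong (2 ^ suc d *_) (Σl-cong (λ e → sym (*-identityˡ _)) es) ⟩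
    2 ^ suc d * Σl (λ e → 1 * 2 ^ free (pattern-of e)) es
      ≤⟨ *-monoʳ-≤ (2 ^ suc d) (averaging (n G) es pattern-of (λ _ → 1) (b * (p + q)) few) ⟩
    2 ^ suc d * (2 ^ n G * (b * (p + q)))
      ≡⟨ sym (*-assoc (2 ^ suc d) (2 ^ n G) _) ⟩
    2 ^ suc d * 2 ^ n G * (b * (p + q))
      ≡⟨ cong (_* (b * (p + q))) (*-comm (2 ^ suc d) (2 ^ n G)) ⟩
    2 ^ n G * 2 ^ suc d * (b * (p + q))
      ≡⟨ *-assoc (2 ^ n G) (2 ^ suc d) _ ⟩
    2 ^ n G * (2 ^ suc d * (b * (p + q))) ∎)
    where
    open ≤-Reasoning
    survives? : (f : Fin (n G) → Bool) → ∀ e → Dec (compatible f (pattern-of e) ≡ true)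
    survives? f e = compatible f (pattern-of e) Bool.≟ true
    bit-≟ : ∀ c → bit c ≡ ⟦ c Bool.≟ true ⟧
    bit-≟ true  = refl
    bit-≟ false = refl
    few : ∀ f → Σl (λ e → 1 * bit (compatible f (pattern-of e))) es ≤ b * (p + q)
    few f = begin
      Σl (λ e → 1 * bit (compatible f (pattern-of e))) es
        ≡⟨ Σl-cong (λ e → trans (*-identityˡ _) (bit-≟ _)) es ⟩
      Σl (λ e → ⟦ survives? f e ⟧) es
        ≡⟨ sym (length-filter-Σl (survives? f) es) ⟩
      length (filter (survives? f) es)
        ≡⟨ sym (length-map _ (filter (survives? f) es)) ⟩
      length S.edgesᴹ
        ≤⟨ sparse S.minor S.depthMinor S.edgesᴹ (S.edgeList (AllPairs.filter⁺ (survives? f) uniq)) ⟩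
      b * (p + q) ∎
      where
      sat : ∀ e → e ∈ filter (survives? f) es →
        (∀ x → x ∈ verts (left e) → f x ≡ true) × (∀ x → x ∈ verts (right e) → f x ≡ false)
      sat e e∈ =
        (λ x x∈ → compatible-just f (pattern-of e) ok x (prescribeAll-∈ true _ x∈)) ,
        (λ x x∈ → compatible-just f (pattern-of e) ok x
           (trans (prescribeAll-∉ true _ (λ x∈L → disjoint e x x∈L x∈)) (prescribeAll-∈ false _ x∈)))
        where ok = proj₂ (∈-filter⁻ (survives? f) {xs = es} e∈)
      module S = Survivors f (filter (survives? f) es) sat

-- Density of powers

-- The first inequality keeps the branch sets of one side apart. The second lets a path of length
-- `d` split into two pieces of length at most `r` and the edge between them.
halve : ∀ d → ∃[ r ] (r + r ≤ d × d ≤ suc (r + r))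
halve zero = 0 , z≤n , z≤n
halve (suc zero) = 0 , z≤n , s≤s z≤n
halve (suc (suc d)) with halve d
... | r , lo , hi = suc r ,
  subst (_≤ suc (suc d)) (sym (cong suc (+-suc r r))) (s≤s (s≤s lo)) ,
  subst (suc (suc d) ≤_) (sym (cong (λ z → 2 + z) (+-suc r r))) (s≤s (s≤s hi))

lookup-injective : {A : Set} {xs : List A} → Unique xs → ∀ i j → lookup xs i ≡ lookup xs j → i ≡ j
lookup-injective (x∉ ∷ u) Fin.zero    Fin.zero    e = refl
lookup-injective (x∉ ∷ u) Fin.zero    (Fin.suc j) e = contradiction e (All.lookup x∉ (∈-lookup j))
lookup-injective (x∉ ∷ u) (Fin.suc i) Fin.zero    e = contradiction (sym e) (All.lookup x∉ (∈-lookup i))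
lookup-injective (x∉ ∷ u) (Fin.suc i) (Fin.suc j) e = cong Fin.suc (lookup-injective u i j e)

Σl-indicator : ∀ {k} (x : Fin k) c {ys} → Unique ys → x ∈ ys → Σl (λ y → ⟦ x Fin.≟ y ⟧ * c) ys ≡ c
Σl-indicator x c {y ∷ ys} (y∉ ∷ u) x∈ with x Fin.≟ y
... | yes refl = trans (cong₂ _+_ (*-identityˡ c) (zeros ys y∉)) (+-identityʳ c)
  where
  zeros : ∀ ys → All (x ≢_) ys → Σl (λ y → ⟦ x Fin.≟ y ⟧ * c) ys ≡ 0
  zeros []       []       = refl
  zeros (z ∷ zs) (ne ∷ r) with x Fin.≟ z
  ... | yes e = contradiction e ne
  ... | no _  = zeros zs r
Σl-indicator x c (y∉ ∷ u) (here e)   | no ne = contradiction e ne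
Σl-indicator x c (y∉ ∷ u) (there x∈) | no ne = Σl-indicator x c u x∈

module _ {X : Set} {k : ℕ} (f : X → Fin k) where

  class : List X → Fin k → List X
  class xs i = filter (λ x → f x Fin.≟ i) xs

  Σl-classes : ∀ (g : X → ℕ) xs → Σl g xs ≡ Σl (λ i → Σl g (class xs i)) (allFin k)
  Σl-classes g xs = sym (begin
    Σl (λ i → Σl g (class xs i)) (allFin k)
      ≡⟨ Σl-cong (λ i → Σl-filter (λ x → f x Fin.≟ i) g xs) (allFin k) ⟩
    Σl (λ i → Σl (λ x → ⟦ f x Fin.≟ i ⟧ * g x) xs) (allFin k)
      ≡⟨ Σl-swap _ (allFin k) xs ⟩
    Σl (λ x → Σl (λ i → ⟦ f x Fin.≟ i ⟧ * g x) (allFin k)) xs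
      ≡⟨ Σl-cong (λ x → Σl-indicator (f x) (g x) (Unique.allFin⁺ k) (∈-allFin (f x))) xs ⟩
    Σl g xs ∎)
    where open ≡-Reasoning

-- `Adj H` comes without a decision procedure, so edges are counted through a decidable relation `P`
-- inside it; it will be membership in the computed adjacency lists.
module PowerDensity (G H : Graph) (d r b : ℕ) (2r≤d : r + r ≤ d) (d≤2r+1 : d ≤ suc (r + r))
  (sparse : ∀ M → DepthMinor r M G → ∀ es → EdgeList M es → length es ≤ b * n M)
  (ind : InducedSub H (power G d)) (k : ℕ) (col : Colourable H k)
  (P : Fin (n H) → Fin (n H) → Set) (P? : ∀ u v → Dec (P u v)) (P⇒Adj : ∀ u v → P u v → Adj H u v) where

  φ : Fin (n H) → Fin (n G)
  φ = proj₁ ind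

  φ-injective : ∀ u v → φ u ≡ φ v → u ≡ v
  φ-injective = proj₁ (proj₂ ind)

  f : Fin (n H) → Fin k
  f = proj₁ col

  -- This is where inducedness enters: vertices of H within distance `d` in G are adjacent in H,
  -- hence differently coloured.
  far : ∀ u v → f u ≡ f v → DistLE G d (φ u) (φ v) → u ≡ v
  far u v fu≡fv δ with u Fin.≟ v
  ... | yes e = e
  ... | no ne = contradiction fu≡fv
    (proj₂ col u v (proj₂ (proj₂ (proj₂ ind)) u v ((λ e → ne (φ-injective u v e)) , δ)))

  class-far : ∀ {S} → Unique S → ∀ i a a′ →
    DistLE G d (φ (lookup (class f S i) a)) (φ (lookup (class f S i) a′)) → a ≡ a′
  class-far {S} uS i a a′ δ =
    lookup-injective (Unique.filter⁺ (λ x → f x Fin.≟ i) uS) a a′ (far _ _ (trans (colour a) (sym (colour a′))) δ)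
    where
    colour : ∀ a → f (lookup (class f S i) a) ≡ i
    colour a = proj₂ (∈-filter⁻ (λ x → f x Fin.≟ i) {xs = S} (∈-lookup a))

  edgesBetween : List (Fin (n H)) → List (Fin (n H)) → List (Fin (n H) × Fin (n H))
  edgesBetween I J = filter (λ e → P? (proj₁ e) (proj₂ e)) (cartesianProduct I J)

  countBetween : List (Fin (n H)) → List (Fin (n H)) → ℕ
  countBetween I J = Σl (λ u → Σl (λ v → ⟦ P? u v ⟧) J) I

  count≡length : ∀ I J → countBetween I J ≡ length (edgesBetween I J)
  count≡length I J = sym (trans (length-filter-Σl _ (cartesianProduct I J)) (Σl-cartesianProduct _ I J))

  edgesBetween-∈ : ∀ I J → All (λ e → proj₁ e ∈ I × proj₂ e ∈ J × P (proj₁ e) (proj₂ e)) (edgesBetween I J)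
  edgesBetween-∈ I J = All.tabulate (λ {e} e∈ →
    let e∈′ , pe = ∈-filter⁻ (λ e → P? (proj₁ e) (proj₂ e)) {xs = cartesianProduct I J} e∈
        u∈ , v∈ = ∈-cartesianProduct⁻ I J e∈′
    in u∈ , v∈ , pe)

  module TwoClasses {S : List (Fin (n H))} (uS : Unique S) (i j : Fin k) (i≢j : i ≢ j) where
    I J : List (Fin (n H))
    I = class f S i
    J = class f S j

    apart : ∀ a a′ → φ (lookup I a) ≢ φ (lookup J a′)
    apart a a′ e = i≢j (trans (sym (colour i a)) (trans (cong f (φ-injective _ _ e)) (colour j a′)))
      where
      colour : ∀ i a → f (lookup (class f S i) a) ≡ i
      colour i a = proj₂ (∈-filter⁻ (λ x → f x Fin.≟ i) {xs = S} (∈-lookup a))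

    open Bipartite G d r (length I) (length J) 2r≤d (φ ∘ lookup I) (φ ∘ lookup J) (class-far uS i) (class-far uS j) apart

    toEdge : ∀ a a′ → Adj H (lookup I a) (lookup J a′) → Edge
    toEdge a a′ adj with proj₁ (proj₂ (proj₂ ind)) _ _ adj
    ... | u≢v , k , k≤d , w with simplePath w
    ... | k′ , k′≤ , w′ , uq = edge a a′ record
      { len≤ = len≤ ; len′≤ = len′≤ ; total = ≤-trans total (≤-trans k′≤ k≤d) ; left = left ; right = right
      ; bridge = bridge ; right⊆ = right⊆ ; disjoint = disjoint }
      where open Halves (halves r r w′ uq u≢v (≤-trans (≤-trans k′≤ k≤d) d≤2r+1))

    original : Edge → Fin (n H) × Fin (n H)
    original e = lookup I (Edge.src e) , lookup J (Edge.tgt e)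

    toEdges : ∀ {l} → All (λ e → proj₁ e ∈ I × proj₂ e ∈ J × P (proj₁ e) (proj₂ e)) l →
      ∃[ es ] map original es ≡ l
    toEdges [] = [] , refl
    toEdges ((u∈ , v∈ , p) ∷ ps) with toEdges ps
    ... | es , eq = toEdge (Any.index u∈) (Any.index v∈) (subst₂ (Adj H) (lookup-index u∈) (lookup-index v∈) (P⇒Adj _ _ p)) ∷ es ,
      cong₂ _∷_ (cong₂ _,_ (sym (lookup-index u∈)) (sym (lookup-index v∈))) eq

    count≤ : countBetween I J ≤ 2 ^ suc d * (b * (length I + length J))
    count≤ with toEdges (edgesBetween-∈ I J)
    ... | es , eq = begin
      countBetween I J          ≡⟨ count≡length I J ⟩
      length (edgesBetween I J) ≡⟨ cong length (sym eq) ⟩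
      length (map original es)  ≡⟨ length-map original es ⟩
      length es                 ≤⟨ edges≤ b sparse es uniq ⟩
      2 ^ suc d * (b * (length I + length J)) ∎
      where
      open ≤-Reasoning
      unique-edges : Unique (edgesBetween I J)
      unique-edges = Unique.filter⁺ _ (Unique.cartesianProduct⁺ (Unique.filter⁺ _ uS) (Unique.filter⁺ _ uS))
      uniq : AllPairs (λ e e′ → Edge.ends e ≢ Edge.ends e′) es
      uniq = AllPairs.map (λ ne eq → ne (cong (λ { (a , a′) → lookup I a , lookup J a′ }) eq))
               (AllPairs.map⁻ (subst Unique (sym eq) unique-edges))

  count-classes≤ : ∀ {S} → Unique S → ∀ i j →
    countBetween (class f S i) (class f S j) ≤ 2 ^ suc d * (b * (length (class f S i) + length (class f S j)))
  count-classes≤ {S} uS i j with i Fin.≟ j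
  ... | no i≢j = TwoClasses.count≤ uS i j i≢j
  -- A colour class is independent, so no edge of H stays inside it.
  ... | yes refl = ≤-trans (≤-reflexive none) z≤n
    where
    none : countBetween (class f S i) (class f S i) ≡ 0
    none = trans (count≡length (class f S i) (class f S i)) (empty (edgesBetween-∈ (class f S i) (class f S i)))
      where
      empty : ∀ {l} → All (λ e → proj₁ e ∈ class f S i × proj₂ e ∈ class f S i × P (proj₁ e) (proj₂ e)) l → length l ≡ 0
      empty [] = refl
      empty ((u∈ , v∈ , p) ∷ _) = contradiction
        (trans (proj₂ (∈-filter⁻ (λ x → f x Fin.≟ i) {xs = S} u∈)) (sym (proj₂ (∈-filter⁻ (λ x → f x Fin.≟ i) {xs = S} v∈))))
        (proj₂ col _ _ (P⇒Adj _ _ p))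

  -- The left side is the sum over `S` of the `P`-degrees inside `S`. On the right, the sizes of the
  -- two classes are added over all `k * k` ordered pairs, so each class is counted `2 * k` times.
  count≤ : ∀ {S} → Unique S → countBetween S S ≤ 2 ^ suc d * (b * (2 * k * length S))
  count≤ {S} uS = begin
    countBetween S S
      ≡⟨ Σl-classes f _ S ⟩
    Σl (λ i → Σl (λ u → Σl (λ v → ⟦ P? u v ⟧) S) (c i)) K
      ≡⟨ Σl-cong (λ i → trans (Σl-cong (λ u → Σl-classes f _ S) (c i)) (Σl-swap _ (c i) K)) K ⟩
    Σl (λ i → Σl (λ j → countBetween (c i) (c j)) K) K
      ≤⟨ Σl-mono (λ i → Σl-mono (λ j → count-classes≤ uS i j) K) K ⟩
    Σl (λ i → Σl (λ j → 2 ^ suc d * (b * (length (c i) + length (c j)))) K) K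
      ≡⟨ Σl-cong (λ i → trans (Σl-*ˡ (2 ^ suc d) _ K) (cong (2 ^ suc d *_) (Σl-*ˡ b _ K))) K ⟩
    Σl (λ i → 2 ^ suc d * (b * Σl (λ j → length (c i) + length (c j)) K)) K
      ≡⟨ trans (Σl-*ˡ (2 ^ suc d) _ K) (cong (2 ^ suc d *_) (Σl-*ˡ b _ K)) ⟩
    2 ^ suc d * (b * Σl (λ i → Σl (λ j → length (c i) + length (c j)) K) K)
      ≡⟨ cong (λ z → 2 ^ suc d * (b * z)) sizes ⟩
    2 ^ suc d * (b * (2 * k * length S)) ∎
    where
    open ≤-Reasoning
    K = allFin k
    c = class f S
    |K| : length K ≡ k
    |K| = length-tabulate id
    total : Σl (λ i → length (c i)) K ≡ length S
    total = sym (trans (trans (sym (*-identityʳ (length S))) (sym (Σl-const 1 S)))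
      (trans (Σl-classes f (λ _ → 1) S) (Σl-cong (λ i → trans (Σl-const 1 (c i)) (*-identityʳ _)) K)))
    sizes : Σl (λ i → Σl (λ j → length (c i) + length (c j)) K) K ≡ 2 * k * length S
    sizes = trans (Σl-cong (λ i → trans (Σl-+ _ _ K) (cong₂ _+_ (trans (Σl-const (length (c i)) K) (cong (_* length (c i)) |K|)) total)) K)
      (trans (Σl-+ _ _ K) (trans (cong₂ _+_ (trans (Σl-*ˡ k _ K) (cong (k *_) total)) (trans (Σl-const (length S) K) (cong (_* length S) |K|)))
        (solve 2 (λ k s → k :* s :+ k :* s := con 2 :* k :* s) refl k (length S))))
      where open +-*-Solver

  minDegree≤ : ∀ {S} → Unique S → 0 < length S → ∀ t →
    (∀ u → u ∈ S → t ≤ Σl (λ v → ⟦ P? u v ⟧) S) → t ≤ 2 ^ suc d * b * 2 * k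
  minDegree≤ {S} uS pos t big = *-cancelʳ-≤ t _ (length S) ⦃ >-nonZero pos ⦄ (begin
    t * length S                           ≡⟨ *-comm t (length S) ⟩
    length S * t                           ≡⟨ sym (Σl-const t S) ⟩
    Σl (λ _ → t) S                         ≤⟨ Σl-mono-∈ S big ⟩
    countBetween S S                       ≤⟨ count≤ uS ⟩
    2 ^ suc d * (b * (2 * k * length S))   ≡⟨ solve 4 (λ a b k s → a :* (b :* (con 2 :* k :* s)) := a :* b :* con 2 :* k :* s) refl (2 ^ suc d) b k (length S) ⟩
    2 ^ suc d * b * 2 * k * length S       ∎)
    where
    open ≤-Reasoning
    open +-*-Solver

-- Structured code for the random access machine

data Op : Set where
  _≔#_   : ℕ → ℕ → Op
  _≔_⊞_  : ℕ → ℕ → ℕ → Op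
  _≔_⊟_  : ℕ → ℕ → ℕ → Op
  _≔*_   : ℕ → ℕ → Op
  *_≔_   : ℕ → ℕ → Op

instr : Op → Instr
instr (i ≔# c)    = const i c
instr (i ≔ j ⊞ k) = add i j k
instr (i ≔ j ⊟ k) = sub i j k
instr (i ≔* j)    = load i j
instr (* i ≔ j)   = store i j

effect : Op → (ℕ → ℕ) → ℕ → ℕ
effect (i ≔# c)    m = update m i c
effect (i ≔ j ⊞ k) m = update m i (m j + m k)
effect (i ≔ j ⊟ k) m = update m i (m j ∸ m k)
effect (i ≔* j)    m = update m i (m (m j))
effect (* i ≔ j)   m = update m (m i) (m j)

effects : List Op → (ℕ → ℕ) → ℕ → ℕ
effects []       m = m
effects (o ∷ os) m = effects os (effect o m)

effects-++ : ∀ os os′ m → effects (os ++ os′) m ≡ effects os′ (effects os m)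
effects-++ []       os′ m = refl
effects-++ (o ∷ os) os′ m = effects-++ os os′ (effect o m)

infixr 5 _⨟_

-- The shapes follow the only jump of the machine: `unless i j c` skips `c` if register `i` is below
-- register `j`, and `repeat c i j` runs `c` before its first test and again as long as register `i`
-- is below register `j`.
data Code : Set where
  ops    : List Op → Code
  _⨟_    : Code → Code → Code
  unless : ℕ → ℕ → Code → Code
  repeat : Code → ℕ → ℕ → Code

-- Jump targets are absolute, so the address of the first instruction is a parameter.
compile : ℕ → Code → Program
compile p (ops os)       = map instr os
compile p (c ⨟ c′)       = compile p c ++ compile (p + length (compile p c)) c′
compile p (unless i j c) = jmpLt i j (suc p + length (compile (suc p) c)) ∷ compile (suc p) c
compile p (repeat c i j) = compile p c ++ jmpLt i j p ∷ []

data Runs : Code → (ℕ → ℕ) → (ℕ → ℕ) → ℕ → Set where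
  r-ops   : ∀ {os m} → Runs (ops os) m (effects os m) (length os)
  r-seq   : ∀ {c c′ m m₁ m₂ t₁ t₂} → Runs c m m₁ t₁ → Runs c′ m₁ m₂ t₂ → Runs (c ⨟ c′) m m₂ (t₁ + t₂)
  r-skip  : ∀ {i j c m} → (m i <ᵇ m j) ≡ true → Runs (unless i j c) m m 1
  r-enter : ∀ {i j c m m′ t} → (m i <ᵇ m j) ≡ false → Runs c m m′ t → Runs (unless i j c) m m′ (suc t)
  r-last  : ∀ {i j c m m′ t} → Runs c m m′ t → (m′ i <ᵇ m′ j) ≡ false → Runs (repeat c i j) m m′ (t + 1)
  r-again : ∀ {i j c m m₁ m′ t t′} → Runs c m m₁ t → (m₁ i <ᵇ m₁ j) ≡ true →
            Runs (repeat c i j) m₁ m′ t′ → Runs (repeat c i j) m m′ (t + suc t′)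

data Steps (P : Program) : State → ℕ → State → Set where
  done : ∀ {s} → Steps P s 0 s
  next : ∀ {s s₁ s′ t} → stepRAM P s ≡ just s₁ → Steps P s₁ t s′ → Steps P s (suc t) s′

steps-++ : ∀ {P s s₁ s₂ t t′} → Steps P s t s₁ → Steps P s₁ t′ s₂ → Steps P s (t + t′) s₂
steps-++ done        ss = ss
steps-++ (next e s) ss = next e (steps-++ s ss)

-- `run` looks for a halt before it looks at its budget, so every budget from `t` on gives the same
-- answer.
run-Steps : ∀ {P s s′ t} T → Steps P s t s′ → stepRAM P s′ ≡ nothing → t ≤ T → run P T s ≡ just s′
run-Steps {P} {s} T done stop _ with stepRAM P s | stop
run-Steps {P} {s} zero    done stop _ | nothing | refl = refl
run-Steps {P} {s} (suc T) done stop _ | nothing | refl = refl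
run-Steps {P} {s} (suc T) (next e ss) stop (s≤s t≤) with stepRAM P s | e
... | just s₁ | refl = run-Steps T ss stop t≤

Located : Program → ℕ → List Instr → Set
Located P p []       = ⊤
Located P p (x ∷ xs) = nth P p ≡ just x × Located P (suc p) xs

located-++ˡ : ∀ P p xs {ys} → Located P p (xs ++ ys) → Located P p xs
located-++ˡ P p []       l       = tt
located-++ˡ P p (x ∷ xs) (e , l) = e , located-++ˡ P (suc p) xs l

located-++ʳ : ∀ P p xs {ys} → Located P p (xs ++ ys) → Located P (p + length xs) ys
located-++ʳ P p []       l       rewrite +-identityʳ p = l
located-++ʳ P p (x ∷ xs) (e , l) rewrite +-suc p (length xs) = located-++ʳ P (suc p) xs l

nth-++ : ∀ {A : Set} (ps xs : List A) k → nth (ps ++ xs) (length ps + k) ≡ nth xs k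
nth-++ []       xs k = refl
nth-++ (p ∷ ps) xs k = nth-++ ps xs k

located-suffix : ∀ ps xs → Located (ps ++ xs) (length ps) xs
located-suffix ps []       = tt
located-suffix ps (x ∷ xs) =
  trans (cong (nth (ps ++ x ∷ xs)) (sym (+-identityʳ (length ps)))) (nth-++ ps (x ∷ xs) 0) ,
  subst₂ (λ P p → Located P p xs) (++-assoc ps (x ∷ []) xs)
    (trans (length-++ ps) (+-comm (length ps) 1)) (located-suffix (ps ++ x ∷ []) xs)

nth-end : ∀ {A : Set} (xs : List A) → nth xs (length xs) ≡ nothing
nth-end []       = refl
nth-end (x ∷ xs) = nth-end xs

step-op : ∀ P o p m → nth P p ≡ just (instr o) → stepRAM P ⟨ p , m ⟩ ≡ just ⟨ suc p , effect o m ⟩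
step-op P (i ≔# c)    p m e rewrite e = refl
step-op P (i ≔ j ⊞ k) p m e rewrite e = refl
step-op P (i ≔ j ⊟ k) p m e rewrite e = refl
step-op P (i ≔* j)    p m e rewrite e = refl
step-op P (* i ≔ j)   p m e rewrite e = refl

step-jump : ∀ P i j l p m {b} → nth P p ≡ just (jmpLt i j l) → (m i <ᵇ m j) ≡ b →
  stepRAM P ⟨ p , m ⟩ ≡ just ⟨ (if b then l else suc p) , m ⟩
step-jump P i j l p m e e′ rewrite e | e′ = refl

steps-ops : ∀ P p os m → Located P p (map instr os) →
  Steps P ⟨ p , m ⟩ (length os) ⟨ p + length (map instr os) , effects os m ⟩
steps-ops P p [] m l rewrite +-identityʳ p = done
steps-ops P p (o ∷ os) m (e , l) rewrite +-suc p (length (map instr os)) =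
  next (step-op P o p m e) (steps-ops P (suc p) os (effect o m) l)

compile-correct : ∀ {c m m′ t} → Runs c m m′ t → ∀ P p → Located P p (compile p c) →
  Steps P ⟨ p , m ⟩ t ⟨ p + length (compile p c) , m′ ⟩
compile-correct (r-ops {os} {m}) P p l = steps-ops P p os m l
compile-correct (r-seq {c} {c′} {m₁ = m₁} {m₂} {t₂ = t₂} R R′) P p l = steps-++
  (compile-correct R P p (located-++ˡ P p (compile p c) l))
  (subst (λ z → Steps P ⟨ p + length (compile p c) , m₁ ⟩ t₂ ⟨ z , m₂ ⟩)
    (trans (+-assoc p (length (compile p c)) _) (cong (p +_) (sym (length-++ (compile p c)))))
    (compile-correct R′ P (p + length (compile p c)) (located-++ʳ P p (compile p c) l)))
compile-correct (r-skip {i} {j} {c} {m} lt) P p (e , l) rewrite +-suc p (length (compile (suc p) c)) =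
  next (step-jump P i j _ p m e lt) done
compile-correct (r-enter {i} {j} {c} {m} nlt R) P p (e , l) rewrite +-suc p (length (compile (suc p) c)) =
  next (step-jump P i j _ p m e nlt) (compile-correct R P (suc p) l)
compile-correct (r-last {i} {j} {c} {m} {m′} {t} R nlt) P p l
  rewrite length-++ (compile p c) {jmpLt i j p ∷ []} | sym (+-assoc p (length (compile p c)) 1)
        | +-comm (p + length (compile p c)) 1 = steps-++
  (compile-correct R P p (located-++ˡ P p (compile p c) l))
  (next (step-jump P i j p _ m′ (proj₁ (located-++ʳ P p (compile p c) l)) nlt) done)
compile-correct (r-again {i} {j} {c} {m₁ = m₁} R lt R′) P p l = steps-++
  (compile-correct R P p (located-++ˡ P p (compile p c) l))
  (next (step-jump P i j p _ m₁ (proj₁ (located-++ʳ P p (compile p c) l)) lt) (compile-correct R′ P p l))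

-- Variables and arrays

data Var : Set where
  size bound arcp vu vv node tmp lvl ent pend stk stamp colr mark′ ctr : Var

-- Registers 0 to 2 are reserved. `size` and `bound` sit where the loading code leaves the number of
-- vertices and twice the number of edges.
reg : Var → ℕ
reg size  = 3
reg bound = 4
reg arcp  = 6
reg vu    = 7
reg vv    = 8
reg node  = 9
reg tmp   = 10
reg lvl   = 11
reg ent   = 12
reg pend  = 13
reg stk   = 14
reg stamp = 15
reg colr  = 16
reg mark′ = 17
reg ctr   = 18

#regs : ℕ
#regs = 19

reg≥3 : ∀ x → 3 ≤ reg x
reg≥3 x = ≤ᵇ⇒≤ 3 (reg x) (check x)
  where
  check : ∀ x → Bool.T (2 <ᵇ reg x)
  check size  = tt
  check bound = tt
  check arcp  = tt
  check vu    = tt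
  check vv    = tt
  check node  = tt
  check tmp   = tt
  check lvl   = tt
  check ent   = tt
  check pend  = tt
  check stk   = tt
  check stamp = tt
  check colr  = tt
  check mark′ = tt
  check ctr   = tt

reg< : ∀ x → reg x < #regs
reg< x = ≤ᵇ⇒≤ (suc (reg x)) #regs (check x)
  where
  check : ∀ x → Bool.T (reg x <ᵇ #regs)
  check size  = tt
  check bound = tt
  check arcp  = tt
  check vu    = tt
  check vv    = tt
  check node  = tt
  check tmp   = tt
  check lvl   = tt
  check ent   = tt
  check pend  = tt
  check stk   = tt
  check stamp = tt
  check colr  = tt
  check mark′ = tt
  check ctr   = tt

data Arr : Set where
  input arcHead arcNext arcTo degree bktHead bktNext bktVal removed order marks colour : Arr

-- With slot 0 for `input`, the condition `0 < slot a` singles out the arrays that start blank. The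
-- slot 11 of `colour` reappears as a literal in the output code.
slot : Arr → ℕ
slot input   = 0
slot arcHead = 1
slot arcNext = 2
slot arcTo   = 3
slot degree  = 4
slot bktHead = 5
slot bktNext = 6
slot bktVal  = 7
slot removed = 8
slot order   = 9
slot marks   = 10
slot colour  = 11

slot< : ∀ a → slot a < 16
slot< a = ≤ᵇ⇒≤ (suc (slot a)) 16 (check a)
  where
  check : ∀ a → Bool.T (slot a <ᵇ 16)
  check input   = tt
  check arcHead = tt
  check arcNext = tt
  check arcTo   = tt
  check degree  = tt
  check bktHead = tt
  check bktNext = tt
  check bktVal  = tt
  check removed = tt
  check order   = tt
  check marks   = tt
  check colour  = tt

record Store : Set where
  field
    sc : Var → ℕ
    ar : Arr → ℕ → ℕ
open Store public

-- Variables are compared through `reg`, by the very test that `update` makes on the memory. For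
-- closed variables the test reduces, so a read after a write holds by computation.
setVar : Store → Var → ℕ → Store
setVar s x v = record { sc = λ y → if reg y ≡ᵇ reg x then v else sc s y ; ar = ar s }

setArr : Store → Arr → ℕ → ℕ → Store
setArr s a i v = record { sc = sc s ; ar = λ b → if slot b ≡ᵇ slot a then update (ar s b) i v else ar s b }

data Stmt : Set where
  _:=#_    : Var → ℕ → Stmt
  _:=_⊕_   : Var → Var → Var → Stmt
  _:=_⊖_   : Var → Var → Var → Stmt
  _:=_⊕#_  : Var → Var → ℕ → Stmt
  _:=_⊖#_  : Var → Var → ℕ → Stmt
  _:=_!_   : Var → Arr → Var → Stmt
  _!_:=_   : Arr → Var → Var → Stmt

exec₁ : Stmt → Store → Store
exec₁ (x :=# c)       s = setVar s x c
exec₁ (x := y ⊕ z)   s = setVar s x (sc s y + sc s z)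
exec₁ (x := y ⊖ z)   s = setVar s x (sc s y ∸ sc s z)
exec₁ (x := y ⊕# c)  s = setVar s x (sc s y + c)
exec₁ (x := y ⊖# c)  s = setVar s x (sc s y ∸ c)
exec₁ (x := a ! y) s = setVar s x (ar s a (sc s y))
exec₁ (a ! y := x)  s = setArr s a (sc s y) (sc s x)

exec : List Stmt → Store → Store
exec []       s = s
exec (o ∷ os) s = exec os (exec₁ o s)

infixr 5 _▸_

data Cmd : Set where
  blk      : List Stmt → Cmd
  _▸_      : Cmd → Cmd → Cmd
  whenPos  : Var → Cmd → Cmd
  whilePos : Var → Cmd → Cmd

data _⊢_⇒_#_ : Cmd → Store → Store → ℕ → Set where
  e-blk   : ∀ {os s} → blk os ⊢ s ⇒ exec os s # length os
  e-seq   : ∀ {c c′ s s₁ s₂ t₁ t₂} → c ⊢ s ⇒ s₁ # t₁ → c′ ⊢ s₁ ⇒ s₂ # t₂ → (c ▸ c′) ⊢ s ⇒ s₂ # (t₁ + t₂)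
  e-skip  : ∀ {x c s} → sc s x ≡ 0 → whenPos x c ⊢ s ⇒ s # 1
  e-when  : ∀ {x c s s′ t} → 0 < sc s x → c ⊢ s ⇒ s′ # t → whenPos x c ⊢ s ⇒ s′ # suc t
  e-exit  : ∀ {x c s} → sc s x ≡ 0 → whilePos x c ⊢ s ⇒ s # 1
  e-while : ∀ {x c s s₁ s′ t t′} → 0 < sc s x → c ⊢ s ⇒ s₁ # t → whilePos x c ⊢ s₁ ⇒ s′ # t′ →
            whilePos x c ⊢ s ⇒ s′ # suc (t + t′)

-- Registers 0 and 1 are scratch and register 2 holds the base W of the arrays, which are
-- interleaved: entry i of an array with slot k lives at W + 16 * i + k.
double : ℕ → ℕ
double i = i + i

addr : ℕ → Arr → ℕ → ℕ
addr W a i = (double (double (double (double i))) + W) + slot a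

addrOps : Arr → Var → List Op
addrOps a y = (0 ≔ reg y ⊞ reg y) ∷ (0 ≔ 0 ⊞ 0) ∷ (0 ≔ 0 ⊞ 0) ∷ (0 ≔ 0 ⊞ 0) ∷ (0 ≔ 0 ⊞ 2) ∷
              (1 ≔# slot a) ∷ (0 ≔ 0 ⊞ 1) ∷ []

implement₁ : Stmt → List Op
implement₁ (x :=# c)       = (reg x ≔# c) ∷ []
implement₁ (x := y ⊕ z)   = (reg x ≔ reg y ⊞ reg z) ∷ []
implement₁ (x := y ⊖ z)   = (reg x ≔ reg y ⊟ reg z) ∷ []
implement₁ (x := y ⊕# c)  = (1 ≔# c) ∷ (reg x ≔ reg y ⊞ 1) ∷ []
implement₁ (x := y ⊖# c)  = (1 ≔# c) ∷ (reg x ≔ reg y ⊟ 1) ∷ []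
implement₁ (x := a ! y) = addrOps a y ++ (reg x ≔* 0) ∷ []
implement₁ (a ! y := x)  = addrOps a y ++ (* 0 ≔ reg x) ∷ []

implement : List Stmt → List Op
implement = concatMap implement₁

translate : Cmd → Code
translate (blk os)       = ops (implement os)
translate (c ▸ c′)       = translate c ⨟ translate c′
translate (whenPos x c)  = ops ((1 ≔# 1) ∷ []) ⨟ unless (reg x) 1 (translate c)
-- Both tests use register 1, which the body may overwrite: it is set to 1 for the entry test
-- `x < 1`, and to 0 after each round for the repetition test `0 < x`.
translate (whilePos x c) = ops ((1 ≔# 1) ∷ []) ⨟ unless (reg x) 1
  (repeat (translate c ⨟ ops ((1 ≔# 0) ∷ [])) 1 (reg x))

record Represents (W : ℕ) (m : ℕ → ℕ) (s : Store) : Set where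
  field
    base    : m 2 ≡ W
    scalars : ∀ x → m (reg x) ≡ sc s x
    arrays  : ∀ a i → m (addr W a i) ≡ ar s a i
open Represents

≡ᵇ-refl : ∀ i → (i ≡ᵇ i) ≡ true
≡ᵇ-refl zero    = refl
≡ᵇ-refl (suc i) = ≡ᵇ-refl i

≢⇒≡ᵇ : ∀ {i j} → i ≢ j → (i ≡ᵇ j) ≡ false
≢⇒≡ᵇ {zero}  {zero}  ne = contradiction refl ne
≢⇒≡ᵇ {zero}  {suc j} ne = refl
≢⇒≡ᵇ {suc i} {zero}  ne = refl
≢⇒≡ᵇ {suc i} {suc j} ne = ≢⇒≡ᵇ (λ e → ne (cong suc e))

update-≡ : ∀ m i v → update m i v i ≡ v
update-≡ m i v rewrite ≡ᵇ-refl i = refl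

update-≢ : ∀ m {i j} v → j ≢ i → update m i v j ≡ m j
update-≢ m v ne rewrite ≢⇒≡ᵇ ne = refl

-- Slots are below the stride 16, so the slot is the remainder modulo 16.
slot-injective : ∀ {a b} i j → slot a + i * 16 ≡ slot b + j * 16 → slot a ≡ slot b × i ≡ j
slot-injective {a} {b} i j e = s , *-cancelʳ-≡ i j 16 (+-cancelˡ-≡ (slot a) _ _ (trans e (cong (_+ j * 16) (sym s))))
  where
  s : slot a ≡ slot b
  s = trans (sym (trans ([m+kn]%n≡m%n (slot a) i 16) (m<n⇒m%n≡m (slot< a))))
        (trans (cong (_% 16) e) (trans ([m+kn]%n≡m%n (slot b) j 16) (m<n⇒m%n≡m (slot< b))))

addr≡ : ∀ W a i → addr W a i ≡ W + (slot a + i * 16)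
addr≡ W a i = solve 3 (λ W s i → let d = λ z → z :+ z in
  (d (d (d (d i))) :+ W) :+ s ⊜ W :+ (s :+ i :* con 16)) refl W (slot a) i
  where open +-*-Solver using (solve; _:+_; _:*_; con) renaming (_:=_ to _⊜_)

addr-injective : ∀ W {a b} i j → addr W a i ≡ addr W b j → slot a ≡ slot b × i ≡ j
addr-injective W {a} {b} i j e =
  slot-injective {a} {b} i j (+-cancelˡ-≡ W _ _ (trans (sym (addr≡ W a i)) (trans e (addr≡ W b j))))

W≤addr : ∀ W a i → W ≤ addr W a i
W≤addr W a i = subst (W ≤_) (sym (addr≡ W a i)) (m≤m+n W _)

module Simulation (W : ℕ) (W≥ : #regs ≤ W) where

  low≢addr : ∀ {i} a j → i < #regs → addr W a j ≢ i
  low≢addr a j i< e = <⇒≱ (≤-trans i< W≥) (subst (W ≤_) e (W≤addr W a j))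

  scratch : ∀ {m s i} v → i < 2 → Represents W m s → Represents W (update m i v) s
  scratch {m} v i<2 R = record
    { base    = trans (update-≢ m v (λ e → <⇒≢ i<2 (sym e))) (base R)
    ; scalars = λ x → trans (update-≢ m v (λ e → <⇒≢ (≤-trans i<2 (≤-trans (n≤1+n 2) (reg≥3 x))) (sym e))) (scalars R x)
    ; arrays  = λ a j → trans (update-≢ m v (low≢addr a j (≤-trans i<2 (s≤s (s≤s z≤n))))) (arrays R a j)
    }

  setVar-rep : ∀ {m s} x {v v′} → v ≡ v′ → Represents W m s → Represents W (update m (reg x) v) (setVar s x v′)
  setVar-rep {m} {s} x {v} refl R = record
    { base    = trans (update-≢ m v (<⇒≢ (reg≥3 x))) (base R)
    ; scalars = λ y → cong (λ z → if reg y ≡ᵇ reg x then v else z) (scalars R y)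
    ; arrays  = λ a j → trans (update-≢ m v (low≢addr a j (reg< x))) (arrays R a j)
    }

  setArr-rep : ∀ {m s} a i {l v v′} → l ≡ addr W a i → v ≡ v′ → Represents W m s →
    Represents W (update m l v) (setArr s a i v′)
  setArr-rep {m} {s} a i {l} {v} refl refl R = record
    { base    = trans (update-≢ m v (λ e → low≢addr a i (s≤s (s≤s (s≤s z≤n))) (sym e))) (base R)
    ; scalars = λ x → trans (update-≢ m v (λ e → low≢addr a i (reg< x) (sym e))) (scalars R x)
    ; arrays  = arrays′
    }
    where
    arrays′ : ∀ b j → update m (addr W a i) v (addr W b j) ≡ ar (setArr s a i v) b j
    arrays′ b j with slot b ≟ slot a
    ... | no ne rewrite ≢⇒≡ᵇ ne = trans (update-≢ m v (λ e → ne (proj₁ (addr-injective W {b} {a} j i e)))) (arrays R b j)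
    ... | yes e rewrite trans (cong (_≡ᵇ slot a) e) (≡ᵇ-refl (slot a)) with j ≟ i
    ... | yes refl rewrite ≡ᵇ-refl j | e = update-≡ m (addr W a j) v
    ... | no j≢ rewrite ≢⇒≡ᵇ j≢ = trans (update-≢ m v (λ e′ → j≢ (proj₂ (addr-injective W {b} {a} j i e′)))) (arrays R b j)

  rep-addr : ∀ {m s} a y → Represents W m s →
    Represents W (effects (addrOps a y) m) s × effects (addrOps a y) m 0 ≡ addr W a (sc s y)
  rep-addr {m} {s} a y R =
    scratch _ z<s (scratch _ (s≤s z<s) (scratch _ z<s (scratch _ z<s (scratch _ z<s (scratch _ z<s (scratch _ z<s R)))))) ,
    cong (_+ slot a) (cong₂ _+_ (cong (λ z → double (double (double (double z)))) (scalars R y)) (base R))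


  implement₁-correct : ∀ o {m s} → Represents W m s → Represents W (effects (implement₁ o) m) (exec₁ o s)
  implement₁-correct (x :=# c)       R = setVar-rep x refl R
  implement₁-correct (x := y ⊕ z)   R = setVar-rep x (cong₂ _+_ (scalars R y) (scalars R z)) R
  implement₁-correct (x := y ⊖ z)   R = setVar-rep x (cong₂ _∸_ (scalars R y) (scalars R z)) R
  implement₁-correct (x := y ⊕# c) {m} R = let R′ = scratch c (s≤s z<s) R in
    setVar-rep x (cong (_+ c) (scalars R′ y)) R′
  implement₁-correct (x := y ⊖# c) {m} R = let R′ = scratch c (s≤s z<s) R in
    setVar-rep x (cong (_∸ c) (scalars R′ y)) R′
  implement₁-correct (x := a ! y) {m} {s} R rewrite effects-++ (addrOps a y) ((reg x ≔* 0) ∷ []) m =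
    let R′ , e = rep-addr a y R in
    setVar-rep x (trans (cong (effects (addrOps a y) m) e) (arrays R′ a (sc s y))) R′
  implement₁-correct (a ! y := x) {m} {s} R rewrite effects-++ (addrOps a y) ((* 0 ≔ reg x) ∷ []) m =
    let R′ , e = rep-addr a y R in setArr-rep a (sc s y) e (scalars R′ x) R′

  implement-correct : ∀ os {m s} → Represents W m s → Represents W (effects (implement os) m) (exec os s)
  implement-correct []       R = R
  implement-correct (o ∷ os) {m} {s} R rewrite effects-++ (implement₁ o) (implement os) m =
    implement-correct os (implement₁-correct o R)

  -- An array access takes the seven operations of `addrOps` and the access itself; this is the
  -- factor 8 between the two time scales.
  length-implement₁ : ∀ o → length (implement₁ o) ≤ 8
  length-implement₁ (x :=# c)       = s≤s z≤n
  length-implement₁ (x := y ⊕ z)   = s≤s z≤n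
  length-implement₁ (x := y ⊖ z)   = s≤s z≤n
  length-implement₁ (x := y ⊕# c)  = s≤s (s≤s z≤n)
  length-implement₁ (x := y ⊖# c)  = s≤s (s≤s z≤n)
  length-implement₁ (x := a ! y) = ≤-refl
  length-implement₁ (a ! y := x)  = ≤-refl

  length-implement : ∀ os → length (implement os) ≤ length os * 8
  length-implement []       = z≤n
  length-implement (o ∷ os) = subst (_≤ 8 + length os * 8) (sym (length-++ (implement₁ o)))
    (+-mono-≤ (length-implement₁ o) (length-implement os))

  positive⇒not-<1 : ∀ {i} → 0 < i → (i <ᵇ 1) ≡ false
  positive⇒not-<1 (s≤s _) = refl

  positive⇒0<ᵇ : ∀ {i} → 0 < i → (0 <ᵇ i) ≡ true
  positive⇒0<ᵇ (s≤s _) = refl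

  test-zero : ∀ {m s x} → Represents W m s → sc s x ≡ 0 → ∀ c → (update m 1 (suc c) (reg x) <ᵇ suc c) ≡ true
  test-zero {x = x} R e c rewrite scalars (scratch (suc c) (s≤s z<s) R) x | e = refl

  test-pos : ∀ {m s x} → Represents W m s → 0 < sc s x → (update m 1 1 (reg x) <ᵇ 1) ≡ false
  test-pos {x = x} R p rewrite scalars (scratch 1 (s≤s z<s) R) x = positive⇒not-<1 p

  Simulated : Cmd → (ℕ → ℕ) → Store → ℕ → Set
  Simulated c m s′ t = ∃[ m′ ] ∃[ t′ ] (Runs (translate c) m m′ t′ × Represents W m′ s′ × t′ ≤ t * 8)

  simulate : ∀ {c m s s′ t} → c ⊢ s ⇒ s′ # t → Represents W m s → Simulated c m s′ t
  -- The source tests before a round and the machine after it, so a loop already entered is treated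
  -- apart: one round in the source together with the loop after it is one `repeat`. A test is one
  -- unit in the source, worth 8 machine steps, and costs two instructions here.
  simulate-loop : ∀ {x c m s s₁ s′ t t′} → c ⊢ s ⇒ s₁ # t → whilePos x c ⊢ s₁ ⇒ s′ # t′ → Represents W m s →
    ∃[ m′ ] ∃[ u ] (Runs (repeat (translate c ⨟ ops ((1 ≔# 0) ∷ [])) 1 (reg x)) m m′ u × Represents W m′ s′ × u + 6 ≤ (t + t′) * 8)

  simulate (e-blk {os}) R = _ , _ , r-ops , implement-correct os R , length-implement os
  simulate (e-seq {t₁ = t₁} {t₂} E E′) R with simulate E R
  ... | _ , _ , r , R₁ , le with simulate E′ R₁
  ... | _ , _ , r′ , R₂ , le′ = _ , _ , r-seq r r′ , R₂ ,
    ≤-trans (+-mono-≤ le le′) (≤-reflexive (sym (*-distribʳ-+ 8 t₁ t₂)))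
  simulate (e-skip z) R = _ , _ , r-seq r-ops (r-skip (test-zero R z 0)) , scratch 1 (s≤s z<s) R , s≤s (s≤s z≤n)
  simulate (e-when p E) R with simulate E (scratch 1 (s≤s z<s) R)
  ... | _ , _ , r , R₁ , le = _ , _ , r-seq r-ops (r-enter (test-pos R p) r) , R₁ ,
    +-mono-≤ (s≤s (s≤s (z≤n {6}))) le
  simulate (e-exit z) R = _ , _ , r-seq r-ops (r-skip (test-zero R z 0)) , scratch 1 (s≤s z<s) R , s≤s (s≤s z≤n)
  simulate (e-while p E E′) R with simulate-loop E E′ (scratch 1 (s≤s z<s) R)
  ... | _ , _ , r , R₁ , le = _ , _ , r-seq r-ops (r-enter (test-pos R p) r) , R₁ ,
    +-mono-≤ (s≤s (s≤s (z≤n {6}))) (≤-trans (m≤m+n _ 6) le)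

  simulate-loop {x} {t = t} E (e-exit z) R with simulate E R
  ... | m₁ , u , r , R₁ , le = _ , _ , r-last (r-seq r r-ops) last , scratch 0 (s≤s z<s) R₁ ,
    subst (_≤ (t + 1) * 8) (sym (trans (cong (_+ 6) (+-assoc u 1 1)) (+-assoc u 2 6)))
      (≤-trans (+-monoˡ-≤ 8 le) (≤-reflexive (sym (*-distribʳ-+ 8 t 1))))
    where
    last : (update m₁ 1 0 1 <ᵇ update m₁ 1 0 (reg x)) ≡ false
    last rewrite scalars (scratch 0 (s≤s z<s) R₁) x | z = refl
  simulate-loop {x} {t = t} E (e-while {t = t₁} {t₂} p E₁ E₂) R with simulate E R
  ... | m₁ , u , r , R₁ , le with simulate-loop E₁ E₂ (scratch 0 (s≤s z<s) R₁)
  ... | m₂ , u′ , r′ , R₂ , le′ = _ , _ , r-again (r-seq r r-ops) again r′ , R₂ , (begin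
    u + 1 + suc u′ + 6 ≡⟨ solve 2 (λ u v → u :+ con 1 :+ (con 1 :+ v) :+ con 6 ⊜ u :+ (con 2 :+ (v :+ con 6))) refl u u′ ⟩
    u + (2 + (u′ + 6)) ≤⟨ +-mono-≤ le (+-mono-≤ (s≤s (s≤s (z≤n {6}))) le′) ⟩
    t * 8 + (8 + (t₁ + t₂) * 8) ≡⟨ sym (*-distribʳ-+ 8 t (suc (t₁ + t₂))) ⟩
    (t + suc (t₁ + t₂)) * 8 ∎)
    where
    open ≤-Reasoning
    open +-*-Solver using (solve; _:+_; con) renaming (_:=_ to _⊜_)
    again : (update m₁ 1 0 1 <ᵇ update m₁ 1 0 (reg x)) ≡ true
    again rewrite scalars (scratch 0 (s≤s z<s) R₁) x = positive⇒0<ᵇ p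

-- Running time of commands

_⊢_⟶[_]_ : Cmd → Store → ℕ → (Store → Set) → Set
c ⊢ s ⟶[ b ] Q = ∃[ s′ ] ∃[ t ] (c ⊢ s ⇒ s′ # t × t ≤ b × Q s′)

t-blk : ∀ os {s Q} → Q (exec os s) → blk os ⊢ s ⟶[ length os ] Q
t-blk os q = _ , _ , e-blk , ≤-refl , q

t-seq : ∀ {c c′ s b b′ P Q} → c ⊢ s ⟶[ b ] P → (∀ s′ → P s′ → c′ ⊢ s′ ⟶[ b′ ] Q) → (c ▸ c′) ⊢ s ⟶[ b + b′ ] Q
t-seq (s₁ , t₁ , E , le , p) f with f s₁ p
... | s₂ , t₂ , E′ , le′ , q = s₂ , _ , e-seq E E′ , +-mono-≤ le le′ , q

t-≤ : ∀ {c s b b′ Q} → b ≤ b′ → c ⊢ s ⟶[ b ] Q → c ⊢ s ⟶[ b′ ] Q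
t-≤ le (s′ , t , E , le′ , q) = s′ , t , E , ≤-trans le′ le , q

t-map : ∀ {c s b P Q} → (∀ {s′} → P s′ → Q s′) → c ⊢ s ⟶[ b ] P → c ⊢ s ⟶[ b ] Q
t-map f (s′ , t , E , le , p) = s′ , t , E , le , f p

t-skip : ∀ {x c s} {Q : Store → Set} → sc s x ≡ 0 → Q s → whenPos x c ⊢ s ⟶[ 1 ] Q
t-skip z q = _ , _ , e-skip z , ≤-refl , q

t-when : ∀ {x c s b Q} → 0 < sc s x → c ⊢ s ⟶[ b ] Q → whenPos x c ⊢ s ⟶[ suc b ] Q
t-when p (s′ , t , E , le , q) = s′ , _ , e-when p E , s≤s le , q

-- For loops whose rounds are known beforehand: the invariant is indexed by the items still to be
-- processed, and each round pays for one test besides its body.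
while-list : ∀ {A : Set} x c (κ : A → ℕ) (I : List A → Store → Set) →
  (∀ s → I [] s → sc s x ≡ 0) →
  (∀ y ys s → I (y ∷ ys) s → 0 < sc s x × c ⊢ s ⟶[ κ y ] I ys) →
  ∀ ys s → I ys s → whilePos x c ⊢ s ⟶[ suc (Σl (λ y → suc (κ y)) ys) ] I []
while-list x c κ I z f [] s i = s , _ , e-exit (z s i) , ≤-refl , i
while-list x c κ I z f (y ∷ ys) s i with f y ys s i
... | pos , s₁ , t₁ , E₁ , le₁ , i₁ with while-list x c κ I z f ys s₁ i₁
... | s₂ , t₂ , E₂ , le₂ , i₂ = s₂ , _ , e-while pos E₁ E₂ ,
  s≤s (≤-trans (+-mono-≤ le₁ le₂) (≤-reflexive (+-suc (κ y) _))) , i₂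

-- For amortised bounds: the potential must drop by more than the cost of the body, the extra unit
-- paying for the test. The final potential is irrelevant to the bound and stays existential.
while-potential : ∀ x c (I : ℕ → Store → Set) →
  (∀ p s → I p s → 0 < sc s x → ∃[ b ] ∃[ p′ ] (b + p′ < p × c ⊢ s ⟶[ b ] I p′)) →
  ∀ p s → I p s → whilePos x c ⊢ s ⟶[ suc p ] (λ s′ → sc s′ x ≡ 0 × ∃[ p′ ] I p′ s′)
while-potential x c I f p s i = go p s i (<-wellFounded p)
  where
  go : ∀ p s → I p s → Acc _<_ p → whilePos x c ⊢ s ⟶[ suc p ] (λ s′ → sc s′ x ≡ 0 × ∃[ p′ ] I p′ s′)
  go p s i (acc rec) with sc s x in eq
  ... | zero = s , _ , e-exit eq , s≤s z≤n , eq , p , i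
  ... | suc _ with f p s i (subst (0 <_) (sym eq) z<s)
  ... | b , p′ , lt , s₁ , t₁ , E₁ , le₁ , i₁ with go p′ s₁ i₁ (rec (≤-trans (s≤s (m≤n+m p′ b)) lt))
  ... | s₂ , t₂ , E₂ , le₂ , q = s₂ , _ , e-while (subst (0 <_) (sym eq) z<s) E₁ E₂ ,
    s≤s (≤-trans (+-mono-≤ le₁ le₂) (≤-trans (≤-reflexive (+-suc b p′)) lt)) , q

-- Linked lists and counting

push : (ℕ → List ℕ) → ℕ → ℕ → ℕ → List ℕ
push F l x j = if j ≡ᵇ l then x ∷ F j else F j

push-≡ : ∀ F l x → push F l x l ≡ x ∷ F l
push-≡ F l x rewrite ≡ᵇ-refl l = refl

push-≢ : ∀ F {l j} x → j ≢ l → push F l x j ≡ F j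
push-≢ F x ne rewrite ≢⇒≡ᵇ ne = refl

∈-push⁺ : ∀ F l x {j y} → y ∈ F j → y ∈ push F l x j
∈-push⁺ F l x {j} y∈ with j ≡ᵇ l
... | true  = there y∈
... | false = y∈

∈-push-new : ∀ F l x → x ∈ push F l x l
∈-push-new F l x rewrite push-≡ F l x = here refl

∈-push⁻ : ∀ F l x {j y} → y ∈ push F l x j → (j ≡ l × y ≡ x) ⊎ (y ∈ F j)
∈-push⁻ F l x {j} y∈ with j ≟ l
... | no ne rewrite ≢⇒≡ᵇ ne = inj₂ y∈
... | yes refl rewrite ≡ᵇ-refl j with y∈
... | here e = inj₁ (refl , e)
... | there y∈ = inj₂ y∈

pop : (ℕ → List ℕ) → ℕ → List ℕ → ℕ → List ℕ
pop F l xs j = if j ≡ᵇ l then xs else F j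

-- Singly linked lists in memory: link 0 is the end, link suc i is node i; all nodes are < bd.
data Chain (nxt val : ℕ → ℕ) (bd : ℕ) : ℕ → List ℕ → Set where
  nil  : Chain nxt val bd 0 []
  cons : ∀ {i x xs} → i < bd → val i ≡ x → Chain nxt val bd (nxt i) xs → Chain nxt val bd (suc i) (x ∷ xs)

-- Nodes are allocated in increasing order and never recycled. All chains live below `bd`, so
-- writing node `bd` disturbs none of them.
chain-fresh : ∀ {nxt val bd h xs} y x → Chain nxt val bd h xs →
  Chain (update nxt bd y) (update val bd x) (suc bd) h xs
chain-fresh y x nil = nil
chain-fresh {nxt} {val} {bd} y x (cons {i} i< e c) =
  cons (m≤n⇒m≤1+n i<) (trans (update-≢ val x (<⇒≢ i<)) e)
    (subst (λ z → Chain _ _ _ z _) (sym (update-≢ nxt y (<⇒≢ i<))) (chain-fresh y x c))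

Lists : (hd nxt val : ℕ → ℕ) → ℕ → (ℕ → List ℕ) → Set
Lists hd nxt val bd F = ∀ l → Chain nxt val bd (hd l) (F l)

lists-push : ∀ {hd nxt val bd F} l x → Lists hd nxt val bd F →
  Lists (update hd l (bd + 1)) (update nxt bd (hd l)) (update val bd x) (bd + 1) (push F l x)
lists-push {hd} {nxt} {val} {bd} {F} l x L j rewrite +-comm bd 1 with j ≟ l
... | no ne rewrite ≢⇒≡ᵇ ne = chain-fresh (hd l) x (L j)
... | yes refl rewrite ≡ᵇ-refl j = cons ≤-refl (update-≡ val bd x)
  (subst (λ z → Chain (update nxt bd (hd j)) (update val bd x) (suc bd) z (F j)) (sym (update-≡ nxt bd (hd j))) (chain-fresh (hd j) x (L j)))

lists-pop : ∀ {hd nxt val bd F} l {i x xs} → Lists hd nxt val bd F → hd l ≡ suc i → F l ≡ x ∷ xs →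
  Lists (update hd l (nxt i)) nxt val bd (pop F l xs) × val i ≡ x
lists-pop {hd} {nxt} {val} {bd} {F} l {i} {x} {xs} L e e′ with hd l | e | F l | e′ | L l
... | _ | refl | _ | refl | cons i< v c = popped , v
  where
  popped : Lists (update hd l (nxt i)) nxt val bd (pop F l xs)
  popped j with j ≟ l
  ... | no ne rewrite ≢⇒≡ᵇ ne = L j
  ... | yes refl rewrite ≡ᵇ-refl j = c

chain-zero : ∀ {nxt val bd h xs} → Chain nxt val bd h xs → h ≡ 0 → xs ≡ []
chain-zero nil _ = refl

chain-suc : ∀ {nxt val bd h xs} → Chain nxt val bd h xs → 0 < h →
  ∃[ i ] ∃[ x ] ∃[ ys ] (h ≡ suc i × xs ≡ x ∷ ys × val i ≡ x × Chain nxt val bd (nxt i) ys)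
chain-suc (cons {i} {x} {xs} i< e c) _ = i , x , xs , refl , refl , e , c

-- A stack of distinct vertices needs no nodes of its own: each vertex serves as its node, and may
-- be pushed only if it is not on the stack.
data Stack (nxt : ℕ → ℕ) : ℕ → List ℕ → Set where
  nil  : Stack nxt 0 []
  cons : ∀ {v xs} → Stack nxt (nxt v) xs → Stack nxt (suc v) (v ∷ xs)

stack-frame : ∀ {nxt h xs} v y → v ∉ xs → Stack nxt h xs → Stack (update nxt v y) h xs
stack-frame v y v∉ nil = nil
stack-frame {nxt} v y v∉ (cons {w} st) = cons (subst (λ z → Stack _ z _)
  (sym (update-≢ nxt y (λ e → v∉ (here (sym e))))) (stack-frame v y (v∉ ∘ there) st))

stack-push : ∀ {nxt h xs} v → v ∉ xs → Stack nxt h xs → Stack (update nxt v h) (suc v) (v ∷ xs)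
stack-push {nxt} {h} {xs} v v∉ st = cons (subst (λ z → Stack (update nxt v h) z xs) (sym (update-≡ nxt v h)) (stack-frame v h v∉ st))

sumTo : (ℕ → ℕ) → ℕ → ℕ
sumTo f zero    = 0
sumTo f (suc N) = f N + sumTo f N

sumTo-cong : ∀ {f g} N → (∀ i → i < N → f i ≡ g i) → sumTo f N ≡ sumTo g N
sumTo-cong zero    e = refl
sumTo-cong (suc N) e = cong₂ _+_ (e N ≤-refl) (sumTo-cong N (λ i i< → e i (m≤n⇒m≤1+n i<)))

sumTo-zero : ∀ {f} N → (∀ i → f i ≡ 0) → sumTo f N ≡ 0
sumTo-zero zero    e = refl
sumTo-zero (suc N) e rewrite e N = sumTo-zero N e

term≤sumTo : ∀ f {i N} → i < N → f i ≤ sumTo f N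
term≤sumTo f {i} {suc N} i< with i ≟ N
... | yes refl = m≤m+n (f i) _
... | no ne = ≤-trans (term≤sumTo f (≤∧≢⇒< (≤-pred i<) ne)) (m≤n+m _ (f N))

sumTo-affine : ∀ a b f N → sumTo (λ i → a + b * f i) N ≡ a * N + b * sumTo f N
sumTo-affine a b f zero rewrite *-zeroʳ a | *-zeroʳ b = refl
sumTo-affine a b f (suc N) rewrite sumTo-affine a b f N =
  solve 5 (λ a b x n s → (a :+ b :* x) :+ (a :* n :+ b :* s) := a :* (con 1 :+ n) :+ b :* (x :+ s)) refl a b (f N) N (sumTo f N)
  where open +-*-Solver

-- Stated with additions on both sides, since subtraction on ℕ truncates.
sumTo-change : ∀ {f g} i N → i < N → (∀ j → j ≢ i → g j ≡ f j) → sumTo g N + f i ≡ sumTo f N + g i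
sumTo-change {f} {g} i (suc N) i< e with i ≟ N
... | yes refl rewrite sumTo-cong {g} {f} N (λ j j< → e j (<⇒≢ j<)) =
  solve 3 (λ x y s → (x :+ s) :+ y := (y :+ s) :+ x) refl (g i) (f i) (sumTo f N)
  where open +-*-Solver
... | no ne rewrite e N (ne ∘ sym) =
  trans (+-assoc (f N) _ _) (trans (cong (f N +_) (sumTo-change i N (≤∧≢⇒< (≤-pred i<) ne) e)) (sym (+-assoc (f N) _ _)))

sumTo-push≤ : ∀ F l x N → sumTo (length ∘ push F l x) N ≤ suc (sumTo (length ∘ F) N)
sumTo-push≤ F l x N with l <? N
... | yes l<N = +-cancelʳ-≤ (length (F l)) _ _ (≤-reflexive (trans
        (sumTo-change {length ∘ F} l N l<N (λ j ne → cong length (push-≢ F x ne)))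
        (trans (cong (λ z → sumTo (length ∘ F) N + length z) (push-≡ F l x)) (+-suc _ _))))
... | no l≮N = ≤-trans (≤-reflexive (sumTo-cong N (λ j j< → cong length (push-≢ F x (λ e → l≮N (subst (_< N) e j<)))))) (n≤1+n _)

-- 1 ∸ r x is 1 if r vanishes at x, and 0 otherwise.
cnt : (ℕ → ℕ) → List ℕ → ℕ
cnt r = Σl (λ x → 1 ∸ r x)

cnt≤length : ∀ r xs → cnt r xs ≤ length xs
cnt≤length r xs = ≤-trans (Σl-mono (λ x → m∸n≤m 1 (r x)) xs) (≤-reflexive (trans (Σl-const 1 xs) (*-identityʳ _)))

mult : ℕ → List ℕ → ℕ
mult v = Σl (λ x → ⟦ x ≟ v ⟧)

indicator-≡ : ∀ {i j} → i ≡ j → ⟦ i ≟ j ⟧ ≡ 1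
indicator-≡ {i} {j} e with i ≟ j
... | yes _ = refl
... | no ne = contradiction e ne

indicator-≢ : ∀ {i j} → i ≢ j → ⟦ i ≟ j ⟧ ≡ 0
indicator-≢ {i} {j} ne with i ≟ j
... | yes e = contradiction e ne
... | no _  = refl

cnt-remove : ∀ r v xs → r v ≡ 0 → cnt (update r v 1) xs + mult v xs ≡ cnt r xs
cnt-remove r v xs e = trans (sym (Σl-+ _ _ xs)) (Σl-cong each xs)
  where
  each : ∀ x → (1 ∸ update r v 1 x) + ⟦ x ≟ v ⟧ ≡ 1 ∸ r x
  each x with x ≟ v
  ... | yes refl rewrite update-≡ r x 1 | e = refl
  ... | no ne rewrite update-≢ r 1 ne = +-identityʳ _

cnt-cong : ∀ {r r′} → (∀ x → r x ≡ r′ x) → ∀ xs → cnt r xs ≡ cnt r′ xs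
cnt-cong e = Σl-cong (λ x → cong (1 ∸_) (e x))

remOf : List ℕ → ℕ → ℕ
remOf []       = λ _ → 0
remOf (v ∷ xs) = update (remOf xs) v 1

remOf-∉ : ∀ xs {v} → remOf xs v ≡ 0 → v ∉ xs
remOf-∉ (x ∷ xs) {v} e (here refl) = contradiction (trans (sym (update-≡ (remOf xs) v 1)) e) (λ ())
remOf-∉ (x ∷ xs) {v} e (there v∈) with v ≟ x
... | yes refl = contradiction (trans (sym (update-≡ (remOf xs) v 1)) e) (λ ())
... | no ne = remOf-∉ xs (trans (sym (update-≢ (remOf xs) 1 ne)) e) v∈

aliveSum : (ℕ → ℕ) → (ℕ → ℕ) → ℕ → ℕ
aliveSum g r = sumTo (λ w → (1 ∸ r w) * g w)

aliveSum-remove : ∀ g r v N → v < N → r v ≡ 0 → aliveSum g (update r v 1) N + g v ≡ aliveSum g r N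
aliveSum-remove g r v N v< e = begin
  aliveSum g (update r v 1) N + g v              ≡⟨ cong (aliveSum g (update r v 1) N +_) (sym (trans (cong (λ z → (1 ∸ z) * g v) e) (+-identityʳ (g v)))) ⟩
  aliveSum g (update r v 1) N + (1 ∸ r v) * g v  ≡⟨ sumTo-change v N v< (λ j ne → cong (λ z → (1 ∸ z) * g j) (update-≢ r 1 ne)) ⟩
  aliveSum g r N + (1 ∸ update r v 1 v) * g v    ≡⟨ cong (λ z → aliveSum g r N + (1 ∸ z) * g v) (update-≡ r v 1) ⟩
  aliveSum g r N + 0                             ≡⟨ +-identityʳ _ ⟩
  aliveSum g r N                                 ∎
  where open ≡-Reasoning

-- Adjacency lists

link : (ℕ → List ℕ) → ℕ → ℕ → ℕ → List ℕ
link F u v = push (push F u v) v u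

linkAll : ∀ {n} → (ℕ → List ℕ) → List (Fin n × Fin n) → ℕ → List ℕ
linkAll F []             = F
linkAll F ((u , v) ∷ es) = linkAll (link F (toℕ u) (toℕ v)) es

neighbours : ∀ {n} → List (Fin n × Fin n) → ℕ → List ℕ
neighbours = linkAll (λ _ → [])

mult-push : ∀ F l x a j → mult a (push F l x j) ≡ ⟦ j ≟ l ⟧ * ⟦ x ≟ a ⟧ + mult a (F j)
mult-push F l x a j with j ≟ l
... | yes refl rewrite ≡ᵇ-refl j = cong (_+ mult a (F j)) (sym (+-identityʳ _))
... | no ne rewrite ≢⇒≡ᵇ ne = refl

⟦⟧-sym : ∀ i j → ⟦ i ≟ j ⟧ ≡ ⟦ j ≟ i ⟧
⟦⟧-sym i j with i ≟ j | j ≟ i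
... | yes _ | yes _ = refl
... | no _  | no _  = refl
... | yes e | no ne = contradiction (sym e) ne
... | no ne | yes e = contradiction (sym e) ne

-- With multiplicities, symmetry is an invariant of linking a single edge. The peeling needs it in
-- this form because its sweep over `F v` lowers a degree once per occurrence.
linkAll-symmetric : ∀ {n} (es : List (Fin n × Fin n)) F → (∀ a b → mult a (F b) ≡ mult b (F a)) →
  ∀ a b → mult a (linkAll F es b) ≡ mult b (linkAll F es a)
linkAll-symmetric [] F s = s
linkAll-symmetric ((u , v) ∷ es) F s = linkAll-symmetric es _ sym′
  where
  x = toℕ u
  y = toℕ v
  sym′ : ∀ a b → mult a (link F x y b) ≡ mult b (link F x y a)
  sym′ a b rewrite mult-push (push F x y) y x a b | mult-push F x y a b
                 | mult-push (push F x y) y x b a | mult-push F x y b a | s a b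
                 | ⟦⟧-sym b y | ⟦⟧-sym b x | ⟦⟧-sym a x | ⟦⟧-sym a y =
    solve 5 (λ p q r t m → p :* q :+ (r :* t :+ m) ⊜ t :* r :+ (q :* p :+ m)) refl
      ⟦ y ≟ b ⟧ ⟦ x ≟ a ⟧ ⟦ x ≟ b ⟧ ⟦ y ≟ a ⟧ (mult b (F a))
    where open +-*-Solver using (solve; _:+_; _:*_) renaming (_:=_ to _⊜_)

linkAll-size : ∀ {n} (es : List (Fin n × Fin n)) F N →
  sumTo (length ∘ linkAll F es) N ≤ 2 * length es + sumTo (length ∘ F) N
linkAll-size [] F N = ≤-refl
linkAll-size ((u , v) ∷ es) F N = begin
  sumTo (length ∘ linkAll (link F (toℕ u) (toℕ v)) es) N
    ≤⟨ linkAll-size es _ N ⟩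
  2 * length es + sumTo (length ∘ link F (toℕ u) (toℕ v)) N
    ≤⟨ +-monoʳ-≤ (2 * length es) (≤-trans (sumTo-push≤ (push F (toℕ u) (toℕ v)) (toℕ v) (toℕ u) N) (s≤s (sumTo-push≤ F (toℕ u) (toℕ v) N))) ⟩
  2 * length es + (2 + sumTo (length ∘ F) N)
    ≡⟨ solve 2 (λ m s → con 2 :* m :+ (con 2 :+ s) ⊜ con 2 :* (con 1 :+ m) :+ s) refl (length es) (sumTo (length ∘ F) N) ⟩
  2 * suc (length es) + sumTo (length ∘ F) N ∎
  where
  open ≤-Reasoning
  open +-*-Solver using (solve; _:+_; _:*_; con) renaming (_:=_ to _⊜_)

neighbours-size : ∀ {n} (es : List (Fin n × Fin n)) N → sumTo (length ∘ neighbours es) N ≤ 2 * length es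
neighbours-size es N = ≤-trans (linkAll-size es (λ _ → []) N)
  (≤-reflexive (trans (cong (2 * length es +_) (sumTo-zero N (λ _ → refl))) (+-identityʳ _)))

∈-link⁻ : ∀ F u v {x y} → y ∈ link F u v x → (x ≡ u × y ≡ v) ⊎ (x ≡ v × y ≡ u) ⊎ y ∈ F x
∈-link⁻ F u v y∈ with ∈-push⁻ (push F u v) v u y∈
... | inj₁ e = inj₂ (inj₁ e)
... | inj₂ y∈ with ∈-push⁻ F u v y∈
... | inj₁ e = inj₁ e
... | inj₂ y∈ = inj₂ (inj₂ y∈)

Joins : ∀ {n} → ℕ → ℕ → Fin n × Fin n → Set
Joins x y (u , v) = (x ≡ toℕ u × y ≡ toℕ v) ⊎ (x ≡ toℕ v × y ≡ toℕ u)

linkAll-sound : ∀ {n} (es : List (Fin n × Fin n)) F {x y} → y ∈ linkAll F es x → y ∈ F x ⊎ Any (Joins x y) es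
linkAll-sound [] F y∈ = inj₁ y∈
linkAll-sound ((u , v) ∷ es) F y∈ with linkAll-sound es _ y∈
... | inj₂ a = inj₂ (there a)
... | inj₁ y∈ with ∈-link⁻ F (toℕ u) (toℕ v) y∈
... | inj₁ e = inj₂ (here (inj₁ e))
... | inj₂ (inj₁ e) = inj₂ (here (inj₂ e))
... | inj₂ (inj₂ y∈′) = inj₁ y∈′

neighbours-sound : ∀ {n} (es : List (Fin n × Fin n)) {x y} → y ∈ neighbours es x → Any (Joins x y) es
neighbours-sound es y∈ with linkAll-sound es (λ _ → []) y∈
... | inj₂ a = a

linkAll-mono : ∀ {n} (es : List (Fin n × Fin n)) F {x y} → y ∈ F x → y ∈ linkAll F es x
linkAll-mono [] F y∈ = y∈
linkAll-mono ((u , v) ∷ es) F y∈ = linkAll-mono es _ (∈-push⁺ (push F (toℕ u) (toℕ v)) (toℕ v) (toℕ u) (∈-push⁺ F (toℕ u) (toℕ v) y∈))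

linkAll-complete : ∀ {n} (es : List (Fin n × Fin n)) F {u v} → (u , v) ∈ es →
  toℕ v ∈ linkAll F es (toℕ u) × toℕ u ∈ linkAll F es (toℕ v)
linkAll-complete ((u , v) ∷ es) F (here refl) =
  linkAll-mono es _ (∈-push⁺ (push F (toℕ u) (toℕ v)) (toℕ v) (toℕ u) (∈-push-new F (toℕ u) (toℕ v))) ,
  linkAll-mono es _ (∈-push-new (push F (toℕ u) (toℕ v)) (toℕ v) (toℕ u))
linkAll-complete ((u , v) ∷ es) F (there e∈) = linkAll-complete es _ e∈

Ascending : ∀ {n} → Fin n × Fin n → Set
Ascending (u , v) = toℕ u < toℕ v

push-unique : ∀ F l x → (∀ j → Unique (F j)) → x ∉ F l → ∀ j → Unique (push F l x j)
push-unique F l x uq x∉ j with j ≟ l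
... | no ne rewrite ≢⇒≡ᵇ ne = uq j
... | yes refl rewrite ≡ᵇ-refl j = All.¬Any⇒All¬ _ x∉ ∷ uq j

-- A neighbour could enter a list twice through the same edge listed again, which `Unique` excludes,
-- or through the reversed edge, which the ascending order of the ends excludes.
linkAll-unique : ∀ {n} (es : List (Fin n × Fin n)) F → Unique es → All Ascending es →
  (∀ x → Unique (F x)) → (∀ u v → (u , v) ∈ es → toℕ v ∉ F (toℕ u) × toℕ u ∉ F (toℕ v)) →
  ∀ x → Unique (linkAll F es x)
linkAll-unique [] F _ _ uq fresh = uq
linkAll-unique ((u , v) ∷ es) F (e∉ ∷ ues) (u<v ∷ asc) uq fresh =
  linkAll-unique es _ ues asc unique′ fresh′
  where
  unique′ : ∀ x → Unique (link F (toℕ u) (toℕ v) x)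
  unique′ = push-unique (push F (toℕ u) (toℕ v)) (toℕ v) (toℕ u)
    (push-unique F (toℕ u) (toℕ v) uq (proj₁ (fresh u v (here refl))))
    (subst (toℕ u ∉_) (sym (push-≢ F (toℕ v) (<⇒≢ u<v ∘ sym))) (proj₂ (fresh u v (here refl))))
  fresh′ : ∀ u′ v′ → (u′ , v′) ∈ es → toℕ v′ ∉ link F (toℕ u) (toℕ v) (toℕ u′) × toℕ u′ ∉ link F (toℕ u) (toℕ v) (toℕ v′)
  fresh′ u′ v′ e∈ = one , two
    where
    same : toℕ u′ ≡ toℕ u → toℕ v′ ≡ toℕ v → ⊥
    same p q = All.lookup e∉ e∈ (cong₂ _,_ (sym (Fin.toℕ-injective p)) (sym (Fin.toℕ-injective q)))
    swapped : toℕ u′ ≡ toℕ v → toℕ v′ ≡ toℕ u → ⊥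
    swapped p q = <-asym u<v (subst₂ _<_ p q (All.lookup asc e∈))
    one : toℕ v′ ∉ link F (toℕ u) (toℕ v) (toℕ u′)
    one m with ∈-link⁻ F (toℕ u) (toℕ v) m
    ... | inj₁ (p , q) = same p q
    ... | inj₂ (inj₁ (p , q)) = swapped p q
    ... | inj₂ (inj₂ m′) = proj₁ (fresh u′ v′ (there e∈)) m′
    two : toℕ u′ ∉ link F (toℕ u) (toℕ v) (toℕ v′)
    two m with ∈-link⁻ F (toℕ u) (toℕ v) m
    ... | inj₁ (p , q) = swapped q p
    ... | inj₂ (inj₁ (p , q)) = same q p
    ... | inj₂ (inj₂ m′) = proj₂ (fresh u′ v′ (there e∈)) m′

-- Commands that build the adjacency lists

pushNode : (hd nxt val : Arr) → Var → Var → List Stmt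
pushNode hd nxt val l x =
  -- Links are node numbers plus one, so the incremented `node` is both the next free node and the
  -- link to the one just written.
  (val ! node := x) ∷ (tmp := hd ! l) ∷ (nxt ! node := tmp) ∷ (node := node ⊕# 1) ∷ (hd ! l := node) ∷ []

increment : Arr → Var → List Stmt
increment a x = (tmp := a ! x) ∷ (tmp := tmp ⊕# 1) ∷ (a ! x := tmp) ∷ []

readEdge : List Stmt
readEdge =
  (vu := input ! arcp) ∷ (arcp := arcp ⊕# 1) ∷ (vv := input ! arcp) ∷ (arcp := arcp ⊕# 1) ∷ (ctr := ctr ⊖# 2) ∷ []

linkEdge : Cmd
linkEdge = blk readEdge
  ▸ blk (pushNode arcHead arcNext arcTo vu vv) ▸ blk (pushNode arcHead arcNext arcTo vv vu)
  ▸ blk (increment degree vu) ▸ blk (increment degree vv)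

initLink : List Stmt
initLink = (arcp :=# 0) ∷ (node :=# 0) ∷ (ctr := bound ⊕# 0) ∷ []

linkEdges : Cmd
linkEdges = blk initLink ▸ whilePos ctr linkEdge

AllZero : (ℕ → ℕ) → Set
AllZero f = ∀ i → f i ≡ 0

degree-push : ∀ {deg F} l x → (∀ w → deg w ≡ length (F w)) →
  ∀ w → update deg l (deg l + 1) w ≡ length (push F l x w)
degree-push {deg} {F} l x e w with w ≟ l
... | no ne rewrite ≢⇒≡ᵇ ne = e w
... | yes refl rewrite ≡ᵇ-refl w = trans (cong (_+ 1) (e w)) (+-comm (length (F w)) 1)

-- Arrays of the later phases. Writes to other arrays leave them unchanged by computation, so the
-- linking steps just repack these fields.
record Blank (s : Store) : Set where
  field
    bktHead0 : AllZero (ar s bktHead)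
    removed0 : AllZero (ar s removed)
    marks0   : AllZero (ar s marks)
    colour0  : AllZero (ar s colour)

record Loaded (n₀ : ℕ) (es : List (Fin n₀ × Fin n₀)) (s : Store) : Set where
  field
    size≡    : sc s size ≡ n₀
    bound≡   : sc s bound ≡ 2 * length es
    input≡   : ∀ k → k < 2 * length es → ar s input k ≡ encodeEdges es k
    arcHead0 : AllZero (ar s arcHead)
    degree0  : AllZero (ar s degree)
    blank    : Blank s

record Linked (n₀ : ℕ) (es : List (Fin n₀ × Fin n₀)) (s : Store) : Set where
  field
    size≡    : sc s size ≡ n₀
    bound≡   : sc s bound ≡ 2 * length es
    arcs     : Lists (ar s arcHead) (ar s arcNext) (ar s arcTo) (sc s node) (neighbours es)
    degree≡  : ∀ w → ar s degree w ≡ length (neighbours es w)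
    blank    : Blank s

module _ {n₀ : ℕ} (es : List (Fin n₀ × Fin n₀)) where

  -- The lists already linked are arcLists, and the degrees already counted are the lengths of degLists.
  record Linking (rest : List (Fin n₀ × Fin n₀)) (arcLists degLists : ℕ → List ℕ) (s : Store) : Set where
    field
      size≡   : sc s size ≡ n₀
      bound≡  : sc s bound ≡ 2 * length es
      ctr≡    : sc s ctr ≡ 2 * length rest
      input≡  : ∀ k → k < 2 * length rest → ar s input (sc s arcp + k) ≡ encodeEdges rest k
      arcs    : Lists (ar s arcHead) (ar s arcNext) (ar s arcTo) (sc s node) arcLists
      degree≡ : ∀ w → ar s degree w ≡ length (degLists w)
      blank   : Blank s

  record AtEdge (u v : ℕ) (rest : List (Fin n₀ × Fin n₀)) (arcLists degLists : ℕ → List ℕ) (s : Store) : Set where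
    field
      vu≡     : sc s vu ≡ u
      vv≡     : sc s vv ≡ v
      linking : Linking rest arcLists degLists s

  read-correct : ∀ u v rest A D s → Linking ((u , v) ∷ rest) A D s →
    AtEdge (toℕ u) (toℕ v) rest A D (exec readEdge s)
  read-correct u v rest A D s I = record
    { vu≡ = trans (cong (ar s input) (sym (+-identityʳ (sc s arcp)))) (input≡ 0 z<s)
    ; vv≡ = input≡ 1 (subst (1 <_) (sym (two-suc (length rest))) (s≤s z<s))
    ; linking = record
      { size≡ = size≡
      ; bound≡ = bound≡
      ; ctr≡ = trans (cong (_∸ 2) ctr≡) (cong (_∸ 2) (two-suc (length rest)))
      ; input≡ = λ k k< → trans (cong (ar s input) (shift (sc s arcp) k))
          (input≡ (2 + k) (subst (2 + k <_) (sym (two-suc (length rest))) (s≤s (s≤s k<))))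
      ; arcs = arcs
      ; degree≡ = degree≡
      ; blank = record { Blank blank }
      } }
    where
    open Linking I
    two-suc : ∀ k → 2 * suc k ≡ 2 + 2 * k
    two-suc k = *-suc 2 k
    shift : ∀ p k → p + 1 + 1 + k ≡ p + (2 + k)
    shift p k = trans (cong (_+ k) (+-assoc p 1 1)) (+-assoc p 2 k)

  push-arc-vu : ∀ u v rest A D s → AtEdge u v rest A D s →
    AtEdge u v rest (push A u v) D (exec (pushNode arcHead arcNext arcTo vu vv) s)
  push-arc-vu _ _ rest A D s record { vu≡ = refl ; vv≡ = refl ; linking = I } = record
    { vu≡ = refl ; vv≡ = refl ; linking = record
      { size≡ = size≡ ; bound≡ = bound≡ ; ctr≡ = ctr≡ ; input≡ = input≡ ; degree≡ = degree≡
      ; arcs = lists-push (sc s vu) (sc s vv) arcs ; blank = record { Blank blank } } }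
    where open Linking I

  push-arc-vv : ∀ u v rest A D s → AtEdge u v rest A D s →
    AtEdge u v rest (push A v u) D (exec (pushNode arcHead arcNext arcTo vv vu) s)
  push-arc-vv _ _ rest A D s record { vu≡ = refl ; vv≡ = refl ; linking = I } = record
    { vu≡ = refl ; vv≡ = refl ; linking = record
      { size≡ = size≡ ; bound≡ = bound≡ ; ctr≡ = ctr≡ ; input≡ = input≡ ; degree≡ = degree≡
      ; arcs = lists-push (sc s vv) (sc s vu) arcs ; blank = record { Blank blank } } }
    where open Linking I

  increment-vu : ∀ u v x rest A D s → AtEdge u v rest A D s →
    AtEdge u v rest A (push D u x) (exec (increment degree vu) s)
  increment-vu _ _ x rest A D s record { vu≡ = refl ; vv≡ = refl ; linking = I } = record
    { vu≡ = refl ; vv≡ = refl ; linking = record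
      { size≡ = size≡ ; bound≡ = bound≡ ; ctr≡ = ctr≡ ; input≡ = input≡ ; arcs = arcs
      ; degree≡ = degree-push {ar s degree} {D} (sc s vu) x degree≡ ; blank = record { Blank blank } } }
    where open Linking I

  increment-vv : ∀ u v x rest A D s → AtEdge u v rest A D s →
    AtEdge u v rest A (push D v x) (exec (increment degree vv) s)
  increment-vv _ _ x rest A D s record { vu≡ = refl ; vv≡ = refl ; linking = I } = record
    { vu≡ = refl ; vv≡ = refl ; linking = record
      { size≡ = size≡ ; bound≡ = bound≡ ; ctr≡ = ctr≡ ; input≡ = input≡ ; arcs = arcs
      ; degree≡ = degree-push {ar s degree} {D} (sc s vv) x degree≡ ; blank = record { Blank blank } } }
    where open Linking I

  linkEdge-correct : ∀ u v rest F s → Linking ((u , v) ∷ rest) F F s →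
    linkEdge ⊢ s ⟶[ 21 ] (λ s′ → Linking rest (link F (toℕ u) (toℕ v)) (link F (toℕ u) (toℕ v)) s′)
  linkEdge-correct u v rest F s I =
    t-seq (t-blk readEdge (read-correct u v rest F F s I)) λ s I →
    t-seq (t-blk (pushNode arcHead arcNext arcTo vu vv) (push-arc-vu x y rest F F s I)) λ s I →
    t-seq (t-blk (pushNode arcHead arcNext arcTo vv vu) (push-arc-vv x y rest _ F s I)) λ s I →
    t-seq (t-blk (increment degree vu) (increment-vu x y y rest _ F s I)) λ s I →
    t-map (AtEdge.linking {x} {y}) (t-blk (increment degree vv) (increment-vv x y x rest _ _ s I))
    where
    x = toℕ u
    y = toℕ v

  Linkable : List (Fin n₀ × Fin n₀) → Store → Set
  Linkable rest s = ∃[ F ] (linkAll F rest ≡ neighbours es × Linking rest F F s)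

  linkEdges-correct : ∀ s → Loaded n₀ es s →
    linkEdges ⊢ s ⟶[ 4 + 22 * length es ] Linked n₀ es
  linkEdges-correct s L = t-≤ (≤-reflexive cost) (t-seq {P = Linkable es}
    (t-blk initLink ((λ _ → []) , refl , start))
    (λ s′ I → t-map finish (while-list ctr linkEdge (λ _ → 21) Linkable
      (λ { _ (_ , _ , I) → Linking.ctr≡ I })
      (λ { (u , v) rest s (F , goal , I) → subst (0 <_) (sym (Linking.ctr≡ I)) z<s ,
             t-map (λ I′ → _ , goal , I′) (linkEdge-correct u v rest F s I) })
      es s′ I)))
    where
    open Loaded L
    cost : 3 + suc (Σl (λ _ → 22) es) ≡ 4 + 22 * length es
    cost = cong (4 +_) (trans (Σl-const 22 es) (*-comm (length es) 22))
    start : Linking es (λ _ → []) (λ _ → []) (exec initLink s)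
    start = record
      { size≡ = size≡ ; bound≡ = bound≡ ; ctr≡ = trans (+-identityʳ _) bound≡ ; input≡ = input≡
      ; arcs = λ l → subst (λ z → Chain (ar s arcNext) (ar s arcTo) 0 z []) (sym (arcHead0 l)) nil ; degree≡ = degree0
      ; blank = record { Blank blank } }
    finish : ∀ {s′} → Linkable [] s′ → Linked n₀ es s′
    finish (F , refl , I) = record { Linking I }

-- Smallest-last peeling

module Peeling (N : ℕ) (F : ℕ → List ℕ) (symF : ∀ a b → mult a (F b) ≡ mult b (F a)) where

  MinDegree : (ℕ → ℕ) → ℕ → Set
  MinDegree S t = ∀ w → w < N → S w ≡ 0 → t ≤ cnt S (F w)

  -- The t-core is nonempty: S vanishes exactly on a vertex set of minimum degree at least t.
  Core : ℕ → Set
  Core t = ∃[ S ] ((∃[ v ] (v < N × S v ≡ 0)) × MinDegree S t)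

  -- The latest removal comes first: `vs` were gone when `v` was removed, so `cnt (remOf vs) (F v)`
  -- is the degree of `v` at that moment. The certificate is a core for this very degree, which is
  -- what the greedy colouring pays for `v`.
  Ordered : List ℕ → Set
  Ordered []       = ⊤
  Ordered (v ∷ vs) = v < N × remOf vs v ≡ 0 × Core (cnt (remOf vs) (F v)) × Ordered vs

  -- State of the peeling at level t: vs are the removed vertices, latest first, and R is the part of the
  -- neighbourhood of the latest one that is still to be processed.  Buckets may hold stale entries.
  record Peel (t : ℕ) (rem deg : ℕ → ℕ) (B : ℕ → List ℕ) (vs R : List ℕ) : Set where
    field
      rem≡    : ∀ w → rem w ≡ remOf vs w
      deg≡    : ∀ w → rem w ≡ 0 → deg w ≡ cnt rem (F w) + mult w R
      inB     : ∀ w → w < N → rem w ≡ 0 → w ∈ B (t + (deg w ∸ t))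
      B<N     : ∀ b w → w ∈ B b → w < N
      degB    : ∀ b w → w ∈ B b → rem w ≡ 0 → deg w ≤ b
      {S}     : ℕ → ℕ
      alive⊆S : ∀ w → rem w ≡ 0 → S w ≡ 0
      minS    : MinDegree S t
      ordered : Ordered vs

  ∈-pop⁻ : ∀ B l {x xs j w} → B l ≡ x ∷ xs → w ∈ pop B l xs j → w ∈ B j
  ∈-pop⁻ B l {j = j} e w∈ with j ≟ l
  ... | no ne rewrite ≢⇒≡ᵇ ne = w∈
  ... | yes refl rewrite ≡ᵇ-refl j | e = there w∈

  ∈-pop⁺ : ∀ B l {x xs j w} → B l ≡ x ∷ xs → w ≢ x → w ∈ B j → w ∈ pop B l xs j
  ∈-pop⁺ B l {j = j} e w≢ w∈ with j ≟ l
  ... | no ne rewrite ≢⇒≡ᵇ ne = w∈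
  ... | yes refl rewrite ≡ᵇ-refl j with subst (_ ∈_) e w∈
  ... | here w≡ = contradiction w≡ w≢
  ... | there w∈′ = w∈′

  peel-start : ∀ {deg B} → (∀ w → deg w ≡ length (F w)) → (∀ w → w < N → w ∈ B (deg w)) →
    (∀ b w → w ∈ B b → w < N × deg w ≡ b) → ∀ {rem} → (∀ w → rem w ≡ 0) → Peel 0 rem deg B [] []
  peel-start {deg} degF inB B⊆ {rem} rem0 = record
    { rem≡ = rem0
    ; deg≡ = λ w _ → trans (degF w) (sym (trans (+-identityʳ _) (trans (Σl-cong (λ x → cong (1 ∸_) (rem0 x)) (F w)) (trans (Σl-const 1 (F w)) (*-identityʳ _)))))
    ; inB = λ w w< _ → inB w w<
    ; B<N = λ b w w∈ → proj₁ (B⊆ b w w∈)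
    ; degB = λ b w w∈ _ → ≤-reflexive (proj₂ (B⊆ b w w∈))
    ; S = λ _ → 0 ; alive⊆S = λ _ _ → refl ; minS = λ _ _ _ → z≤n ; ordered = tt }

  peel-skip : ∀ {t rem deg B vs v xs} → Peel t rem deg B vs [] → B t ≡ v ∷ xs → rem v ≢ 0 →
    Peel t rem deg (pop B t xs) vs []
  peel-skip {t} {rem} {deg} {B} P e dead = record
    { rem≡ = rem≡ ; deg≡ = deg≡
    ; inB = λ w w< r → ∈-pop⁺ B t e (λ { refl → dead r }) (inB w w< r)
    ; B<N = λ b w w∈ → B<N b w (∈-pop⁻ B t e w∈)
    ; degB = λ b w w∈ → degB b w (∈-pop⁻ B t e w∈)
    ; alive⊆S = alive⊆S ; minS = minS ; ordered = ordered }
    where open Peel P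

  -- The popped entry may be stale, but an entry never lies in a bucket below the current degree, so
  -- `deg v ≤ t`. With no neighbours pending, `deg v` is the true degree, and the set `S` from the
  -- start of the level, of minimum degree at least `t`, certifies the core.
  peel-remove : ∀ {t rem deg B vs v xs} → Peel t rem deg B vs [] → B t ≡ v ∷ xs → rem v ≡ 0 →
    Peel t (update rem v 1) deg (pop B t xs) (v ∷ vs) (F v)
  peel-remove {t} {rem} {deg} {B} {vs} {v} P e alive = record
    { rem≡ = λ w → cong (λ z → if w ≡ᵇ v then 1 else z) (rem≡ w)
    -- The count of `w` drops by the multiplicity of `v` in `F w`. By symmetry this is the
    -- multiplicity of `w` in `F v`, so the coming sweep makes up for it exactly.
    ; deg≡ = λ w r → trans (deg≡ w (still w r)) (trans (+-identityʳ _)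
        (trans (sym (cnt-remove rem v (F w) alive)) (cong (cnt (update rem v 1) (F w) +_) (symF v w))))
    ; inB = λ w w< r → ∈-pop⁺ B t e (other w r) (inB w w< (still w r))
    ; B<N = λ b w w∈ → B<N b w (∈-pop⁻ B t e w∈)
    ; degB = λ b w w∈ r → degB b w (∈-pop⁻ B t e w∈) (still w r)
    ; alive⊆S = λ w r → alive⊆S w (still w r) ; minS = minS
    ; ordered = v<N , trans (sym (rem≡ v)) alive ,
        (S , (v , v<N , alive⊆S v alive) , λ w w< Sw → ≤-trans low (minS w w< Sw)) , ordered }
    where
    open Peel P
    v∈ : v ∈ B t
    v∈ = subst (v ∈_) (sym e) (here refl)
    v<N : v < N
    v<N = B<N t v v∈
    other : ∀ w → update rem v 1 w ≡ 0 → w ≢ v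
    other w r refl = contradiction (trans (sym (update-≡ rem v 1)) r) (λ ())
    still : ∀ w → update rem v 1 w ≡ 0 → rem w ≡ 0
    still w r = trans (sym (update-≢ rem 1 (other w r))) r
    low : cnt (remOf vs) (F v) ≤ t
    low = subst (_≤ t) (trans (deg≡ v alive) (trans (+-identityʳ _) (cnt-cong rem≡ (F v)))) (degB t v v∈ alive)

  -- The new bucket is the maximum of `t` and the lowered degree. The old entry stays behind, since
  -- its bucket still bounds the degree from above. Removed neighbours are swept as well: degrees
  -- are constrained only for vertices still present.
  peel-sweep : ∀ {t rem deg B vs w R} → w < N → Peel t rem deg B vs (w ∷ R) →
    Peel t rem (update deg w (deg w ∸ 1)) (push B (t + (deg w ∸ 1 ∸ t)) w) vs R
  peel-sweep {t} {rem} {deg} {B} {vs} {w} {R} w<N P = record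
    { rem≡ = rem≡ ; deg≡ = deg′ ; inB = inB′ ; B<N = B<N′ ; degB = degB′
    ; alive⊆S = alive⊆S ; minS = minS ; ordered = ordered }
    where
    open Peel P
    b = t + (deg w ∸ 1 ∸ t)
    deg′ : ∀ x → rem x ≡ 0 → update deg w (deg w ∸ 1) x ≡ cnt rem (F x) + mult x R
    deg′ x r with x ≟ w
    ... | yes refl = trans (update-≡ deg w (deg w ∸ 1)) (cong (_∸ 1) (trans (deg≡ w r)
      (trans (cong (λ z → cnt rem (F w) + (z + mult w R)) (indicator-≡ {w} refl)) (+-suc _ _))))
    ... | no ne = trans (update-≢ deg (deg w ∸ 1) ne) (trans (deg≡ x r)
      (cong (λ z → cnt rem (F x) + (z + mult x R)) (indicator-≢ (ne ∘ sym))))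
    inB′ : ∀ x → x < N → rem x ≡ 0 → x ∈ push B b w (t + (update deg w (deg w ∸ 1) x ∸ t))
    inB′ x x< r with x ≟ w
    ... | yes refl rewrite ≡ᵇ-refl w = ∈-push-new B b w
    ... | no ne rewrite ≢⇒≡ᵇ ne = ∈-push⁺ B b w (inB x x< r)
    B<N′ : ∀ c x → x ∈ push B b w c → x < N
    B<N′ c x x∈ with ∈-push⁻ B b w x∈
    ... | inj₁ (_ , refl) = w<N
    ... | inj₂ x∈′ = B<N c x x∈′
    lower : ∀ x → update deg w (deg w ∸ 1) x ≤ deg x
    lower x with x ≟ w
    ... | yes refl rewrite ≡ᵇ-refl w = m∸n≤m (deg w) 1
    ... | no ne rewrite ≢⇒≡ᵇ ne = ≤-refl
    degB′ : ∀ c x → x ∈ push B b w c → rem x ≡ 0 → update deg w (deg w ∸ 1) x ≤ c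
    degB′ c x x∈ r with ∈-push⁻ B b w x∈
    ... | inj₁ (refl , refl) = subst (_≤ b) (sym (update-≡ deg w (deg w ∸ 1))) (m≤n+m∸n _ t)
    ... | inj₂ x∈′ = ≤-trans (lower x) (degB c x x∈′ r)

  -- A present vertex of degree at most `t` would wait in bucket `t`. As this is empty, the present
  -- vertices have degree above `t` and become the new `S`; their buckets are their degrees, before
  -- and after the change of level.
  peel-level : ∀ {t rem deg B vs} → Peel t rem deg B vs [] → B t ≡ [] → Peel (suc t) rem deg B vs []
  peel-level {t} {rem} {deg} {B} {vs} P e = record
    { rem≡ = rem≡ ; deg≡ = deg≡
    ; inB = λ w w< r → subst (λ z → w ∈ B z) (sym (m+[n∸m]≡n (above w w< r)))
        (subst (λ z → w ∈ B z) (m+[n∸m]≡n (<⇒≤ (above w w< r))) (inB w w< r))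
    ; B<N = B<N ; degB = degB
    ; S = rem ; alive⊆S = λ _ r → r
    ; minS = λ w w< r → subst (suc t ≤_) (trans (deg≡ w r) (+-identityʳ _)) (above w w< r)
    ; ordered = ordered }
    where
    open Peel P
    above : ∀ w → w < N → rem w ≡ 0 → t < deg w
    above w w< r with deg w ≤? t
    ... | no d≰t = ≰⇒> d≰t
    ... | yes d≤t with subst (λ z → w ∈ B (t + z)) (m≤n⇒m∸n≡0 d≤t) (inB w w< r)
    ... | w∈ with subst (w ∈_) (trans (cong B (+-identityʳ t)) e) w∈
    ... | ()

  -- The removal order lists no vertex twice, so costs paid along it are bounded by a sum over all
  -- vertices.
  ordered-sum : ∀ g vs → Ordered vs → Σl g vs + aliveSum g (remOf vs) N ≡ sumTo g N
  ordered-sum g [] _ = sumTo-cong N (λ i _ → +-identityʳ (g i))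
  ordered-sum g (v ∷ vs) (v< , fresh , _ , o) = begin
    g v + Σl g vs + A ≡⟨ cong (_+ A) (+-comm (g v) (Σl g vs)) ⟩
    Σl g vs + g v + A ≡⟨ +-assoc (Σl g vs) (g v) A ⟩
    Σl g vs + (g v + A) ≡⟨ cong (Σl g vs +_) (trans (+-comm (g v) A) (aliveSum-remove g (remOf vs) v N v< fresh)) ⟩
    Σl g vs + aliveSum g (remOf vs) N ≡⟨ ordered-sum g vs o ⟩
    sumTo g N ∎
    where
    open ≡-Reasoning
    A = aliveSum g (update (remOf vs) v 1) N

  -- A vertex still present lies in `S` and has at least `t` neighbours there, more than its whole
  -- list holds.
  all-removed : ∀ {t rem deg B vs} → Peel t rem deg B vs [] → (∀ w → w < N → length (F w) < t) →
    ∀ w → w < N → remOf vs w ≢ 0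
  all-removed P big w w< r = <⇒≱ (big w w<) (≤-trans (minS w w< (alive⊆S w (trans (rem≡ w) r))) (cnt≤length S (F w)))
    where open Peel P

-- Bucket queue and peeling as commands

initFill : List Stmt
-- `bound` becomes `2 * length es + 1`, a number of levels above every degree.
initFill = (node :=# 0) ∷ (vu :=# 0) ∷ (ctr := size ⊕# 0) ∷ (bound := bound ⊕# 1) ∷ []

getDegree : List Stmt
getDegree = (ent := degree ! vu) ∷ []

nextVertex : List Stmt
nextVertex = (vu := vu ⊕# 1) ∷ (ctr := ctr ⊖# 1) ∷ []

pushBucket : Var → Var → List Stmt
pushBucket = pushNode bktHead bktNext bktVal

fillBuckets : Cmd
fillBuckets = blk initFill ▸ whilePos ctr (blk getDegree ▸ blk (pushBucket ent vu) ▸ blk nextVertex)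

initPeel lookBucket popBucket removeVertex lowerDegree nextArc nextLevel : List Stmt
initPeel     = (lvl :=# 0) ∷ (stk :=# 0) ∷ (ctr := bound ⊕# 0) ∷ []
-- By truncation `mark′` ends as 1 if the bucket of the current level is empty and as 0 otherwise.
-- `nextLevel` adds it to the level, so advancing takes no branch.
lookBucket   = (ent := bktHead ! lvl) ∷ (mark′ :=# 1) ∷ (mark′ := mark′ ⊖ ent) ∷ []
popBucket    = (ent := ent ⊖# 1) ∷ (tmp := bktNext ! ent) ∷ (bktHead ! lvl := tmp) ∷ (vu := bktVal ! ent) ∷
               (tmp := removed ! vu) ∷ (pend :=# 1) ∷ (pend := pend ⊖ tmp) ∷ []
removeVertex = (tmp :=# 1) ∷ (removed ! vu := tmp) ∷ (order ! vu := stk) ∷ (stk := vu ⊕# 1) ∷ (arcp := arcHead ! vu) ∷ []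
-- `colr` serves here as the bucket number `lvl + (degree ∸ lvl)`, the maximum of the two.
lowerDegree  = (arcp := arcp ⊖# 1) ∷ (vv := arcTo ! arcp) ∷ (tmp := degree ! vv) ∷ (tmp := tmp ⊖# 1) ∷
               (degree ! vv := tmp) ∷ (tmp := tmp ⊖ lvl) ∷ (colr := lvl ⊕ tmp) ∷ []
nextArc      = (arcp := arcNext ! arcp) ∷ []
nextLevel    = (lvl := lvl ⊕ mark′) ∷ (ctr := ctr ⊖ mark′) ∷ []

sweepArc sweepArcs peelStep peelAll : Cmd
sweepArc  = blk lowerDegree ▸ blk (pushBucket colr vv) ▸ blk nextArc
sweepArcs = whilePos arcp sweepArc
peelStep  = blk lookBucket ▸ whenPos ent (blk popBucket ▸ whenPos pend (blk removeVertex ▸ sweepArcs)) ▸ blk nextLevel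
peelAll   = blk initPeel ▸ whilePos ctr peelStep

module _ (N T nb : ℕ) (F : ℕ → List ℕ) (symF : ∀ a b → mult a (F b) ≡ mult b (F a))
  (F<N : ∀ x → All (_< N) (F x)) (F<T : ∀ w → w < N → length (F w) < T) where

  open Peeling N F symF

  record Filling (i k : ℕ) (B : ℕ → List ℕ) (s : Store) : Set where
    field
      size≡    : sc s size ≡ N
      bound≡   : sc s bound ≡ T
      vu≡      : sc s vu ≡ i
      ctr≡     : sc s ctr ≡ k
      arcs     : Lists (ar s arcHead) (ar s arcNext) (ar s arcTo) nb F
      bkts     : Lists (ar s bktHead) (ar s bktNext) (ar s bktVal) (sc s node) B
      degree≡  : ∀ w → ar s degree w ≡ length (F w)
      removed0 : AllZero (ar s removed)
      marks0   : AllZero (ar s marks)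
      colour0  : AllZero (ar s colour)

  record Filled (i : ℕ) (B : ℕ → List ℕ) : Set where
    field
      inB  : ∀ w → w < i → w ∈ B (length (F w))
      B⊆   : ∀ b w → w ∈ B b → w < i × length (F w) ≡ b
      usage : sumTo (length ∘ B) T ≤ i

  filled-push : ∀ i B → Filled i B → Filled (suc i) (push B (length (F i)) i)
  filled-push i B Φ = record { inB = inB′ ; B⊆ = B⊆′ ; usage = ≤-trans (sumTo-push≤ B (length (F i)) i T) (s≤s usage) }
    where
    open Filled Φ
    inB′ : ∀ w → w < suc i → w ∈ push B (length (F i)) i (length (F w))
    inB′ w w< with w ≟ i
    ... | yes refl = ∈-push-new B (length (F i)) i
    ... | no ne = ∈-push⁺ B (length (F i)) i (inB w (≤∧≢⇒< (≤-pred w<) ne))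
    B⊆′ : ∀ b w → w ∈ push B (length (F i)) i b → w < suc i × length (F w) ≡ b
    B⊆′ b w w∈ with ∈-push⁻ B (length (F i)) i w∈
    ... | inj₁ (refl , refl) = ≤-refl , refl
    ... | inj₂ w∈′ = let w< , e = B⊆ b w w∈′ in m≤n⇒m≤1+n w< , e

  getDegree-correct : ∀ i k B s → Filling i k B s →
    Filling i k B (exec getDegree s) × sc (exec getDegree s) ent ≡ length (F i)
  getDegree-correct i k B s I = record { Filling I } , trans (degree≡ (sc s vu)) (cong (λ z → length (F z)) vu≡)
    where open Filling I

  pushVertex-correct : ∀ i k B s → Filling i k B s × sc s ent ≡ length (F i) →
    Filling i k (push B (length (F i)) i) (exec (pushBucket ent vu) s)
  pushVertex-correct i k B s (I , e) = record
    { size≡ = size≡ ; bound≡ = bound≡ ; vu≡ = vu≡ ; ctr≡ = ctr≡ ; arcs = arcs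
    ; bkts = subst₂ (λ l x → Lists _ _ _ (sc s node + 1) (push B l x)) e vu≡ (lists-push (sc s ent) (sc s vu) bkts)
    ; degree≡ = degree≡ ; removed0 = removed0 ; marks0 = marks0 ; colour0 = colour0 }
    where open Filling I

  nextVertex-correct : ∀ i k B s → Filling i (suc k) B s → Filling (suc i) k B (exec nextVertex s)
  nextVertex-correct i k B s I = record
    { size≡ = size≡ ; bound≡ = bound≡ ; vu≡ = trans (cong (_+ 1) vu≡) (+-comm i 1) ; ctr≡ = cong (_∸ 1) ctr≡
    ; arcs = arcs ; bkts = bkts ; degree≡ = degree≡ ; removed0 = removed0 ; marks0 = marks0 ; colour0 = colour0 }
    where open Filling I

  Fillable : List ℕ → Store → Set
  Fillable xs s = ∃[ i ] ∃[ B ] (i + length xs ≡ N × Filling i (length xs) B s × Filled i B)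

  fillBuckets-correct : ∀ s →
    sc s size ≡ N → suc (sc s bound) ≡ T → Lists (ar s arcHead) (ar s arcNext) (ar s arcTo) nb F →
    (∀ w → ar s degree w ≡ length (F w)) → Blank s →
    fillBuckets ⊢ s ⟶[ 5 + 9 * N ] (λ s′ → ∃[ B ] (Filling N 0 B s′ × Filled N B))
  fillBuckets-correct s sz bd arcs dg bl = t-≤ (≤-reflexive cost) (t-seq {P = Fillable (upTo N)}
    (t-blk initFill start)
    (λ s I → t-map finish (while-list ctr _ (λ _ → 8) Fillable
      (λ { _ (_ , _ , _ , I , _) → Filling.ctr≡ I }) body (upTo N) s I)))
    where
    open Blank bl
    cost : 4 + suc (Σl (λ _ → 9) (upTo N)) ≡ 5 + 9 * N
    cost = cong (5 +_) (trans (Σl-const 9 (upTo N)) (trans (cong (_* 9) (length-upTo N)) (*-comm N 9)))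
    start : Fillable (upTo N) (exec initFill s)
    start = 0 , (λ _ → []) , length-upTo N , record
      { size≡ = sz ; bound≡ = trans (+-comm _ 1) bd ; vu≡ = refl
      ; ctr≡ = trans (+-identityʳ _) (trans sz (sym (length-upTo N))) ; arcs = arcs
      ; bkts = λ l → subst (λ z → Chain (ar s bktNext) (ar s bktVal) 0 z []) (sym (bktHead0 l)) nil
      ; degree≡ = dg ; removed0 = removed0 ; marks0 = marks0 ; colour0 = colour0 } ,
      record { inB = λ _ () ; B⊆ = λ _ _ () ; usage = ≤-reflexive (sumTo-zero T (λ _ → refl)) }
    body : ∀ y ys s → Fillable (y ∷ ys) s →
      0 < sc s ctr × (blk getDegree ▸ blk (pushBucket ent vu) ▸ blk nextVertex) ⊢ s ⟶[ 8 ] Fillable ys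
    body y ys s (i , B , e , I , Φ) = subst (0 <_) (sym (Filling.ctr≡ I)) z<s ,
      t-seq (t-blk getDegree (getDegree-correct i _ B s I)) λ s I →
      t-seq (t-blk (pushBucket ent vu) (pushVertex-correct i _ B s I)) λ s I →
      t-blk nextVertex (suc i , _ , trans (sym (+-suc i _)) e , nextVertex-correct i _ _ s I , filled-push i B Φ)
    finish : ∀ {s} → Fillable [] s → ∃[ B ] (Filling N 0 B s × Filled N B)
    finish (i , B , e , I , Φ) with trans (sym (+-identityʳ i)) e
    ... | refl = B , I , Φ

  record Frame (t k q : ℕ) (B : ℕ → List ℕ) (vs : List ℕ) (s : Store) : Set where
    field
      lvl≡    : sc s lvl ≡ t
      ctr≡    : sc s ctr ≡ k
      inc≡    : sc s mark′ ≡ q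
      size≡   : sc s size ≡ N
      arcs    : Lists (ar s arcHead) (ar s arcNext) (ar s arcTo) nb F
      bkts    : Lists (ar s bktHead) (ar s bktNext) (ar s bktVal) (sc s node) B
      stack   : Stack (ar s order) (sc s stk) vs
      marks0  : AllZero (ar s marks)
      colour0 : AllZero (ar s colour)

  record Peeled (t k q : ℕ) (B : ℕ → List ℕ) (vs R : List ℕ) (s : Store) : Set where
    field
      frame : Frame t k q B vs s
      peel  : Peel t (ar s removed) (ar s degree) B vs R

  lookBucket-correct : ∀ t k q B vs s → Peeled t k q B vs [] s →
    Peeled t k (1 ∸ ar s bktHead t) B vs [] (exec lookBucket s) × sc (exec lookBucket s) ent ≡ ar s bktHead t
  lookBucket-correct _ k q B vs s record { frame = fr@record { lvl≡ = refl } ; peel = pl } =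
    record { frame = record { lvl≡ = refl ; ctr≡ = ctr≡ ; inc≡ = refl ; size≡ = size≡ ; arcs = arcs ; bkts = bkts
      ; stack = stack ; marks0 = marks0 ; colour0 = colour0 } ; peel = pl } , refl
    where open Frame fr

  nextLevel-correct : ∀ t k B vs q s → Peeled t k q B vs [] s → (q ≡ 1 → B t ≡ []) → q ≡ 0 ⊎ q ≡ 1 →
    Peeled (t + q) (k ∸ q) q B vs [] (exec nextLevel s)
  nextLevel-correct t k B vs q s Π empty q01 = record
    { frame = record { lvl≡ = cong₂ _+_ lvl≡ inc≡ ; ctr≡ = cong₂ _∸_ ctr≡ inc≡ ; inc≡ = inc≡ ; size≡ = size≡
      ; arcs = arcs ; bkts = bkts ; stack = stack ; marks0 = marks0 ; colour0 = colour0 }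
    ; peel = advance q01 }
    where
    open Peeled Π
    open Frame frame
    advance : q ≡ 0 ⊎ q ≡ 1 → Peel (t + q) (ar s removed) (ar s degree) B vs []
    advance (inj₁ refl) = subst (λ z → Peel z (ar s removed) (ar s degree) B vs []) (sym (+-identityʳ t)) peel
    advance (inj₂ refl) = subst (λ z → Peel z (ar s removed) (ar s degree) B vs []) (+-comm 1 t) (peel-level peel (empty refl))

  record Popped (t k : ℕ) (B : ℕ → List ℕ) (vs : List ℕ) (v : ℕ) (xs : List ℕ) (s : Store) : Set where
    field
      top≡   : B t ≡ v ∷ xs
      vu≡   : sc s vu ≡ v
      pend≡ : sc s pend ≡ 1 ∸ ar s removed v
      frame : Frame t k 0 (pop B t xs) vs s
      peel  : Peel t (ar s removed) (ar s degree) B vs []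

  popBucket-correct : ∀ t k B vs i s → Peeled t k 0 B vs [] s → sc s ent ≡ suc i → ar s bktHead t ≡ suc i →
    ∃[ v ] ∃[ xs ] Popped t k B vs v xs (exec popBucket s)
  popBucket-correct _ k B vs i s record { frame = fr@record { lvl≡ = refl } ; peel = pl } e h
    with chain-suc (Frame.bkts fr (sc s lvl)) (subst (0 <_) (sym h) z<s)
  ... | i′ , v , xs , h′ , b≡ , val≡ , _ with trans (sym h) h′
  ... | refl = v , xs , record
      { top≡ = b≡ ; vu≡ = trans at val≡ ; pend≡ = cong (λ z → 1 ∸ ar s removed z) (trans at val≡)
      ; frame = record { lvl≡ = refl ; ctr≡ = ctr≡ ; inc≡ = inc≡ ; size≡ = size≡ ; arcs = arcs
        ; bkts = subst (λ z → Lists (update (ar s bktHead) (sc s lvl) (ar s bktNext z)) (ar s bktNext) (ar s bktVal) (sc s node) (pop B (sc s lvl) xs))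
            (sym (cong (_∸ 1) e)) (proj₁ (lists-pop (sc s lvl) bkts h b≡))
        ; stack = stack ; marks0 = marks0 ; colour0 = colour0 }
      ; peel = pl }
    where
    open Frame fr
    at : ar s bktVal (sc s ent ∸ 1) ≡ ar s bktVal i
    at = cong (λ z → ar s bktVal (z ∸ 1)) e

  -- A swept arc adds at most one counted bucket entry, so entries plus pending arcs never grow, and
  -- `K` can be fixed when the vertex is removed.
  record Sweeping (t k : ℕ) (vs R : List ℕ) (K : ℕ) (s : Store) : Set where
    field
      {B}   : ℕ → List ℕ
      state : Peeled t k 0 B vs R s
      arcs  : Chain (ar s arcNext) (ar s arcTo) nb (sc s arcp) R
      R<N   : All (_< N) R
      usage  : sumTo (length ∘ B) T + length R ≤ K

  removeVertex-correct : ∀ t k B vs v xs s → Popped t k B vs v xs s → ar s removed v ≡ 0 →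
    Sweeping t k (v ∷ vs) (F v) (sumTo (length ∘ pop B t xs) T + length (F v)) (exec removeVertex s)
  removeVertex-correct t k B vs _ xs s Π@record { vu≡ = refl } alive = record
    { state = record
      { frame = record { lvl≡ = lvl≡ ; ctr≡ = ctr≡ ; inc≡ = inc≡ ; size≡ = size≡ ; arcs = arcs ; bkts = bkts
        ; stack = subst (λ z → Stack (update (ar s order) (sc s vu) (sc s stk)) z (sc s vu ∷ vs)) (+-comm 1 (sc s vu)) (stack-push (sc s vu) fresh stack)
        ; marks0 = marks0 ; colour0 = colour0 }
      ; peel = peel-remove peel top≡ alive }
    ; arcs = arcs (sc s vu) ; R<N = F<N (sc s vu) ; usage = ≤-refl }
    where
    open Popped Π
    open Frame frame
    fresh : sc s vu ∉ vs
    fresh = remOf-∉ vs (trans (sym (Peel.rem≡ peel (sc s vu))) alive)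

  record Lowered (t k : ℕ) (vs : List ℕ) (w : ℕ) (R : List ℕ) (K : ℕ) (s : Store) : Set where
    field
      {B}   : ℕ → List ℕ
      {b}   : ℕ
      colr≡ : sc s colr ≡ b
      vv≡   : sc s vv ≡ w
      frame : Frame t k 0 B vs s
      peel  : Peel t (ar s removed) (ar s degree) (push B b w) vs R
      arcs  : Chain (ar s arcNext) (ar s arcTo) nb (ar s arcNext (sc s arcp)) R
      R<N   : All (_< N) R
      usage  : suc (sumTo (length ∘ B) T) + length R ≤ K

  lowerDegree-correct : ∀ t k vs w R K s → Sweeping t k vs (w ∷ R) K s →
    Lowered t k vs w R K (exec lowerDegree s)
  lowerDegree-correct _ k vs w R K s Ψ@record { state = record { frame = record { lvl≡ = refl } } }
    with sc s arcp | Sweeping.arcs Ψ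
  ... | suc i | cons _ refl c = record
    { colr≡ = refl ; vv≡ = refl
    ; frame = record { lvl≡ = refl ; ctr≡ = ctr≡ ; inc≡ = inc≡ ; size≡ = size≡ ; arcs = Frame.arcs frame ; bkts = bkts
      ; stack = stack ; marks0 = marks0 ; colour0 = colour0 }
    ; peel = peel-sweep (All.head R<N) peel
    ; arcs = c ; R<N = All.tail R<N ; usage = subst (_≤ K) (+-suc _ _) usage }
    where
    open Sweeping Ψ
    open Peeled state
    open Frame frame

  pushSwept-correct : ∀ t k vs w R K s → Lowered t k vs w R K s →
    Sweeping t k vs R K (exec nextArc (exec (pushBucket colr vv) s))
  pushSwept-correct t k vs _ R K s Λ@record { colr≡ = refl ; vv≡ = refl } = record
    { state = record
      { frame = record { lvl≡ = lvl≡ ; ctr≡ = ctr≡ ; inc≡ = inc≡ ; size≡ = size≡ ; arcs = Frame.arcs frame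
        ; bkts = lists-push (sc s colr) (sc s vv) bkts ; stack = stack ; marks0 = marks0 ; colour0 = colour0 }
      ; peel = peel }
    ; arcs = arcs ; R<N = R<N
    ; usage = ≤-trans (+-monoˡ-≤ (length R) (sumTo-push≤ B (sc s colr) (sc s vv) T)) usage }
    where
    open Lowered Λ
    open Frame frame hiding (arcs)

  sweepArcs-correct : ∀ t k vs R K s → Sweeping t k vs R K s →
    sweepArcs ⊢ s ⟶[ 1 + 14 * length R ] Sweeping t k vs [] K
  sweepArcs-correct t k vs R K s Ψ = t-≤ (≤-reflexive (cong suc (trans (Σl-const 14 R) (*-comm (length R) 14))))
    (while-list arcp sweepArc (λ _ → 13) (λ R → Sweeping t k vs R K) stop body R s Ψ)
    where
    stop : ∀ s → Sweeping t k vs [] K s → sc s arcp ≡ 0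
    stop s Ψ with sc s arcp | Sweeping.arcs Ψ
    ... | _ | nil = refl
    body : ∀ w R s → Sweeping t k vs (w ∷ R) K s → 0 < sc s arcp × sweepArc ⊢ s ⟶[ 13 ] Sweeping t k vs R K
    body w R s Ψ = positive (Sweeping.arcs Ψ) ,
      t-seq (t-blk lowerDegree (lowerDegree-correct t k vs w R K s Ψ)) λ s Λ →
      t-seq {P = λ s₁ → Sweeping t k vs R K (exec nextArc s₁)}
        (t-blk (pushBucket colr vv) (pushSwept-correct t k vs w R K s Λ)) λ s₁ Ψ₁ →
      t-blk nextArc Ψ₁
      where
      positive : ∀ {h} → Chain (ar s arcNext) (ar s arcTo) nb h (w ∷ R) → 0 < h
      positive (cons _ _ _) = z<s

  -- The sweep after a removal costs 14 per neighbour and may add a bucket entry, worth 16 in the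
  -- potential. These 30 are covered by 40, and the constant part by 10 together with the 16 of the
  -- popped entry.
  charge : ℕ → ℕ
  charge w = 10 + 40 * length (F w)

  -- A round advances the level, discards a stale entry or removes a vertex, and each summand pays
  -- for one of these. The first two cost 7 and 15 steps with all tests, hence the factor 16.
  potential : ℕ → (ℕ → List ℕ) → List ℕ → ℕ
  potential k B vs = 16 * k + 16 * sumTo (length ∘ B) T + aliveSum charge (remOf vs) N

  record Step (p : ℕ) (s : Store) : Set where
    field
      {t k q} : ℕ
      {B}     : ℕ → List ℕ
      {vs}    : List ℕ
      levels  : k + t ≡ T
      peeled  : Peeled t k q B vs [] s
      budget  : potential k B vs ≤ p

  usage-pop : ∀ B t {v xs} → t < T → B t ≡ v ∷ xs → suc (sumTo (length ∘ pop B t xs) T) ≡ sumTo (length ∘ B) T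
  usage-pop B t {v} {xs} t< e = +-cancelʳ-≡ (length xs) _ _ (trans (sym (+-suc _ _)) (trans
    (cong (λ z → sumTo (length ∘ pop B t xs) T + z) (sym (cong length e)))
    (trans (sumTo-change {length ∘ B} {length ∘ pop B t xs} t T t< (λ j ne → cong length (pop-≢ j ne)))
      (cong (sumTo (length ∘ B) T +_) (cong length pop-≡)))))
    where
    pop-≢ : ∀ j → j ≢ t → pop B t xs j ≡ B j
    pop-≢ j ne rewrite ≢⇒≡ᵇ ne = refl
    pop-≡ : pop B t xs t ≡ xs
    pop-≡ rewrite ≡ᵇ-refl t = refl

  record Served (t k : ℕ) (B : ℕ → List ℕ) (vs : List ℕ) (cost : ℕ) (s : Store) : Set where
    field
      {q}    : ℕ
      {B′}   : ℕ → List ℕ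
      {vs′}  : List ℕ
      peeled : Peeled t k q B′ vs′ [] s
      empty  : q ≡ 1 → B′ t ≡ []
      inc01  : q ≡ 0 ⊎ q ≡ 1
      -- Around the body, `lookBucket` takes 3 steps and `nextLevel` 2; the `suc` is the loop test.
      paid   : suc (5 + cost) + potential (k ∸ q) B′ vs′ ≤ potential k B vs

  serve : ∀ t k B vs s → k + t ≡ T → 0 < k →
    Peeled t k (1 ∸ ar s bktHead t) B vs [] s × sc s ent ≡ ar s bktHead t →
    ∃[ b ] (whenPos ent (blk popBucket ▸ whenPos pend (blk removeVertex ▸ sweepArcs)) ⊢ s ⟶[ b ] Served t k B vs b)
  serve t (suc k) B vs s lv _ (Π , ent≡) with ar s bktHead t in h
  ... | zero = 1 , t-skip ent≡ record
    { peeled = Π ; empty = λ _ → chain-zero (Frame.bkts (Peeled.frame Π) t) h ; inc01 = inj₂ refl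
    ; paid = ≤-trans (+-monoˡ-≤ (potential k B vs) (≤ᵇ⇒≤ 7 16 _)) (≤-reflexive (solve 3 (λ k b a →
        con 16 :+ (con 16 :* k :+ b :+ a) := con 16 :* (con 1 :+ k) :+ b :+ a) refl k (16 * sumTo (length ∘ B) T) (aliveSum charge (remOf vs) N))) }
    where open +-*-Solver
  ... | suc i with popBucket-correct t (suc k) B vs i s (subst (λ z → Peeled t (suc k) z B vs [] s) (0∸n≡0 i) Π) ent≡ h
  ... | v , xs , Π′ with ar s removed v in r
  ... | suc r₀ = 9 , t-when (subst (0 <_) (sym ent≡) z<s)
      (t-seq {P = λ s₁ → sc s₁ pend ≡ 0 × Peeled t (suc k) 0 (pop B t xs) vs [] s₁}
        (t-blk popBucket (trans (Popped.pend≡ Π′) (trans (cong (1 ∸_) r) (0∸n≡0 r₀)) , record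
          { frame = Popped.frame Π′
          ; peel = peel-skip (Popped.peel Π′) (Popped.top≡ Π′) (λ e → contradiction (trans (sym e) r) (λ ())) }))
        λ s₁ (z , Π₁) → t-skip z record
          { peeled = Π₁ ; empty = λ () ; inc01 = inj₁ refl
          ; paid = subst (λ z → 15 + potential (suc k) (pop B t xs) vs ≤ 16 * suc k + 16 * z + aliveSum charge (remOf vs) N)
              (usage-pop B t t<T (Popped.top≡ Π′))
              (≤-trans (+-monoˡ-≤ (potential (suc k) (pop B t xs) vs) (≤ᵇ⇒≤ 15 16 _)) (≤-reflexive (solve 3 (λ k b a →
                con 16 :+ (k :+ con 16 :* b :+ a) := k :+ con 16 :* (con 1 :+ b) :+ a) refl
                (16 * suc k) (sumTo (length ∘ pop B t xs) T) (aliveSum charge (remOf vs) N)))) })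
    where
    open +-*-Solver
    t<T : t < T
    t<T = subst (t <_) lv (s≤s (m≤n+m t k))
  ... | zero = suc (7 + suc (5 + (1 + 14 * L))) , t-when (subst (0 <_) (sym ent≡) z<s)
      (t-seq {P = λ s₁ → sc s₁ pend ≡ 1 × ar s₁ removed v ≡ 0 × Popped t (suc k) B vs v xs s₁}
        (t-blk popBucket (trans (Popped.pend≡ Π′) (cong (1 ∸_) r) , r , Π′))
        λ s₁ (o , r₁ , Π₁) → t-when (subst (0 <_) (sym o) z<s)
          (t-seq (t-blk removeVertex (removeVertex-correct t (suc k) B vs v xs s₁ Π₁ r₁))
            λ s₂ Ψ → t-map finish (sweepArcs-correct t (suc k) (v ∷ vs) (F v) _ s₂ Ψ)))
    where
    open +-*-Solver
    L = length (F v)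
    σ = sumTo (length ∘ pop B t xs) T
    t<T : t < T
    t<T = subst (t <_) lv (s≤s (m≤n+m t k))
    v<N : v < N
    v<N = Peel.B<N (Popped.peel Π′) t v (subst (v ∈_) (sym (Popped.top≡ Π′)) (here refl))
    finish : ∀ {s₃} → Sweeping t (suc k) (v ∷ vs) [] (σ + L) s₃ →
      Served t (suc k) B vs (suc (7 + suc (5 + (1 + 14 * L)))) s₃
    finish Ψ = record
      { peeled = Sweeping.state Ψ ; empty = λ () ; inc01 = inj₁ refl ; paid = begin
        suc (5 + suc (7 + suc (5 + (1 + 14 * L)))) + (16 * suc k + 16 * sumTo (length ∘ Sweeping.B Ψ) T + A′)
          ≤⟨ +-monoʳ-≤ (suc (5 + suc (7 + suc (5 + (1 + 14 * L)))))
               (+-monoˡ-≤ A′ (+-monoʳ-≤ (16 * suc k) (*-monoʳ-≤ 16 (subst (_≤ σ + L) (+-identityʳ _) (Sweeping.usage Ψ))))) ⟩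
        suc (5 + suc (7 + suc (5 + (1 + 14 * L)))) + (16 * suc k + 16 * (σ + L) + A′)
          ≡⟨ solve 4 (λ k σ l a → con 21 :+ con 14 :* l :+ (k :+ con 16 :* (σ :+ l) :+ a)
               := k :+ con 16 :* σ :+ (a :+ (con 21 :+ con 30 :* l))) refl (16 * suc k) σ L A′ ⟩
        16 * suc k + 16 * σ + (A′ + (21 + 30 * L))
          ≤⟨ +-monoʳ-≤ (16 * suc k + 16 * σ) (+-monoʳ-≤ A′ (+-mono-≤ (≤ᵇ⇒≤ 21 26 _) (*-monoˡ-≤ L (≤ᵇ⇒≤ 30 40 _)))) ⟩
        16 * suc k + 16 * σ + (A′ + (26 + 40 * L))
          ≡⟨ solve 4 (λ k σ l a → k :+ con 16 :* σ :+ (a :+ (con 26 :+ con 40 :* l))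
               := k :+ con 16 :* (con 1 :+ σ) :+ (a :+ (con 10 :+ con 40 :* l))) refl (16 * suc k) σ L A′ ⟩
        16 * suc k + 16 * suc σ + (A′ + charge v)
          ≡⟨ cong₂ (λ x y → 16 * suc k + 16 * x + y) (usage-pop B t t<T (Popped.top≡ Π′))
               (aliveSum-remove charge (remOf vs) v N v<N (trans (sym (Peel.rem≡ (Popped.peel Π′) v)) r)) ⟩
        potential (suc k) B vs ∎ }
      where
      open ≤-Reasoning
      A′ = aliveSum charge (update (remOf vs) v 1) N

  levels-advance : ∀ k t q → 0 < k → q ≡ 0 ⊎ q ≡ 1 → (k ∸ q) + (t + q) ≡ k + t
  levels-advance k       t _ _ (inj₁ refl) = cong (k +_) (+-identityʳ t)
  levels-advance (suc k) t _ _ (inj₂ refl) = trans (cong (k +_) (+-comm t 1)) (+-suc k t)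

  peelStep-correct : ∀ p s → Step p s → 0 < sc s ctr → ∃[ b ] ∃[ p′ ] (b + p′ < p × peelStep ⊢ s ⟶[ b ] Step p′)
  peelStep-correct p s record { t = t ; k = k ; q = q ; B = B ; vs = vs ; levels = lv ; peeled = Π ; budget = bu } ctr>0 =
    5 + b , p ∸ suc (5 + b) , ≤-reflexive (m+[n∸m]≡n enough) , t-≤ (≤-reflexive shuffle)
      (t-seq {P = _≡ look} (t-blk lookBucket refl) λ { s₁ refl →
       t-seq (proj₂ served) λ s₂ V → t-blk nextLevel (finish s₂ V) })
    where
    k>0 : 0 < k
    k>0 = subst (0 <_) (Frame.ctr≡ (Peeled.frame Π)) ctr>0
    look : Store
    look = exec lookBucket s
    served : ∃[ b ] (whenPos ent (blk popBucket ▸ whenPos pend (blk removeVertex ▸ sweepArcs)) ⊢ look ⟶[ b ] Served t k B vs b)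
    served = serve t k B vs look lv k>0 (lookBucket-correct t k q B vs s Π)
    b : ℕ
    b = proj₁ served
    paid≤ : ∀ {s₂} → (V : Served t k B vs b s₂) →
      suc (5 + b) + potential (k ∸ Served.q V) (Served.B′ V) (Served.vs′ V) ≤ p
    paid≤ V = ≤-trans (Served.paid V) bu
    enough : suc (5 + b) ≤ p
    enough with proj₂ served
    ... | s₂ , _ , _ , _ , V = ≤-trans (m≤m+n (suc (5 + b)) _) (paid≤ V)
    shuffle : 3 + (b + 2) ≡ 5 + b
    shuffle = cong (3 +_) (+-comm b 2)
    finish : ∀ s₂ → Served t k B vs b s₂ → Step (p ∸ suc (5 + b)) (exec nextLevel s₂)
    finish s₂ V = record
      { levels = trans (levels-advance k t q′ k>0 inc01) lv
      ; peeled = nextLevel-correct t k B′ vs′ q′ s₂ (Served.peeled V) empty inc01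
      ; budget = subst (_≤ p ∸ suc (5 + b)) (m+n∸m≡n (suc (5 + b)) _) (∸-monoˡ-≤ (suc (5 + b)) (paid≤ V)) }
      where open Served V renaming (q to q′)

  record FullyPeeled (s : Store) : Set where
    field
      {vs}    : List ℕ
      size≡   : sc s size ≡ N
      arcs    : Lists (ar s arcHead) (ar s arcNext) (ar s arcTo) nb F
      stack   : Stack (ar s order) (sc s stk) vs
      ordered : Ordered vs
      all     : ∀ w → w < N → remOf vs w ≢ 0
      marks0  : AllZero (ar s marks)
      colour0 : AllZero (ar s colour)

  peelCost : ℕ
  peelCost = 16 * T + 16 * N + sumTo charge N

  peelAll-correct : ∀ B s → Filling N 0 B s → Filled N B →
    peelAll ⊢ s ⟶[ 4 + peelCost ] FullyPeeled
  peelAll-correct B s I Φ = t-≤ (≤-reflexive (+-suc 3 peelCost)) (t-seq {P = Step peelCost} (t-blk initPeel start)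
    λ s₁ S₁ → t-map finish (while-potential ctr peelStep Step peelStep-correct peelCost s₁ S₁))
    where
    open Filling I
    open Filled Φ
    start : Step peelCost (exec initPeel s)
    start = record
      { t = 0 ; k = T ; q = sc s mark′ ; B = B ; vs = []
      ; levels = +-identityʳ T
      ; peeled = record
        { frame = record { lvl≡ = refl ; ctr≡ = trans (+-identityʳ _) bound≡ ; inc≡ = refl ; size≡ = size≡ ; arcs = arcs
          ; bkts = bkts ; stack = nil ; marks0 = marks0 ; colour0 = colour0 }
        ; peel = peel-start degree≡ (λ w w< → subst (λ z → w ∈ B z) (sym (degree≡ w)) (inB w w<))
            (λ b w w∈ → let w< , e = B⊆ b w w∈ in w< , trans (degree≡ w) e) removed0 }
      ; budget = +-mono-≤ (+-monoʳ-≤ (16 * T) (*-monoʳ-≤ 16 usage)) (≤-reflexive (sumTo-cong N (λ w _ → +-identityʳ (charge w)))) }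
    finish : ∀ {s} → sc s ctr ≡ 0 × ∃[ p ] Step p s → FullyPeeled s
    finish (z , p , record { t = t ; k = k ; levels = lv ; peeled = Π }) = record
      { size≡ = Frame.size≡ fr ; arcs = Frame.arcs fr ; stack = Frame.stack fr ; ordered = Peel.ordered (Peeled.peel Π)
      ; all = all-removed (Peeled.peel Π) (λ w w< → subst (length (F w) <_) (sym t≡T) (F<T w w<))
      ; marks0 = Frame.marks0 fr ; colour0 = Frame.colour0 fr }
      where
      fr = Peeled.frame Π
      t≡T : t ≡ T
      t≡T = trans (cong (_+ t) (sym (trans (sym (Frame.ctr≡ fr)) z))) lv

-- Greedy colouring

-- Marks are time stamps: each vertex uses the fresh stamp `node`, so the array is never cleared,
-- and `tmp ⊖ stamp` is positive exactly for colours marked in the current round. Colour 0 means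
-- uncoloured; such neighbours mark entry 0, which the scan from 1 never reads.
beginVertex markNext beginScan scanNext endVertex : List Stmt
beginVertex = (vu := stk ⊖# 1) ∷ (arcp := arcHead ! vu) ∷ (node := stamp ⊕# 1) ∷ []
markNext    = (arcp := arcp ⊖# 1) ∷ (vv := arcTo ! arcp) ∷ (tmp := colour ! vv) ∷ (marks ! tmp := node) ∷ (arcp := arcNext ! arcp) ∷ []
beginScan   = (colr :=# 1) ∷ (tmp := marks ! colr) ∷ (mark′ := tmp ⊖ stamp) ∷ []
scanNext    = (colr := colr ⊕# 1) ∷ (tmp := marks ! colr) ∷ (mark′ := tmp ⊖ stamp) ∷ []
endVertex   = (colour ! vu := colr) ∷ (stamp := node ⊕# 0) ∷ (stk := order ! vu) ∷ []

colourVertex colourAll : Cmd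
colourVertex = blk beginVertex ▸ whilePos arcp (blk markNext) ▸ blk beginScan ▸ whilePos mark′ (blk scanNext) ▸ blk endVertex
colourAll    = blk ((stamp :=# 0) ∷ []) ▸ whilePos stk colourVertex

module _ (N nb : ℕ) (F : ℕ → List ℕ) (symF : ∀ a b → mult a (F b) ≡ mult b (F a))
  (F-sym : ∀ {x y} → y ∈ F x → x ∈ F y) (F-irrefl : ∀ x → x ∉ F x) where

  open Peeling N F symF

  record Coloured (L : List ℕ) (col : ℕ → ℕ) : Set where
    field
      waiting  : ∀ w → remOf L w ≢ 0 → col w ≡ 0
      finished : ∀ w → w < N → remOf L w ≡ 0 → 0 < col w
      proper   : ∀ v w → w ∈ F v → 0 < col v → 0 < col w → col v ≢ col w
      small    : ∀ v → 0 < col v → ∃[ d ] (Core d × col v ≤ suc d)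

  remOf-tail : ∀ v L w → remOf (v ∷ L) w ≡ 0 → w ≢ v × remOf L w ≡ 0
  remOf-tail v L w e = w≢v , trans (sym (update-≢ (remOf L) 1 w≢v)) e
    where
    w≢v : w ≢ v
    w≢v refl = contradiction (trans (sym (update-≡ (remOf L) v 1)) e) (λ ())

  -- The stack returns vertices in reverse order of removal, so `L` holds those removed before `v`.
  -- Then `cnt (remOf L) (F v)` counts the neighbours present when `v` was removed, the degree for
  -- which `Ordered` supplies a core.
  coloured-step : ∀ v L col c → Ordered (v ∷ L) → Coloured (v ∷ L) col → 0 < c →
    (∀ w → w ∈ F v → col w ≢ c) → c ≤ suc (cnt (remOf L) (F v)) → Coloured L (update col v c)
  coloured-step v L col c (_ , v∉L , core , _) Γ c>0 avoid c≤ = record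
    { waiting = waiting′ ; finished = finished′ ; proper = proper′ ; small = small′ }
    where
    open Coloured Γ
    waiting′ : ∀ w → remOf L w ≢ 0 → update col v c w ≡ 0
    waiting′ w ne with w ≟ v
    ... | yes refl = contradiction v∉L ne
    ... | no w≢v = trans (update-≢ col c w≢v) (waiting w (λ e → ne (trans (sym (update-≢ (remOf L) 1 w≢v)) e)))
    finished′ : ∀ w → w < N → remOf L w ≡ 0 → 0 < update col v c w
    finished′ w w< e with w ≟ v
    ... | yes refl = subst (0 <_) (sym (update-≡ col v c)) c>0
    ... | no w≢v = subst (0 <_) (sym (update-≢ col c w≢v)) (finished w w< (trans (update-≢ (remOf L) 1 w≢v) e))
    proper′ : ∀ x w → w ∈ F x → 0 < update col v c x → 0 < update col v c w → update col v c x ≢ update col v c w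
    proper′ x w w∈ px pw e with x ≟ v | w ≟ v
    ... | yes refl | yes refl = F-irrefl v w∈
    ... | yes refl | no w≢v = avoid w w∈ (sym (trans (sym (update-≡ col v c)) (trans e (update-≢ col c w≢v))))
    ... | no x≢v | yes refl = avoid x (F-sym w∈) (trans (sym (update-≢ col c x≢v)) (trans e (update-≡ col v c)))
    ... | no x≢v | no w≢v = proper x w w∈ (subst (0 <_) (update-≢ col c x≢v) px) (subst (0 <_) (update-≢ col c w≢v) pw)
                              (trans (sym (update-≢ col c x≢v)) (trans e (update-≢ col c w≢v)))
    small′ : ∀ x → 0 < update col v c x → ∃[ d ] (Core d × update col v c x ≤ suc d)
    small′ x px with x ≟ v
    ... | yes refl = _ , core , subst (_≤ _) (sym (update-≡ col v c)) c≤
    ... | no x≢v = let d , cd , le = small x (subst (0 <_) (update-≢ col c x≢v) px)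
                   in d , cd , subst (_≤ suc d) (sym (update-≢ col c x≢v)) le

  record Greedy (L : List ℕ) (s : Store) : Set where
    field
      size≡    : sc s size ≡ N
      arcs     : Lists (ar s arcHead) (ar s arcNext) (ar s arcTo) nb F
      stack    : Stack (ar s order) (sc s stk) L
      ordered  : Ordered L
      coloured : Coloured L (ar s colour)
      marks≤   : ∀ c → ar s marks c ≤ sc s stamp

  record Marking (v : ℕ) (L R : List ℕ) (s : Store) : Set where
    field
      size≡    : sc s size ≡ N
      arcs     : Lists (ar s arcHead) (ar s arcNext) (ar s arcTo) nb F
      stack    : Stack (ar s order) (ar s order v) L
      ordered  : Ordered (v ∷ L)
      coloured : Coloured (v ∷ L) (ar s colour)
      vu≡      : sc s vu ≡ v
      node≡    : sc s node ≡ sc s stamp + 1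
      chain    : Chain (ar s arcNext) (ar s arcTo) nb (sc s arcp) R
      R⊆F      : ∀ w → w ∈ R → w ∈ F v
      marked   : ∀ w → w ∈ F v → w ∈ R ⊎ ar s marks (ar s colour w) ≡ sc s stamp + 1
      sound    : ∀ c → ar s marks c ≤ sc s stamp ⊎
                   (ar s marks c ≡ sc s stamp + 1 × ∃[ w ] (w ∈ F v × ar s colour w ≡ c))

  beginVertex-correct : ∀ v L s → Greedy (v ∷ L) s → Marking v L (F v) (exec beginVertex s)
  beginVertex-correct v L s Γ with sc s stk | Greedy.stack Γ
  ... | suc _ | cons st = record
    { size≡ = size≡ ; arcs = arcs ; stack = st ; ordered = ordered ; coloured = coloured ; vu≡ = refl ; node≡ = refl
    ; chain = arcs v ; R⊆F = λ _ w∈ → w∈ ; marked = λ _ w∈ → inj₁ w∈ ; sound = λ c → inj₁ (marks≤ c) }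
    where open Greedy Γ

  markNext-correct : ∀ v L w R s → Marking v L (w ∷ R) s → Marking v L R (exec markNext s)
  markNext-correct v L w R s M with sc s arcp | Marking.chain M
  ... | suc i | cons _ refl ch = record
    { size≡ = size≡ ; arcs = arcs ; stack = stack ; ordered = ordered ; coloured = coloured ; vu≡ = vu≡ ; node≡ = node≡
    ; chain = ch ; R⊆F = λ x x∈ → R⊆F x (there x∈) ; marked = marked′ ; sound = sound′ }
    where
    open Marking M
    col = ar s colour
    mk = ar s marks
    marked′ : ∀ x → x ∈ F v → x ∈ R ⊎ update mk (col w) (sc s node) (col x) ≡ sc s stamp + 1
    marked′ x x∈ with col x ≟ col w
    ... | yes e = inj₂ (trans (cong (update mk (col w) (sc s node)) e) (trans (update-≡ mk (col w) (sc s node)) node≡))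
    ... | no ne with marked x x∈
    ... | inj₁ (here refl) = contradiction refl ne
    ... | inj₁ (there x∈R) = inj₁ x∈R
    ... | inj₂ e = inj₂ (trans (update-≢ mk (sc s node) ne) e)
    sound′ : ∀ c → update mk (col w) (sc s node) c ≤ sc s stamp ⊎
               (update mk (col w) (sc s node) c ≡ sc s stamp + 1 × ∃[ x ] (x ∈ F v × col x ≡ c))
    sound′ c with c ≟ col w
    ... | yes refl = inj₂ (trans (update-≡ mk (col w) (sc s node)) node≡ , w , R⊆F w (here refl) , refl)
    ... | no ne rewrite update-≢ mk (sc s node) ne = sound c

  markAll-correct : ∀ v L R s → Marking v L R s → whilePos arcp (blk markNext) ⊢ s ⟶[ 1 + 6 * length R ] Marking v L []
  markAll-correct v L R s M = t-≤ (≤-reflexive (cong suc (trans (Σl-const 6 R) (*-comm (length R) 6))))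
    (while-list arcp (blk markNext) (λ _ → 5) (Marking v L) stop
      (λ w R s M → positive s (Marking.chain M) , t-blk markNext (markNext-correct v L w R s M)) R s M)
    where
    stop : ∀ s → Marking v L [] s → sc s arcp ≡ 0
    stop s M with sc s arcp | Marking.chain M
    ... | _ | nil = refl
    positive : ∀ s {h w R} → Chain (ar s arcNext) (ar s arcTo) nb h (w ∷ R) → 0 < h
    positive s (cons _ _ _) = z<s

  Marked : Store → ℕ → Set
  Marked s c = ∀ j → 0 < j → j < c → ar s marks j ≡ sc s stamp + 1

  -- The marked colours below c are distinct colours of already coloured neighbours.
  marked≤ : ∀ v L s c → Marking v L [] s → 0 < c → Marked s c → c ≤ suc (cnt (remOf L) (F v))
  marked≤ v L s (suc c) M _ J = s≤s (begin
    c                                ≡⟨ sym (trans (length-map suc (upTo c)) (length-upTo c)) ⟩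
    length (map suc (upTo c))        ≤⟨ unique-⊆-length (Unique.map⁺ suc-injective (Unique.upTo⁺ c)) used ⟩
    length (map (ar s colour) later) ≡⟨ length-map (ar s colour) later ⟩
    length later                     ≡⟨ length-filter-Σl later? (F v) ⟩
    Σl (λ w → ⟦ later? w ⟧) (F v)    ≤⟨ Σl-mono one (F v) ⟩
    cnt (remOf L) (F v)              ∎)
    where
    open ≤-Reasoning
    open Marking M
    later? : ∀ w → Dec (remOf L w ≡ 0)
    later? w = remOf L w ≟ 0
    later : List ℕ
    later = filter later? (F v)
    one : ∀ w → ⟦ later? w ⟧ ≤ 1 ∸ remOf L w
    one w with remOf L w
    ... | zero  = ≤-refl
    ... | suc _ = z≤n
    used : ∀ {j} → j ∈ map suc (upTo c) → j ∈ map (ar s colour) later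
    used j∈ with ∈-map⁻ suc j∈
    ... | i , i∈ , refl with J (suc i) z<s (s≤s (∈-upTo⁻ i∈)) | sound (suc i)
    ... | e | inj₁ le = contradiction (subst (_≤ sc s stamp) e le) (λ le′ → <-irrefl refl (subst (_≤ sc s stamp) (+-comm (sc s stamp) 1) le′))
    ... | e | inj₂ (_ , w , w∈ , cw) with remOf (v ∷ L) w ≟ 0
    ... | yes z = subst (_∈ map (ar s colour) later) cw
                    (∈-map⁺ (ar s colour) (∈-filter⁺ later? w∈ (proj₂ (remOf-tail v L w z))))
    ... | no nz = contradiction (trans (sym cw) (Coloured.waiting coloured w nz)) (λ ())

  -- A rejected colour costs the three steps of `scanNext` and a loop test, hence the factor 4 in
  -- the budget.
  record Scanning (v : ℕ) (L : List ℕ) (p : ℕ) (s : Store) : Set where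
    field
      marking : Marking v L [] s
      colr>0  : 0 < sc s colr
      below   : Marked s (sc s colr)
      mark≡   : sc s mark′ ≡ ar s marks (sc s colr) ∸ sc s stamp
      budget  : 4 * (suc (length (F v)) ∸ sc s colr) ≤ p

  beginScan-correct : ∀ v L s → Marking v L [] s → Scanning v L (4 * length (F v)) (exec beginScan s)
  beginScan-correct v L s M = record
    { marking = record { Marking M } ; colr>0 = z<s
    ; below = λ { (suc _) _ (s≤s ()) } ; mark≡ = refl ; budget = ≤-refl }

  scanNext-correct : ∀ v L p s → Scanning v L p s → 0 < sc s mark′ →
    ∃[ b ] ∃[ p′ ] (b + p′ < p × blk scanNext ⊢ s ⟶[ b ] Scanning v L p′)
  scanNext-correct v L p s Σ pos′ = 3 , p ∸ 4 , ≤-reflexive (m+[n∸m]≡n 4≤p) , t-blk scanNext record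
    { marking = record { Marking marking } ; colr>0 = ≤-trans colr>0 (m≤m+n _ 1)
    ; below = below′ ; mark≡ = refl
    ; budget = subst (λ z → 4 * (suc (length (F v)) ∸ z) ≤ p ∸ 4) (+-comm 1 (sc s colr))
        (subst (_≤ p ∸ 4) (m+n∸m≡n 4 _) (∸-monoˡ-≤ 4 spend)) }
    where
    open Scanning Σ
    c = sc s colr
    at-c : ar s marks c ≡ sc s stamp + 1
    at-c with Marking.sound marking c
    ... | inj₂ (e , _) = e
    ... | inj₁ le = contradiction (subst (0 <_) (trans mark≡ (m≤n⇒m∸n≡0 le)) pos′) (λ ())
    below′ : Marked s (c + 1)
    below′ j j>0 j< with j ≟ c
    ... | yes refl = at-c
    ... | no ne = below j j>0 (≤∧≢⇒< (≤-pred (subst (j <_) (+-comm c 1) j<)) ne)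
    -- If `c` is marked as well, all colours up to `c` are used by distinct entries of `F v`, so the
    -- scan cannot pass the degree.
    room : c < suc (length (F v))
    room = ≤-trans (marked≤ v L s (suc c) marking z<s (subst (Marked s) (+-comm c 1) below′)) (s≤s (cnt≤length (remOf L) (F v)))
    spend : 4 + 4 * (suc (length (F v)) ∸ suc c) ≤ p
    spend = ≤-trans (≤-reflexive (trans (sym (*-suc 4 _)) (cong (4 *_) (sym (+-∸-assoc 1 room))))) budget
    4≤p : 4 ≤ p
    4≤p = ≤-trans (m≤m+n 4 _) spend

  endVertex-correct : ∀ v L s → sc s mark′ ≡ 0 → ∀ p → Scanning v L p s → Greedy L (exec endVertex s)
  endVertex-correct _ L s z p record { marking = M@record { vu≡ = refl } ; colr>0 = colr>0 ; below = below ; mark≡ = mark≡ } = record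
    { size≡ = size≡ ; arcs = arcs ; stack = stack ; ordered = proj₂ (proj₂ (proj₂ ordered))
    ; coloured = coloured-step (sc s vu) L (ar s colour) (sc s colr) ordered coloured colr>0 avoid
        (marked≤ (sc s vu) L s (sc s colr) M colr>0 below)
    ; marks≤ = λ c → subst (ar s marks c ≤_) (sym (trans (+-identityʳ _) node≡)) (bounded c) }
    where
    open Marking M
    avoid : ∀ w → w ∈ F (sc s vu) → ar s colour w ≢ sc s colr
    avoid w w∈ e with marked w w∈
    -- A neighbour of this colour would have marked it, and `mark′` would be 1.
    ... | inj₂ m = contradiction (trans (sym (m+n∸m≡n (sc s stamp) 1)) (trans (cong (_∸ sc s stamp) (sym (trans (cong (ar s marks) (sym e)) m))) (trans (sym mark≡) z))) (λ ())
    bounded : ∀ c → ar s marks c ≤ sc s stamp + 1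
    bounded c with sound c
    ... | inj₁ le = ≤-trans le (m≤m+n _ 1)
    ... | inj₂ (e , _) = ≤-reflexive e

  vertexCost : ℕ → ℕ
  vertexCost v = 11 + 10 * length (F v)

  colourVertex-correct : ∀ v L s → Greedy (v ∷ L) s → colourVertex ⊢ s ⟶[ vertexCost v ] Greedy L
  colourVertex-correct v L s Γ = t-≤ (≤-reflexive cost) (
    t-seq (t-blk beginVertex (beginVertex-correct v L s Γ)) λ s M →
    t-seq (markAll-correct v L (F v) s M) λ s M →
    t-seq (t-blk beginScan (beginScan-correct v L s M)) λ s Σ →
    t-seq (while-potential mark′ (blk scanNext) (Scanning v L) (scanNext-correct v L) _ s Σ) λ s (z , p , Σ) →
    t-blk endVertex (endVertex-correct v L s z p Σ))
    where
    open +-*-Solver using (solve; _:+_; _:*_; con) renaming (_:=_ to _⊜_)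
    cost : 3 + (1 + 6 * length (F v) + (3 + (suc (4 * length (F v)) + 3))) ≡ 11 + 10 * length (F v)
    cost = solve 1 (λ l → con 3 :+ (con 1 :+ con 6 :* l :+ (con 3 :+ (con 1 :+ con 4 :* l :+ con 3))) ⊜ con 11 :+ con 10 :* l) refl (length (F v))

  colourAll-correct : ∀ vs s → sc s size ≡ N → Lists (ar s arcHead) (ar s arcNext) (ar s arcTo) nb F →
    Stack (ar s order) (sc s stk) vs → Ordered vs → (∀ w → w < N → remOf vs w ≢ 0) →
    AllZero (ar s marks) → AllZero (ar s colour) →
    colourAll ⊢ s ⟶[ 2 + sumTo (λ v → 12 + 10 * length (F v)) N ] Greedy []
  colourAll-correct vs s sz arcs st ord all mk0 col0 = t-≤ (s≤s (s≤s vs-cost))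
    (t-seq {P = Greedy vs} (t-blk ((stamp :=# 0) ∷ []) start)
      λ s Γ → while-list stk colourVertex vertexCost Greedy stop
        (λ v L s Γ → positive s (Greedy.stack Γ) , colourVertex-correct v L s Γ) vs s Γ)
    where
    vs-cost : Σl (λ v → suc (vertexCost v)) vs ≤ sumTo (λ v → 12 + 10 * length (F v)) N
    vs-cost = ≤-trans (m≤m+n _ _) (≤-reflexive (ordered-sum (λ v → 12 + 10 * length (F v)) vs ord))
    stop : ∀ s → Greedy [] s → sc s stk ≡ 0
    stop s Γ with sc s stk | Greedy.stack Γ
    ... | _ | nil = refl
    positive : ∀ s {h v L} → Stack (ar s order) h (v ∷ L) → 0 < h
    positive s (cons _) = z<s
    uncoloured : ∀ {w} → ¬ (0 < ar s colour w)
    uncoloured {w} lt = contradiction (col0 w) (λ e → <⇒≢ lt (sym e))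
    start : Greedy vs (exec ((stamp :=# 0) ∷ []) s)
    start = record
      { size≡ = sz ; arcs = arcs ; stack = st ; ordered = ord ; marks≤ = λ c → ≤-reflexive (mk0 c)
      ; coloured = record
        { waiting = λ w _ → col0 w ; finished = λ w w< e → contradiction e (all w w<)
        ; proper = λ v w _ pv _ → contradiction pv uncoloured ; small = λ v pv → contradiction pv uncoloured } }

-- The colouring algorithm as a whole

greedyColouring : Cmd
greedyColouring = linkEdges ▸ fillBuckets ▸ peelAll ▸ colourAll

opaque
  colouringCode : Code
  colouringCode = translate greedyColouring

  colouringCode≡ : colouringCode ≡ translate greedyColouring
  colouringCode≡ = refl

module Neighbours {n₀ : ℕ} (es : List (Fin n₀ × Fin n₀)) where

  symmetric : ∀ a b → mult a (neighbours es b) ≡ mult b (neighbours es a)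
  symmetric = linkAll-symmetric es (λ _ → []) (λ _ _ → refl)

  ∈-<n : ∀ x → All (_< n₀) (neighbours es x)
  ∈-<n x = All.tabulate (λ y∈ → bounded (proj₂ (proj₂ (find (neighbours-sound es y∈)))))
    where
    bounded : ∀ {y e} → Joins x y e → y < n₀
    bounded {e = u , v} (inj₁ (_ , refl)) = Fin.toℕ<n v
    bounded {e = u , v} (inj₂ (_ , refl)) = Fin.toℕ<n u

  ∈-sym : ∀ {x y} → y ∈ neighbours es x → x ∈ neighbours es y
  ∈-sym y∈ with find (neighbours-sound es y∈)
  ... | (u , v) , e∈ , inj₁ (refl , refl) = proj₂ (linkAll-complete es (λ _ → []) e∈)
  ... | (u , v) , e∈ , inj₂ (refl , refl) = proj₁ (linkAll-complete es (λ _ → []) e∈)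

  irreflexive : All Ascending es → ∀ x → x ∉ neighbours es x
  irreflexive asc x x∈ with find (neighbours-sound es x∈)
  ... | (u , v) , e∈ , inj₁ (p , q) = <⇒≢ (All.lookup asc e∈) (trans (sym p) q)
  ... | (u , v) , e∈ , inj₂ (p , q) = <⇒≢ (All.lookup asc e∈) (trans (sym q) p)

  degree<  : ∀ w → w < n₀ → length (neighbours es w) < suc (2 * length es)
  degree< w w< = s≤s (≤-trans (term≤sumTo (length ∘ neighbours es) w<) (neighbours-size es n₀))

  open Peeling n₀ (neighbours es) symmetric public

  record ColouredStore (s : Store) : Set where
    field
      size≡    : sc s size ≡ n₀
      coloured : ∀ w → w < n₀ → 0 < ar s colour w
      proper   : ∀ v w → w ∈ neighbours es v → 0 < ar s colour v → 0 < ar s colour w → ar s colour v ≢ ar s colour w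
      small    : ∀ v → 0 < ar s colour v → ∃[ d ] (Core d × ar s colour v ≤ suc d)

  -- All phases cost a constant per vertex, edge and list entry. The lists have at most
  -- `2 * length es` entries in all, so their factor 50 counts double: with the 54 paid per edge
  -- directly this makes 154.
  greedyColouring-correct : All Ascending es → ∀ s → Loaded n₀ es s →
    greedyColouring ⊢ s ⟶[ 154 * (n₀ + length es) + 31 ] ColouredStore
  greedyColouring-correct asc s L = t-≤ cost≤ (
    t-seq (linkEdges-correct es s L) λ s A →
    t-seq (fillBuckets-correct n₀ T (sc s node) F symmetric ∈-<n degree< s
      (Linked.size≡ A) (cong suc (Linked.bound≡ A)) (Linked.arcs A) (Linked.degree≡ A) (Linked.blank A)) λ s₁ (B , I , Φ) →
    t-seq (peelAll-correct n₀ T (sc s node) F symmetric ∈-<n degree< B s₁ I Φ) λ s₂ P →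
    t-map finish (colourAll-correct n₀ (sc s node) F symmetric ∈-sym (irreflexive asc) (FullyPeeled.vs P) s₂
      (FullyPeeled.size≡ P) (FullyPeeled.arcs P) (FullyPeeled.stack P) (FullyPeeled.ordered P) (FullyPeeled.all P) (FullyPeeled.marks0 P) (FullyPeeled.colour0 P)))
    where
    F = neighbours es
    T = suc (2 * length es)
    finish : ∀ {nb s} → Greedy n₀ nb F symmetric ∈-sym (irreflexive asc) [] s → ColouredStore s
    finish Γ = record
      { size≡ = Greedy.size≡ Γ ; coloured = λ w w< → Coloured.finished (Greedy.coloured Γ) w w< refl
      ; proper = Coloured.proper (Greedy.coloured Γ) ; small = Coloured.small (Greedy.coloured Γ) }
    m = length es
    D = sumTo (length ∘ F) n₀
    cost≤ : 4 + 22 * m + (5 + 9 * n₀ + (4 + (16 * T + 16 * n₀ + sumTo (λ w → 10 + 40 * length (F w)) n₀)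
              + (2 + sumTo (λ w → 12 + 10 * length (F w)) n₀))) ≤ 154 * (n₀ + m) + 31
    cost≤ = begin
      4 + 22 * m + (5 + 9 * n₀ + (4 + (16 * T + 16 * n₀ + sumTo (λ w → 10 + 40 * length (F w)) n₀)
        + (2 + sumTo (λ w → 12 + 10 * length (F w)) n₀)))
        ≡⟨ cong₂ (λ x y → 4 + 22 * m + (5 + 9 * n₀ + (4 + (16 * T + 16 * n₀ + x) + (2 + y))))
             (sumTo-affine 10 40 (length ∘ F) n₀) (sumTo-affine 12 10 (length ∘ F) n₀) ⟩
      4 + 22 * m + (5 + 9 * n₀ + (4 + (16 * T + 16 * n₀ + (10 * n₀ + 40 * D)) + (2 + (12 * n₀ + 10 * D))))
        ≡⟨ solve 3 (λ m n d → con 4 :+ con 22 :* m :+ (con 5 :+ con 9 :* n :+ (con 4 :+ (con 16 :* (con 1 :+ con 2 :* m) :+ con 16 :* n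
             :+ (con 10 :* n :+ con 40 :* d)) :+ (con 2 :+ (con 12 :* n :+ con 10 :* d))))
             ⊜ con 50 :* d :+ (con 54 :* m :+ con 47 :* n :+ con 31)) refl m n₀ D ⟩
      50 * D + (54 * m + 47 * n₀ + 31)
        ≤⟨ +-mono-≤ (*-monoʳ-≤ 50 (neighbours-size es n₀)) (+-monoˡ-≤ 31 (+-monoʳ-≤ (54 * m) (*-monoˡ-≤ n₀ (≤ᵇ⇒≤ 47 154 _)))) ⟩
      50 * (2 * m) + (54 * m + 154 * n₀ + 31)
        ≡⟨ solve 2 (λ m n → con 50 :* (con 2 :* m) :+ (con 54 :* m :+ con 154 :* n :+ con 31) ⊜ con 154 :* (n :+ m) :+ con 31) refl m n₀ ⟩
      154 * (n₀ + m) + 31 ∎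
      where
      open ≤-Reasoning
      open +-*-Solver using (solve; _:+_; _:*_; con) renaming (_:=_ to _⊜_)

  colouringCode-correct : ∀ b {s} → greedyColouring ⊢ s ⟶[ b ] ColouredStore → ∀ {W} → #regs ≤ W → ∀ {m} → Represents W m s →
    ∃[ m′ ] ∃[ t ] ∃[ s′ ] (Runs colouringCode m m′ t × t ≤ b * 8 × Represents W m′ s′ × ColouredStore s′)
  colouringCode-correct b {s} (s′ , t , E , t≤ , col) {W} W≥ {m} R = finish (Simulation.simulate W W≥ E R)
    where
    finish : Simulation.Simulated W W≥ greedyColouring m s′ t →
      ∃[ m′ ] ∃[ t ] ∃[ s′ ] (Runs colouringCode m m′ t × t ≤ b * 8 × Represents W m′ s′ × ColouredStore s′)
    finish (m′ , t′ , runs , R′ , t′≤) = m′ , t′ , s′ , subst (λ c → Runs c m m′ t′) (sym colouringCode≡) runs ,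
      ≤-trans t′≤ (*-monoˡ-≤ 8 t≤) , R′ , col

-- Moving the input out of the registers

<⇒<ᵇ-true : ∀ {i j} → i < j → (i <ᵇ j) ≡ true
<⇒<ᵇ-true {zero}  (s≤s _) = refl
<⇒<ᵇ-true {suc i} (s≤s p) = <⇒<ᵇ-true p

≮⇒<ᵇ-false : ∀ {i j} → j ≤ i → (i <ᵇ j) ≡ false
≮⇒<ᵇ-false {i} z≤n = refl
≮⇒<ᵇ-false (s≤s p) = ≮⇒<ᵇ-false p

module CountedLoop (os : List Op) (r r′ off E W : ℕ) (E≤W : E ≤ W) (Inv : ℕ → (ℕ → ℕ) → Set)
  (counter : ∀ k m → Inv k m → m r ≡ off + k × m r′ ≡ E)
  (step : ∀ k m → Inv k m → off + k < W → Inv (suc k) (effects os m)) where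

  -- The body runs before the first test, so `off + k < W` is demanded for the first round; later
  -- the passed test gives it, as `E ≤ W`. `d` bounds the number of further rounds.
  counted-loop : ∀ d k m → Inv k m → off + k < W → E ≤ off + suc k + d →
    ∃[ m′ ] ∃[ k′ ] ∃[ t ] (Runs (repeat (ops os) r r′) m m′ t × Inv k′ m′ × E ≤ off + k′ × t ≤ suc d * (length os + 1))
  counted-loop d k m I lt le with off + suc k <? E
  ... | no ≮E = _ , suc k , _ , r-last r-ops stop , step k m I lt , ≮⇒≥ ≮E , m≤m+n (length os + 1) _
    where
    stop : (effects os m r <ᵇ effects os m r′) ≡ false
    stop with counter (suc k) _ (step k m I lt)
    ... | e , e′ rewrite e | e′ = ≮⇒<ᵇ-false (≮⇒≥ ≮E)
  counted-loop zero k m I lt le | yes <E = contradiction (subst (E ≤_) (+-identityʳ _) le) (<⇒≱ <E)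
  counted-loop (suc d) k m I lt le | yes <E
    with counted-loop d (suc k) (effects os m) (step k m I lt) (≤-trans <E E≤W)
           (subst (E ≤_) (trans (+-suc _ d) (cong (_+ d) (sym (+-suc off (suc k))))) le)
  ... | m′ , k′ , t , R , I′ , E≤ , t≤ = m′ , k′ , _ , r-again r-ops go R , I′ , E≤ ,
    ≤-trans (≤-reflexive (trans (+-suc (length os) t) (cong (_+ t) (+-comm 1 (length os))))) (+-monoʳ-≤ (length os + 1) t≤)
    where
    go : (effects os m r <ᵇ effects os m r′) ≡ true
    go with counter (suc k) _ (step k m I lt)
    ... | e , e′ rewrite e | e′ = <⇒<ᵇ-true <E

-- Opaque, since the effect of a long block of additions has a very large normal form.
opaque
  addRepeatedly : ℕ → ℕ → ℕ → List Op
  addRepeatedly k i j = replicate k (i ≔ i ⊞ j)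

  addRepeatedly-same : ∀ k i j m → i ≢ j → effects (addRepeatedly k i j) m i ≡ m i + k * m j
  addRepeatedly-same zero    i j m ne = sym (+-identityʳ _)
  addRepeatedly-same (suc k) i j m ne = trans (addRepeatedly-same k i j _ ne)
    (trans (cong₂ (λ x y → x + k * y) (update-≡ m i (m i + m j)) (update-≢ m (m i + m j) (λ e → ne (sym e)))) (+-assoc (m i) (m j) _))

  addRepeatedly-other : ∀ k i j m {x} → x ≢ i → effects (addRepeatedly k i j) m x ≡ m x
  addRepeatedly-other zero    i j m ne = refl
  addRepeatedly-other (suc k) i j m ne = trans (addRepeatedly-other k i j _ ne) (update-≢ m (m i + m j) ne)

  addRepeatedly-length : ∀ k i j → length (addRepeatedly k i j) ≡ k
  addRepeatedly-length k i j = length-replicate k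

addr-suc : ∀ W a j → addr W a (suc j) ≡ addr W a j + 16
addr-suc W a j = trans (addr≡ W a (suc j)) (trans
  (solve 3 (λ w s i → w :+ (s :+ (con 1 :+ i) :* con 16) ⊜ (w :+ (s :+ i :* con 16)) :+ con 16) refl W (slot a) j)
  (cong (_+ 16) (sym (addr≡ W a j))))
  where open +-*-Solver using (solve; _:+_; _:*_; con) renaming (_:=_ to _⊜_)

encode-beyond : ∀ {n} (es : List (Fin n × Fin n)) k → 2 * length es ≤ k → encodeEdges es k ≡ 0
encode-beyond []       k _ = refl
encode-beyond ((u , v) ∷ es) k le rewrite *-suc 2 (length es) with k | le
... | suc (suc k′) | s≤s (s≤s le′) = encode-beyond es k′ le′

-- The multiple 20 makes W = 2 |E| + 20 (n + 2 |E|) exceed all the registers in use, and the input.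
adds : ℕ
adds = 20

opaque
  saveRegisters : ℕ → ℕ → List Op
  saveRegisters j zero    = []
  saveRegisters j (suc k) = (1 ≔ 1 ⊞ 2) ∷ (* 1 ≔ (3 + j)) ∷ saveRegisters (suc j) k

  subtractRepeatedly : ℕ → ℕ → ℕ → List Op
  subtractRepeatedly k i j = replicate k (i ≔ i ⊟ j)

  subtractRepeatedly-same : ∀ k i j m → i ≢ j → effects (subtractRepeatedly k i j) m i ≡ m i ∸ k * m j
  subtractRepeatedly-same zero    i j m ne = refl
  subtractRepeatedly-same (suc k) i j m ne = trans (subtractRepeatedly-same k i j _ ne)
    (trans (cong₂ (λ x y → x ∸ k * y) (update-≡ m i (m i ∸ m j)) (update-≢ m (m i ∸ m j) (λ e → ne (sym e)))) (∸-+-assoc (m i) (m j) _))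

  subtractRepeatedly-length : ∀ k i j → length (subtractRepeatedly k i j) ≡ k
  subtractRepeatedly-length k i j = length-replicate k

  saveRegisters-length : ∀ j k → length (saveRegisters j k) ≡ k * 2
  saveRegisters-length j zero    = refl
  saveRegisters-length j (suc k) = cong (2 +_) (saveRegisters-length (suc j) k)

Writes : (ℕ → Set) → Op → Set
Writes P (i ≔# c)    = P i
Writes P (i ≔ j ⊞ k) = P i
Writes P (i ≔ j ⊟ k) = P i
Writes P (i ≔* j)    = P i
Writes P (* i ≔ j)   = ⊥

effect-frame : ∀ {P : ℕ → Set} o m {x} → Writes P o → ¬ P x → effect o m x ≡ m x
effect-frame (i ≔# c)    m w np = update-≢ m c (λ { refl → np w })
effect-frame (i ≔ j ⊞ k) m w np = update-≢ m _ (λ { refl → np w })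
effect-frame (i ≔ j ⊟ k) m w np = update-≢ m _ (λ { refl → np w })
effect-frame (i ≔* j)    m w np = update-≢ m _ (λ { refl → np w })

effects-frame : ∀ {P : ℕ → Set} os m {x} → All (Writes P) os → ¬ P x → effects os m x ≡ m x
effects-frame []       m []       np = refl
effects-frame (o ∷ os) m (w ∷ ws) np = trans (effects-frame os (effect o m) ws np) (effect-frame o m w np)

opaque
  unfolding addRepeatedly
  addRepeatedly-writes : ∀ {P} k i j → P i → All (Writes P) (addRepeatedly k i j)
  addRepeatedly-writes k i j p = All.replicate⁺ k p

opaque
  unfolding subtractRepeatedly
  subtractRepeatedly-writes : ∀ {P} k i j → P i → All (Writes P) (subtractRepeatedly k i j)
  subtractRepeatedly-writes k i j p = All.replicate⁺ k p

beginCopy copyBody setup : List Op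
-- After 16 moves register 1 holds `W + 16 * 16`. Taking off 256 gives `W`, and taking off `adds`
-- times register 0 recovers twice the number of edges, which had been absorbed into `W`. The loop
-- copies from cell 19 up to the end of the input, two cells later than this number.
beginCopy = (5 ≔# 256) ∷ (4 ≔ 1 ⊟ 5) ∷ subtractRepeatedly adds 4 0 ++ (5 ≔# 2) ∷ (4 ≔ 4 ⊞ 5) ∷ (3 ≔# 19) ∷ (6 ≔# 1) ∷ []
copyBody  = (5 ≔* 3) ∷ (1 ≔ 1 ⊞ 2) ∷ (* 1 ≔ 5) ∷ (3 ≔ 3 ⊞ 6) ∷ []
-- The number of vertices is register 0 minus twice the number of edges; `W` is then formed afresh
-- in register 2.
setup     = (5 ≔# 2) ∷ (4 ≔ 4 ⊟ 5) ∷ (3 ≔ 0 ⊟ 4) ∷ (5 ≔# 0) ∷ (2 ≔ 4 ⊞ 5) ∷ addRepeatedly adds 2 0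

-- From register 2 on there may be input everywhere, so `W` is built in place in register 1. The
-- word in register 2 is moved first, which frees this register for the stride 16; then 3 to 18
-- follow one by one.
saveAll : List Op
saveAll = addRepeatedly adds 1 0 ++ (* 1 ≔ 2) ∷ (2 ≔# 16) ∷ saveRegisters 0 16

saveAll-length : length saveAll ≡ 54
saveAll-length = trans (length-++ (addRepeatedly adds 1 0))
  (cong₂ (λ x y → x + (2 + y)) (addRepeatedly-length adds 1 0) (saveRegisters-length 0 16))

beginCopy-length : length beginCopy ≡ 26
beginCopy-length = cong (2 +_) (trans (length-++ (subtractRepeatedly adds 4 0)) (cong (_+ 4) (subtractRepeatedly-length adds 4 0)))

setup-length : length setup ≡ 25
setup-length = cong (5 +_) (addRepeatedly-length adds 2 0)

ops-run : ∀ os (Q : (ℕ → ℕ) → Set) m → Q (effects os m) → ∃[ m′ ] (Runs (ops os) m m′ (length os) × Q m′)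
ops-run os Q m q = _ , r-ops , q

opaque
  loadInput : Code
  loadInput = ops saveAll
    ⨟ ops beginCopy ⨟ repeat (ops copyBody) 3 4 ⨟ ops setup

Scratch : ℕ → Set
Scratch i = Bool.T ((3 ≤ᵇ i) ∧ (i <ᵇ 19))

outside : ∀ x → x < 3 ⊎ 19 ≤ x → ¬ Scratch x
outside x (inj₁ x<3) t with 3 ≤ᵇ x in e
... | true = <⇒≱ x<3 (≤ᵇ⇒≤ 3 x (subst Bool.T (sym e) tt))
outside x (inj₂ 19≤x) t with 3 ≤ᵇ x
... | true = <⇒≱ (<ᵇ⇒< x 19 t) 19≤x

module LoadInput {n₀ : ℕ} (n>0 : 0 < n₀) (es : List (Fin n₀ × Fin n₀)) (E₂ Y W : ℕ)
  (E₂≡ : E₂ ≡ 2 * length es) (Y≡ : Y ≡ n₀ + E₂) (W≡ : W ≡ E₂ + adds * Y) where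

  20≤adds*Y : 20 ≤ adds * Y
  20≤adds*Y = *-monoʳ-≤ adds {1} {Y} (subst (1 ≤_) (sym Y≡) (≤-trans n>0 (m≤m+n n₀ E₂)))

  20≤W : 20 ≤ W
  20≤W = subst (20 ≤_) (sym W≡) (≤-trans 20≤adds*Y (m≤n+m _ E₂))

  19≤W : 19 ≤ W
  19≤W = ≤-trans (n≤1+n 19) 20≤W

  input≤W : E₂ + 2 ≤ W
  input≤W = subst (E₂ + 2 ≤_) (sym W≡) (+-monoʳ-≤ E₂ (≤-trans (s≤s (s≤s z≤n)) 20≤adds*Y))

  n≤W : n₀ ≤ W
  n≤W = subst (n₀ ≤_) (sym W≡) (≤-trans (subst (n₀ ≤_) (sym Y≡) (m≤m+n n₀ E₂)) (≤-trans (m≤m+n Y _) (m≤n+m (adds * Y) E₂)))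

  -- The input cells 2 … 2 + j have been moved to the array input; the destination of the last one is in register 1.
  record Moved (j : ℕ) (m : ℕ → ℕ) : Set where
    field
      at0  : m 0 ≡ Y
      at1  : m 1 ≡ addr W input j
      at2  : m 2 ≡ 16
      copied : ∀ q → q ≤ j → m (addr W input q) ≡ encodeEdges es q
      todo : ∀ q → j < q → 2 + q < W → m (2 + q) ≡ encodeEdges es q
      rest : ∀ a q → 0 < slot a → m (addr W a q) ≡ 0

  low≢addr : ∀ {i} a q → i < 19 → addr W a q ≢ i
  low≢addr a q i< e = <⇒≱ (≤-trans i< 19≤W) (subst (W ≤_) e (W≤addr W a q))

  moved-frame : ∀ {j m m′} → 16 ≤ j → Moved j m →
    (∀ x → x < 3 ⊎ 19 ≤ x → m′ x ≡ m x) → Moved j m′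
  moved-frame {j} {m} {m′} j≥ M same = record
    { at0 = trans (same 0 (inj₁ z<s)) at0 ; at1 = trans (same 1 (inj₁ (s≤s z<s))) at1 ; at2 = trans (same 2 (inj₁ ≤-refl)) at2
    ; copied = λ q q≤ → trans (high input q) (copied q q≤)
    ; todo = λ q j<q q<W → trans (same (2 + q) (inj₂ (s≤s (s≤s (≤-trans (s≤s j≥) j<q))))) (todo q j<q q<W)
    ; rest = λ a q p → trans (high a q) (rest a q p) }
    where
    open Moved M
    high : ∀ a q → m′ (addr W a q) ≡ m (addr W a q)
    high a q = same (addr W a q) (inj₂ (≤-trans 19≤W (W≤addr W a q)))

  next-cell : ∀ {j m} → Moved j m → m 1 + m 2 ≡ addr W input (suc j)
  next-cell {j} M = trans (cong₂ _+_ (Moved.at1 M) (Moved.at2 M)) (sym (addr-suc W input j))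

  -- Destinations lie at `W` or above and the pending sources below `W`, so no unread input is
  -- overwritten.
  move-one : ∀ {j m l v} → Moved j m → l ≡ addr W input (suc j) → v ≡ encodeEdges es (suc j) →
    Moved (suc j) (update (update m 1 l) l v)
  move-one {j} {m} {v = v} M refl e = record
    { at0 = trans (low (λ ()) z<s) at0
    ; at1 = trans (update-≢ m₁ v (λ e → low≢addr input (suc j) (s≤s z<s) (sym e))) (update-≡ m 1 _)
    ; at2 = trans (low (λ ()) (s≤s (s≤s z<s))) at2
    ; copied = copied′
    ; todo = λ q j<q q<W → trans (update-≢ m₁ v (λ e → <⇒≱ q<W (subst (W ≤_) (sym e) (W≤addr W input (suc j)))))
        (trans (update-≢ m {1} {2 + q} l (λ ())) (todo q (<⇒≤ j<q) q<W))
    ; rest = λ a q p → trans (update-≢ m₁ v (λ e → <⇒≢ p (sym (proj₁ (addr-injective W {a} {input} q (suc j) e)))))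
        (trans (update-≢ m l (low≢addr a q (s≤s z<s))) (rest a q p)) }
    where
    open Moved M
    l = addr W input (suc j)
    m₁ = update m 1 l
    low : ∀ {i} → i ≢ 1 → i < 19 → update m₁ l v i ≡ m i
    low ne i< = trans (update-≢ m₁ v (λ e → low≢addr input (suc j) i< (sym e))) (update-≢ m l ne)
    copied′ : ∀ q → q ≤ suc j → update m₁ l v (addr W input q) ≡ encodeEdges es q
    copied′ q q≤ with q ≟ suc j
    ... | yes refl = trans (update-≡ m₁ l v) e
    ... | no ne = trans (update-≢ m₁ v (λ e → ne (proj₂ (addr-injective W {input} {input} q (suc j) e))))
      (trans (update-≢ m l (low≢addr input q (s≤s z<s))) (copied q (≤-pred (≤∧≢⇒< q≤ ne))))

  opaque
    unfolding saveRegisters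
    saveRegisters-correct : ∀ k j m → j + k ≤ 16 → Moved j m → Moved (j + k) (effects (saveRegisters j k) m)
    saveRegisters-correct zero    j m le M rewrite +-identityʳ j = M
    saveRegisters-correct (suc k) j m le M rewrite +-suc j k = saveRegisters-correct k (suc j) _ le
      (subst (λ a → Moved (suc j) (update (update m 1 (m 1 + m 2)) a (m (3 + j)))) (sym (update-≡ m 1 (m 1 + m 2)))
        (move-one M (next-cell M) (Moved.todo M (suc j) ≤-refl (≤-trans (+-monoʳ-≤ 4 (≤-trans (m≤m+n j k) (≤-pred le))) 19≤W))))

  saveAll-correct : ∀ m → m 0 ≡ Y → m 1 ≡ E₂ → (∀ q → m (2 + q) ≡ encodeEdges es q) →
    Moved 16 (effects saveAll m)
  saveAll-correct m e0 e1 enc rewrite effects-++ (addRepeatedly adds 1 0) ((* 1 ≔ 2) ∷ (2 ≔# 16) ∷ saveRegisters 0 16) m =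
    saveRegisters-correct 16 0 _ ≤-refl (first (effects (addRepeatedly adds 1 0) m)
      (trans (addRepeatedly-same adds 1 0 m (λ ())) (trans (cong₂ (λ x y → x + adds * y) e1 e0) (sym W≡)))
      (trans (addRepeatedly-other adds 1 0 m (λ ())) e0)
      (λ q → trans (addRepeatedly-other adds 1 0 m (λ ())) (enc q)))
    where
    first : ∀ m → m 1 ≡ W → m 0 ≡ Y → (∀ q → m (2 + q) ≡ encodeEdges es q) →
      Moved 0 (update (update m (m 1) (m 2)) 2 16)
    first m e1 e0 enc rewrite e1 = record
      { at0 = trans (keep (λ ()) z<s) e0 ; at1 = trans (keep (λ ()) (s≤s z<s)) (trans e1 (sym (+-identityʳ W)))
      ; at2 = update-≡ (update m W (m 2)) 2 16
      ; copied = λ { zero _ → trans (update-≢ (update m W (m 2)) 16 (low≢addr input 0 (s≤s (s≤s z<s))))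
          (trans (cong (update m W (m 2)) (+-identityʳ W)) (trans (update-≡ m W (m 2)) (enc 0))) }
      ; todo = λ { (suc q) _ lt → trans (update-≢ (update m W (m 2)) {2} {3 + q} 16 (λ ())) (trans (update-≢ m (m 2) (<⇒≢ lt)) (enc (suc q))) }
      ; rest = rest′ }
      where
      keep : ∀ {i} → i ≢ 2 → i < 19 → update (update m W (m 2)) 2 16 i ≡ m i
      keep ne i< = trans (update-≢ (update m W (m 2)) 16 ne) (update-≢ m (m 2) (<⇒≢ (≤-trans i< 19≤W)))
      rest′ : ∀ a q → 0 < slot a → update (update m W (m 2)) 2 16 (addr W a q) ≡ 0
      rest′ a q p = trans (update-≢ (update m W (m 2)) 16 (low≢addr a q (s≤s (s≤s z<s)))) (trans (update-≢ m (m 2) ne) blank)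
        where
        ne : addr W a q ≢ W
        ne e = <⇒≢ p (sym (proj₁ (addr-injective W {a} {input} q 0 (trans e (sym (+-identityʳ W))))))
        big : E₂ + 2 ≤ addr W a q
        big = ≤-trans input≤W (W≤addr W a q)
        -- The cell lies past the end of the input, where the initial memory is 0.
        blank : m (addr W a q) ≡ 0
        blank = trans (cong m (sym (m+[n∸m]≡n (≤-trans (m≤n+m 2 E₂) big))))
          (trans (enc _) (encode-beyond es _ (subst (_≤ addr W a q ∸ 2) (trans (m+n∸n≡m E₂ 2) E₂≡) (∸-monoˡ-≤ 2 big))))

  record Copying (k : ℕ) (m : ℕ → ℕ) : Set where
    field
      at3   : m 3 ≡ 3 + k
      at4   : m 4 ≡ E₂ + 2
      at6   : m 6 ≡ 1
      k≥    : 16 ≤ k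
      moved : Moved k m

  beginCopy-correct : ∀ m → Moved 16 m → Copying 16 (effects beginCopy m)
  beginCopy-correct m M = subst (λ f → Copying 16 f) (sym split) record
    { at3 = refl
    ; at4 = cong (_+ 2) (trans (subtractRepeatedly-same adds 4 0 m₁ (λ ()))
        (trans (cong₂ (λ x y → x ∸ adds * y) (trans m₁4 W≡) at0) (m+n∸n≡m E₂ (adds * Y))))
    ; at6 = refl ; k≥ = ≤-refl ; moved = moved-frame ≤-refl M (λ x p → trans (cong (λ f → f x) (sym split)) (effects-frame {Scratch} beginCopy m
        (tt ∷ tt ∷ All.++⁺ (subtractRepeatedly-writes {Scratch} adds 4 0 tt) (tt ∷ tt ∷ tt ∷ tt ∷ [])) (outside x p))) }
    where
    open Moved M
    m₁ = effects ((5 ≔# 256) ∷ (4 ≔ 1 ⊟ 5) ∷ []) m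
    split : effects beginCopy m ≡ effects ((5 ≔# 2) ∷ (4 ≔ 4 ⊞ 5) ∷ (3 ≔# 19) ∷ (6 ≔# 1) ∷ []) (effects (subtractRepeatedly adds 4 0) m₁)
    split = effects-++ (subtractRepeatedly adds 4 0) _ m₁
    m₁4 : m₁ 4 ≡ W
    m₁4 = trans (cong (_∸ 256) (trans at1 (trans (+-identityʳ (256 + W)) (+-comm 256 W)))) (m+n∸n≡m W 256)

  copy-step : ∀ k m → Copying k m → 3 + k < W → Copying (suc k) (effects copyBody m)
  copy-step k m C lt = record
    { at3 = trans (cong₂ _+_ (trans (low (≤ᵇ⇒≤ 4 19 _) refl) at3) (trans (low (≤ᵇ⇒≤ 7 19 _) refl) at6)) (+-comm (3 + k) 1)
    ; at4 = trans (low (≤ᵇ⇒≤ 5 19 _) refl) at4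
    ; at6 = trans (low (≤ᵇ⇒≤ 7 19 _) refl) at6
    ; k≥ = m≤n⇒m≤1+n k≥
    ; moved = moved-frame (m≤n⇒m≤1+n k≥) moved₂ (λ x p → effects-frame {Scratch} ((3 ≔ 3 ⊞ 6) ∷ []) m₂ {x} (tt ∷ []) (outside x p)) }
    where
    open Copying C
    m₁ = update m 5 (m (m 3))
    m₂ = effects ((1 ≔ 1 ⊞ 2) ∷ (* 1 ≔ 5) ∷ []) m₁
    moved₁ : Moved k m₁
    moved₁ = moved-frame k≥ moved (λ x p → effects-frame {Scratch} ((5 ≔* 3) ∷ []) m {x} (tt ∷ []) (outside x p))
    moved₂ : Moved (suc k) m₂
    moved₂ = move-one moved₁ (next-cell moved₁) (trans (cong m at3) (Moved.todo moved (suc k) ≤-refl lt))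
    low : ∀ {i v} → i < 19 → update m₁ 1 (m 1 + m 2) i ≡ v → m₂ i ≡ v
    low {i} i< e = trans (update-≢ (update m₁ 1 (m 1 + m 2)) (m₁ 5) (λ e′ → low≢addr input (suc k) i<
      (trans (sym (next-cell moved)) (sym e′)))) e

  record Set-up (m : ℕ → ℕ) : Set where
    field
      base≡  : m 2 ≡ W
      size≡  : m 3 ≡ n₀
      bound≡ : m 4 ≡ E₂
      input≡ : ∀ q → q < E₂ → m (addr W input q) ≡ encodeEdges es q
      rest≡  : ∀ a q → 0 < slot a → m (addr W a q) ≡ 0

  Target : ℕ → Set
  Target i = Bool.T ((2 ≤ᵇ i) ∧ (i <ᵇ 19))

  beyond : ∀ x → 19 ≤ x → ¬ Target x
  beyond x 19≤x t with 2 ≤ᵇ x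
  ... | true = <⇒≱ (<ᵇ⇒< x 19 t) 19≤x

  setup-correct : ∀ k m → Copying k m → E₂ + 2 ≤ 3 + k → Set-up (effects setup m)
  setup-correct k m C le = record
    { base≡ = trans (addRepeatedly-same adds 2 0 m₁ (λ ())) (trans (cong₂ (λ x y → x + adds * y) (trans (+-identityʳ _) e₂) at0) (sym W≡))
    ; size≡ = trans (addRepeatedly-other adds 2 0 m₁ (λ ())) (trans (cong₂ _∸_ (trans at0 Y≡) e₂) (m+n∸n≡m n₀ E₂))
    ; bound≡ = trans (addRepeatedly-other adds 2 0 m₁ (λ ())) e₂
    ; input≡ = λ q q< → trans (high input q) (copied q (≤-pred (≤-trans q< (≤-trans (≤-reflexive (sym (m+n∸n≡m E₂ 2))) (∸-monoˡ-≤ 2 le)))))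
    ; rest≡ = λ a q p → trans (high a q) (rest a q p) }
    where
    open Copying C
    open Moved moved
    m₁ = effects ((5 ≔# 2) ∷ (4 ≔ 4 ⊟ 5) ∷ (3 ≔ 0 ⊟ 4) ∷ (5 ≔# 0) ∷ (2 ≔ 4 ⊞ 5) ∷ []) m
    e₂ : m 4 ∸ 2 ≡ E₂
    e₂ = trans (cong (_∸ 2) at4) (m+n∸n≡m E₂ 2)
    high : ∀ a q → effects setup m (addr W a q) ≡ m (addr W a q)
    high a q = effects-frame {Target} setup m (tt ∷ tt ∷ tt ∷ tt ∷ tt ∷ addRepeatedly-writes {Target} adds 2 0 tt)
      (beyond _ (≤-trans 19≤W (W≤addr W a q)))

  module Loop = CountedLoop copyBody 3 4 3 (E₂ + 2) W input≤W Copying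
    (λ k m C → Copying.at3 C , Copying.at4 C) copy-step


  opaque
    unfolding loadInput
    loadInput-correct : ∀ m → m 0 ≡ Y → m 1 ≡ E₂ → (∀ q → m (2 + q) ≡ encodeEdges es q) →
      ∃[ m′ ] ∃[ t ] (Runs loadInput m m′ t × Set-up m′ × t ≤ 10 * length es + 110)
    loadInput-correct m e0 e1 enc =
      let m₁ , R₁ , M = ops-run saveAll (Moved 16) m (saveAll-correct m e0 e1 enc)
          m₂ , R₂ , C = ops-run beginCopy (Copying 16) m₁ (beginCopy-correct m₁ M)
          m₃ , k , t , R₃ , C′ , le , t≤ = Loop.counted-loop E₂ 16 m₂ C 20≤W
            (≤-trans (≤-reflexive (+-comm E₂ 2)) (+-monoˡ-≤ E₂ (≤ᵇ⇒≤ 2 20 _)))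
          m₄ , R₄ , S = ops-run setup Set-up m₃ (setup-correct k m₃ C′ le)
      in m₄ , _ , r-seq R₁ (r-seq R₂ (r-seq R₃ R₄)) , S , cost t saveAll-length beginCopy-length setup-length t≤
      where
      open ≤-Reasoning
      open +-*-Solver using (solve; _:+_; _:*_; con) renaming (_:=_ to _⊜_)
      -- Five steps per copied word and two words per edge. The straight-line blocks and the one
      -- round that the loop always makes add up to 54 + 26 + 25 + 5 = 110.
      cost : ∀ {a b c} t → a ≡ 54 → b ≡ 26 → c ≡ 25 → t ≤ suc E₂ * 5 → a + (b + (t + c)) ≤ 10 * length es + 110
      cost t refl refl refl t≤ = begin
        54 + (26 + (t + 25))
          ≤⟨ +-monoʳ-≤ 54 (+-monoʳ-≤ 26 (+-monoˡ-≤ 25 t≤)) ⟩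
        54 + (26 + (suc E₂ * 5 + 25))
          ≡⟨ cong (λ z → 54 + (26 + (suc z * 5 + 25))) E₂≡ ⟩
        54 + (26 + (suc (2 * length es) * 5 + 25))
          ≡⟨ solve 1 (λ e → con 54 :+ (con 26 :+ ((con 1 :+ con 2 :* e) :* con 5 :+ con 25)) ⊜ con 10 :* e :+ con 110) refl (length es) ⟩
        10 * length es + 110 ∎

-- Writing the colours

-- A loop copies the colours of the vertices from 19 on; the registers below 19 run it and receive
-- their own colours afterwards. The offset 315 is `16 * 19 + 11`, the place of entry 19 of `colour`
-- relative to `W`.
beginOutput outputBody fetchLast : List Op
beginOutput = (4 ≔# 19) ∷ (5 ≔# 315) ∷ (5 ≔ 5 ⊞ 2) ∷ (6 ≔# 16) ∷ (7 ≔# 1) ∷ []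
outputBody  = (8 ≔* 5) ∷ (* 4 ≔ 8) ∷ (5 ≔ 5 ⊞ 6) ∷ (4 ≔ 4 ⊞ 7) ∷ []
-- Register 2 gives up the base by turning into the address of its own colour, at offset
-- `16 * 2 + 11`. Taking off 32 yields the address for register 0, which must be loaded before
-- register 2 is.
fetchLast   = (0 ≔# 43) ∷ (2 ≔ 2 ⊞ 0) ∷ (0 ≔# 32) ∷ (0 ≔ 2 ⊟ 0) ∷ (0 ≔* 0) ∷ (2 ≔* 2) ∷ []

-- The register to be filled holds its own source address meanwhile, so besides it only the base in
-- register 2 is used.
fetch : ℕ → List Op
fetch v = (v ≔# (double (double (double (double v))) + 11)) ∷ (v ≔ v ⊞ 2) ∷ (v ≔* v) ∷ []

opaque
  fetchAll : List ℕ → List Op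
  fetchAll []       = []
  fetchAll (v ∷ vs) = fetch v ++ fetchAll vs

  fetchAll-length : ∀ vs → length (fetchAll vs) ≡ length vs * 3
  fetchAll-length []       = refl
  fetchAll-length (v ∷ vs) = cong (3 +_) (fetchAll-length vs)

-- All registers below 19 but 0 and 2, which hold a scratch value and the base of the arrays.
lowRegisters : List ℕ
lowRegisters = 1 ∷ 3 ∷ 4 ∷ 5 ∷ 6 ∷ 7 ∷ 8 ∷ 9 ∷ 10 ∷ 11 ∷ 12 ∷ 13 ∷ 14 ∷ 15 ∷ 16 ∷ 17 ∷ 18 ∷ []

opaque
  writeOutput : Code
  writeOutput = ops beginOutput ⨟ repeat (ops outputBody) 4 3 ⨟ ops (fetchAll lowRegisters) ⨟ ops fetchLast

module WriteOutput (n₀ W : ℕ) (20≤W : 20 ≤ W) (n≤W : n₀ ≤ W) (col : ℕ → ℕ) where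

  19≤W : 19 ≤ W
  19≤W = ≤-trans (n≤1+n 19) 20≤W

  cell : ℕ → ℕ
  cell v = addr W colour v

  low≢cell : ∀ {i} v → i < W → cell v ≢ i
  low≢cell v i< e = <⇒≱ i< (subst (W ≤_) e (W≤addr W colour v))

  record Outputting (k : ℕ) (m : ℕ → ℕ) : Set where
    field
      at2     : m 2 ≡ W
      at3     : m 3 ≡ n₀
      at4     : m 4 ≡ 19 + k
      at5     : m 5 ≡ cell (19 + k)
      at6     : m 6 ≡ 16
      at7     : m 7 ≡ 1
      arr     : ∀ v → m (cell v) ≡ col v
      written : ∀ v → 19 ≤ v → v < 19 + k → m v ≡ col v

  beginOutput-correct : ∀ m → m 2 ≡ W → m 3 ≡ n₀ → (∀ v → m (cell v) ≡ col v) → Outputting 0 (effects beginOutput m)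
  beginOutput-correct m e2 e3 ea = record
    { at2 = e2 ; at3 = e3 ; at4 = refl
    ; at5 = trans (cong (315 +_) e2) (trans (trans (+-assoc 304 11 W) (cong (304 +_) (+-comm 11 W))) (sym (+-assoc 304 W 11)))
    ; at6 = refl ; at7 = refl
    ; arr = λ v → trans (effects-frame {Scratch} beginOutput m {cell v} (tt ∷ tt ∷ tt ∷ tt ∷ tt ∷ []) (outside (cell v) (inj₂ (≤-trans 19≤W (W≤addr W colour v))))) (ea v)
    ; written = λ v le lt → contradiction le (<⇒≱ lt) }

  output-step : ∀ k m → Outputting k m → 19 + k < W → Outputting (suc k) (effects outputBody m)
  output-step k m O lt = record
    { at2 = trans (low 2 (λ ()) (≤ᵇ⇒≤ 3 19 _)) at2
    ; at3 = trans (low 3 (λ ()) (≤ᵇ⇒≤ 4 19 _)) at3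
    ; at4 = trans (cong₂ _+_ (trans (low 4 (λ ()) (≤ᵇ⇒≤ 5 19 _)) at4) (trans (low 7 (λ ()) (≤ᵇ⇒≤ 8 19 _)) at7)) (+-comm (19 + k) 1)
    ; at5 = trans (cong₂ _+_ (trans (low 5 (λ ()) (≤ᵇ⇒≤ 6 19 _)) at5) (trans (low 6 (λ ()) (≤ᵇ⇒≤ 7 19 _)) at6)) (sym (addr-suc W colour (19 + k)))
    ; at6 = trans (low 6 (λ ()) (≤ᵇ⇒≤ 7 19 _)) at6
    ; at7 = trans (low 7 (λ ()) (≤ᵇ⇒≤ 8 19 _)) at7
    ; arr = λ v → trans (high (cell v) (≤-trans 19≤W (W≤addr W colour v)))
        (trans (update-≢ m₁ (m₁ 8) (λ e → low≢cell v lt (trans e at4))) (trans (first (cell v) (≤-trans 19≤W (W≤addr W colour v))) (arr v)))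
    ; written = written′ }
    where
    open Outputting O
    m₁ = update m 8 (m (m 5))
    m₂ = update m₁ (m 4) (m₁ 8)
    m₃ = effects ((5 ≔ 5 ⊞ 6) ∷ (4 ≔ 4 ⊞ 7) ∷ []) m₂
    high : ∀ x → 19 ≤ x → m₃ x ≡ m₂ x
    high x le = effects-frame {Scratch} ((5 ≔ 5 ⊞ 6) ∷ (4 ≔ 4 ⊞ 7) ∷ []) m₂ {x} (tt ∷ tt ∷ []) (outside x (inj₂ le))
    first : ∀ x → 19 ≤ x → m₁ x ≡ m x
    first x le = effects-frame {Scratch} ((8 ≔* 5) ∷ []) m {x} (tt ∷ []) (outside x (inj₂ le))
    low : ∀ i → i ≢ 8 → i < 19 → m₂ i ≡ m i
    low i ne i< = trans (update-≢ m₁ (m₁ 8) (λ e → <⇒≱ i< (subst (19 ≤_) (sym (trans e at4)) (m≤m+n 19 k)))) (update-≢ m (m (m 5)) ne)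
    written′ : ∀ v → 19 ≤ v → v < 19 + suc k → m₃ v ≡ col v
    written′ v le lt′ with v ≟ 19 + k
    ... | yes refl = trans (high v le) (trans (cong m₂ (sym at4)) (trans (update-≡ m₁ (m 4) (m₁ 8)) (trans (cong m at5) (arr v))))
    ... | no ne = trans (high v le) (trans (update-≢ m₁ (m₁ 8) (λ e → ne (trans e at4)))
      (trans (first v le) (written v le (≤∧≢⇒< (≤-pred (subst (v <_) (+-suc 19 k) lt′)) ne))))

  record Fetching (m : ℕ → ℕ) : Set where
    field
      at2     : m 2 ≡ W
      arr     : ∀ v → m (cell v) ≡ col v
      written : ∀ v → 19 ≤ v → v < n₀ → m v ≡ col v

  record Fetchable (v : ℕ) : Set where
    constructor fetchable
    field
      v≢2 : v ≢ 2
      v<  : v < 19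

  fetch-value : ∀ v m → Fetching m → Fetchable v → effects (fetch v) m v ≡ col v
  fetch-value v m Φ (fetchable v≢2 v<) = trans (update-≡ m₂ v (m₂ (m₂ v))) (trans (cong m₂ m₂v)
    (trans (update-≢ m₁ (m₁ v + m₁ 2) (low≢cell v (≤-trans v< 19≤W))) (trans (update-≢ m c (low≢cell v (≤-trans v< 19≤W))) (arr v))))
    where
    open Fetching Φ
    c = double (double (double (double v))) + 11
    m₁ = update m v c
    m₂ = update m₁ v (m₁ v + m₁ 2)
    m₂v : m₂ v ≡ cell v
    m₂v = trans (update-≡ m₁ v (m₁ v + m₁ 2)) (trans (cong₂ _+_ (update-≡ m v c) (trans (update-≢ m c (λ e → v≢2 (sym e))) at2))
      (trans (+-assoc (double (double (double (double v)))) 11 W) (trans (cong (double (double (double (double v))) +_) (+-comm 11 W))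
        (sym (+-assoc (double (double (double (double v)))) W 11)))))

  fetch-other : ∀ v m {x} → x ≢ v → effects (fetch v) m x ≡ m x
  fetch-other v m {x} ne = effects-frame {_≡ v} (fetch v) m {x} (refl ∷ refl ∷ refl ∷ []) ne

  fetch-correct : ∀ v m → Fetching m → Fetchable v → Fetching (effects (fetch v) m)
  fetch-correct v m Φ (fetchable v≢2 v<) = record
    { at2 = trans (fetch-other v m (λ e → v≢2 (sym e))) at2
    ; arr = λ x → trans (fetch-other v m (low≢cell x (≤-trans v< 19≤W))) (arr x)
    ; written = λ x le lt → trans (fetch-other v m (λ e → <⇒≱ v< (subst (19 ≤_) e le))) (written x le lt) }
    where open Fetching Φ

  opaque
    unfolding fetchAll
    fetchAll-correct : ∀ vs m → All Fetchable vs → Fetching m →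
      Fetching (effects (fetchAll vs) m) × (∀ v → v ∈ vs ⊎ m v ≡ col v → effects (fetchAll vs) m v ≡ col v)
    fetchAll-correct [] m [] Φ = Φ , λ { v (inj₂ e) → e }
    fetchAll-correct (v ∷ vs) m (fv ∷ fvs) Φ with fetchAll-correct vs (effects (fetch v) m) fvs (fetch-correct v m Φ fv)
    ... | Φ′ , h = Φ′ , λ x → λ
      { (inj₁ (here refl)) → h x (inj₂ (fetch-value v m Φ fv))
      ; (inj₁ (there x∈)) → h x (inj₁ x∈)
      ; (inj₂ e) → h x (inj₂ (kept x e)) }
      where
      kept : ∀ x → m x ≡ col x → effects (fetch v) m x ≡ col x
      kept x e with x ≟ v
      ... | yes refl = fetch-value v m Φ fv
      ... | no ne = trans (fetch-other v m ne) e

  lowFetchable : All Fetchable lowRegisters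
  lowFetchable = All.tabulate (λ v∈ → fetchable (All.lookup not2 v∈) (All.lookup small v∈))
    where
    not2 : All (_≢ 2) lowRegisters
    not2 = (λ ()) ∷ (λ ()) ∷ (λ ()) ∷ (λ ()) ∷ (λ ()) ∷ (λ ()) ∷ (λ ()) ∷ (λ ()) ∷ (λ ()) ∷ (λ ()) ∷ (λ ()) ∷ (λ ()) ∷
           (λ ()) ∷ (λ ()) ∷ (λ ()) ∷ (λ ()) ∷ (λ ()) ∷ []
    small : All (_< 19) lowRegisters
    small = All.map (<ᵇ⇒< _ 19) (tt ∷ tt ∷ tt ∷ tt ∷ tt ∷ tt ∷ tt ∷ tt ∷ tt ∷ tt ∷ tt ∷ tt ∷ tt ∷ tt ∷ tt ∷ tt ∷ tt ∷ [])

  fetchLast-correct : ∀ m → Fetching m → (∀ v → v ∈ lowRegisters → m v ≡ col v) →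
    ∀ v → v < n₀ → effects fetchLast m v ≡ col v
  fetchLast-correct m Φ low v v<n with v ≟ 0 | v ≟ 2
  ... | yes refl | _ = trans (frame (m 2 + 43 ∸ 32) (subst (λ z → 19 ≤ z + 43 ∸ 32) (sym at2) (≤-trans 19≤W (≤-trans (m≤m+n W 11) (≤-reflexive (sym w11))))))
        (trans (cong m (trans (cong (λ z → z + 43 ∸ 32) at2) w11)) (arr 0))
    where
    open Fetching Φ
    w11 : W + 43 ∸ 32 ≡ W + 11
    w11 = +-∸-assoc W (≤ᵇ⇒≤ 32 43 _)
    frame : ∀ x → 19 ≤ x → effects ((0 ≔# 43) ∷ (2 ≔ 2 ⊞ 0) ∷ (0 ≔# 32) ∷ (0 ≔ 2 ⊟ 0) ∷ []) m x ≡ m x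
    frame x le = effects-frame {_< 19} ((0 ≔# 43) ∷ (2 ≔ 2 ⊞ 0) ∷ (0 ≔# 32) ∷ (0 ≔ 2 ⊟ 0) ∷ []) m {x} (z<s ∷ ≤ᵇ⇒≤ 3 19 _ ∷ z<s ∷ z<s ∷ []) (≤⇒≯ le)
  ... | no _ | yes refl = trans (frame (m 2 + 43) (subst (λ z → 19 ≤ z + 43) (sym at2) (≤-trans 19≤W (m≤m+n W 43))))
        (trans (cong m (trans (cong (_+ 43) at2) (trans (+-comm W 43) (trans (cong (32 +_) (+-comm 11 W)) (sym (+-assoc 32 W 11)))))) (arr 2))
    where
    open Fetching Φ
    frame : ∀ x → 19 ≤ x → effects ((0 ≔# 43) ∷ (2 ≔ 2 ⊞ 0) ∷ (0 ≔# 32) ∷ (0 ≔ 2 ⊟ 0) ∷ (0 ≔* 0) ∷ []) m x ≡ m x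
    frame x le = effects-frame {_< 19} ((0 ≔# 43) ∷ (2 ≔ 2 ⊞ 0) ∷ (0 ≔# 32) ∷ (0 ≔ 2 ⊟ 0) ∷ (0 ≔* 0) ∷ []) m {x} (z<s ∷ ≤ᵇ⇒≤ 3 19 _ ∷ z<s ∷ z<s ∷ z<s ∷ []) (≤⇒≯ le)
  ... | no v≢0 | no v≢2 = trans (effects-frame {λ x → x ≡ 0 ⊎ x ≡ 2} fetchLast m {v} (inj₁ refl ∷ inj₂ refl ∷ inj₁ refl ∷ inj₁ refl ∷ inj₁ refl ∷ inj₂ refl ∷ [])
      (λ { (inj₁ e) → v≢0 e ; (inj₂ e) → v≢2 e })) value
    where
    member : ∀ v → v < 19 → v ≢ 0 → v ≢ 2 → v ∈ lowRegisters
    member 0 _ ne _ = contradiction refl ne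
    member 1 _ _ _ = here refl
    member 2 _ _ ne = contradiction refl ne
    -- After its head, `lowRegisters` is `map (3 +_) (upTo 16)` by computation.
    member (suc (suc (suc v))) (s≤s (s≤s (s≤s v<16))) _ _ = there (∈-map⁺ (3 +_) (∈-upTo⁺ v<16))
    value : m v ≡ col v
    value with v <? 19
    ... | yes v<19 = low v (member v v<19 v≢0 v≢2)
    ... | no v≮19 = Fetching.written Φ v (≮⇒≥ v≮19) v<n

  module Loop = CountedLoop outputBody 4 3 19 n₀ W n≤W Outputting (λ k m O → Outputting.at4 O , Outputting.at3 O) output-step

  opaque
    unfolding writeOutput
    writeOutput-correct : ∀ m → m 2 ≡ W → m 3 ≡ n₀ → (∀ v → m (cell v) ≡ col v) →
      ∃[ m′ ] ∃[ t ] (Runs writeOutput m m′ t × (∀ v → v < n₀ → m′ v ≡ col v) × t ≤ 5 * n₀ + 67)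
    writeOutput-correct m e2 e3 ea =
      let m₁ , R₁ , O = ops-run beginOutput (Outputting 0) m (beginOutput-correct m e2 e3 ea)
          m₂ , k , t , R₂ , O′ , le , t≤ = Loop.counted-loop n₀ 0 m₁ O 20≤W (m≤n+m n₀ 20)
          open Outputting O′
          m₃ , R₃ , Φ , h = ops-run (fetchAll lowRegisters)
            (λ m₃ → Fetching m₃ × (∀ v → v ∈ lowRegisters ⊎ m₂ v ≡ col v → m₃ v ≡ col v)) m₂
            (fetchAll-correct lowRegisters m₂ lowFetchable record
              { at2 = at2 ; arr = arr ; written = λ v v≥ v< → written v v≥ (≤-trans v< le) })
          m₄ , R₄ , good = ops-run fetchLast (λ m₄ → ∀ v → v < n₀ → m₄ v ≡ col v) m₃
            (fetchLast-correct m₃ Φ (λ v v∈ → h v (inj₁ v∈)))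
      in m₄ , _ , r-seq R₁ (r-seq R₂ (r-seq R₃ R₄)) , good , cost t t≤
      where
      cost : ∀ t → t ≤ suc n₀ * 5 → 5 + (t + (length (fetchAll lowRegisters) + 6)) ≤ 5 * n₀ + 67
      cost t t≤ = begin
        5 + (t + (length (fetchAll lowRegisters) + 6)) ≡⟨ cong (λ z → 5 + (t + (z + 6))) (fetchAll-length lowRegisters) ⟩
        5 + (t + 57)             ≤⟨ +-monoʳ-≤ 5 (+-monoˡ-≤ 57 t≤) ⟩
        5 + (suc n₀ * 5 + 57)    ≡⟨ cong (λ z → 10 + (z + 57)) (*-comm n₀ 5) ⟩
        10 + (5 * n₀ + 57)       ≡⟨ trans (+-comm 10 (5 * n₀ + 57)) (+-assoc (5 * n₀) 57 10) ⟩
        5 * n₀ + 67 ∎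
        where open ≤-Reasoning

-- The theorem

-- The test halts exactly on the graph without vertices: there 2 |E| < n + 2 |E| fails.
boot : Code → Program
boot c = add 1 1 1 ∷ add 0 0 1 ∷ jmpLt 1 0 4 ∷ halt ∷ compile 4 c

main : Code
main = loadInput ⨟ colouringCode ⨟ writeOutput

opaque
  program : Program
  program = boot main

  program≡ : program ≡ boot main
  program≡ = refl

opaque
  -- This is `154 * 8 + 10`: the algorithm at 8 machine steps per unit, and 10 steps per edge to
  -- move the input.
  timeFactor : ℕ
  timeFactor = 1242

  totalCost : ∀ n e t₁ t₂ t₃ → t₁ ≤ 10 * e + 110 → t₂ ≤ (154 * (n + e) + 31) * 8 → t₃ ≤ 5 * n + 67 →
    3 + (t₁ + (t₂ + t₃)) ≤ timeFactor * (n + e) + timeFactor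
  totalCost n e t₁ t₂ t₃ l₁ l₂ l₃ = begin
    3 + (t₁ + (t₂ + t₃))
      ≤⟨ +-monoʳ-≤ 3 (+-mono-≤ l₁ (+-mono-≤ l₂ l₃)) ⟩
    3 + (10 * e + 110 + ((154 * (n + e) + 31) * 8 + (5 * n + 67)))
      ≡⟨ solve 2 (λ n e → con 3 :+ (con 10 :* e :+ con 110 :+ ((con 154 :* (n :+ e) :+ con 31) :* con 8 :+ (con 5 :* n :+ con 67)))
           ⊜ con 1237 :* n :+ con 1242 :* e :+ con 428) refl n e ⟩
    1237 * n + 1242 * e + 428
      ≤⟨ +-mono-≤ (+-monoˡ-≤ (1242 * e) (*-monoˡ-≤ n (≤ᵇ⇒≤ 1237 1242 _))) (≤ᵇ⇒≤ 428 1242 _) ⟩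
    1242 * n + 1242 * e + 1242
      ≡⟨ cong (_+ 1242) (sym (*-distribˡ-+ 1242 n e)) ⟩
    1242 * (n + e) + 1242 ∎
    where
    open ≤-Reasoning
    open +-*-Solver using (solve; _:+_; _:*_; con) renaming (_:=_ to _⊜_)

  3≤timeFactor : 3 ≤ timeFactor
  3≤timeFactor = ≤ᵇ⇒≤ 3 1242 _

-- Execution of the complete program

module Execution (H : Graph) (es : List (Fin (n H) × Fin (n H))) (asc : All Ascending es) where

  open Neighbours es

  e : ℕ
  e = length es

  prepared : ℕ → ℕ
  prepared = effects ((1 ≔ 1 ⊞ 1) ∷ (0 ≔ 0 ⊞ 1) ∷ []) (initMem H es)

  prologue : ∀ c {b} → (e + e <ᵇ n H + (e + e)) ≡ b → Steps (boot c) (initState H es) 3 ⟨ (if b then 4 else 3) , prepared ⟩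
  prologue c {b} e≡ = next refl (next refl (next (step-jump (boot c) 1 0 4 2 prepared refl e≡) done))

  boot-runs : ∀ c {m t} T → Runs c prepared m t → 3 + t ≤ T → 0 < n H →
    run (boot c) T (initState H es) ≡ just ⟨ length (boot c) , m ⟩
  boot-runs c {m} T R le n>0 = run-Steps T (steps-++ (prologue c (<⇒<ᵇ-true (m<n+m (e + e) n>0)))
    (compile-correct R (boot c) 4 (located-suffix (add 1 1 1 ∷ add 0 0 1 ∷ jmpLt 1 0 4 ∷ halt ∷ []) (compile 4 c)))) stop le
    where
    stop : stepRAM (boot c) ⟨ length (boot c) , m ⟩ ≡ nothing
    stop rewrite nth-end (compile 4 c) = refl

  boot-halts : ∀ c T → 3 ≤ T → n H ≡ 0 → run (boot c) T (initState H es) ≡ just ⟨ 3 , prepared ⟩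
  boot-halts c T le n≡0 = run-Steps T (prologue c (≮⇒<ᵇ-false (≤-reflexive (cong (_+ (e + e)) n≡0)))) refl le

  ColouredMemory : (ℕ → ℕ) → Set
  ColouredMemory m = ∃[ S ] (ColouredStore S × (∀ v → v < n H → m v ≡ ar S colour v))

  storeOf : ℕ → (ℕ → ℕ) → Store
  storeOf W m = record { sc = λ x → m (reg x) ; ar = λ a i → m (addr W a i) }

  module _ (n>0 : 0 < n H) (E₂ Y W : ℕ) (E₂≡ : E₂ ≡ 2 * e) (Y≡ : Y ≡ n H + E₂) (W≡ : W ≡ E₂ + adds * Y) where

    open LoadInput n>0 es E₂ Y W E₂≡ Y≡ W≡

    Goal : Set
    Goal = ∃[ m ] ∃[ t ] (Runs main prepared m t × 3 + t ≤ timeFactor * (n H + e) + timeFactor × ColouredMemory m)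
    loaded : ∀ {m} → Set-up m → Loaded (n H) es (storeOf W m)
    loaded I = record
      { size≡ = size≡ ; bound≡ = trans bound≡ E₂≡
      ; input≡ = λ k k< → input≡ k (subst (k <_) (sym E₂≡) k<)
      ; arcHead0 = λ i → rest≡ arcHead i z<s ; degree0 = λ i → rest≡ degree i z<s
      ; blank = record { bktHead0 = λ i → rest≡ bktHead i z<s ; removed0 = λ i → rest≡ removed i z<s
        ; marks0 = λ i → rest≡ marks i z<s ; colour0 = λ i → rest≡ colour i z<s } }
      where open Set-up I
    afterRun : ∀ {m₁ m₂ t₁ t₂ S} → Runs loadInput prepared m₁ t₁ → t₁ ≤ 10 * e + 110 →
      Runs colouringCode m₁ m₂ t₂ → t₂ ≤ (154 * (n H + e) + 31) * 8 → ColouredStore S →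
      (∃[ m₃ ] ∃[ t₃ ] (Runs writeOutput m₂ m₃ t₃ × (∀ v → v < n H → m₃ v ≡ ar S colour v) × t₃ ≤ 5 * n H + 67)) → Goal
    afterRun R₁ l₁ R₂ l₂ col (m₃ , t₃ , R₃ , good , l₃) =
      m₃ , _ , r-seq R₁ (r-seq R₂ R₃) , totalCost (n H) e _ _ t₃ l₁ l₂ l₃ , _ , col , good

    output : ∀ {m₂ S} → Represents W m₂ S → ColouredStore S →
      ∃[ m₃ ] ∃[ t₃ ] (Runs writeOutput m₂ m₃ t₃ × (∀ v → v < n H → m₃ v ≡ ar S colour v) × t₃ ≤ 5 * n H + 67)
    output {m₂} {S} rep col = WriteOutput.writeOutput-correct (n H) W 20≤W n≤W (ar S colour) m₂
      (Represents.base rep) (trans (Represents.scalars rep size) (ColouredStore.size≡ col)) (Represents.arrays rep colour)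

    colour-loaded : ∀ {m} → Set-up m →
      ∃[ m′ ] ∃[ t ] ∃[ s′ ] (Runs colouringCode m m′ t × t ≤ (154 * (n H + e) + 31) * 8 × Represents W m′ s′ × ColouredStore s′)
    colour-loaded {m} I = colouringCode-correct (154 * (n H + e) + 31) (greedyColouring-correct asc (storeOf W m) (loaded I)) 19≤W
      (record { base = Set-up.base≡ I ; scalars = λ _ → refl ; arrays = λ _ _ → refl })

    afterColouring : ∀ {m₁ t₁} → Runs loadInput prepared m₁ t₁ → t₁ ≤ 10 * e + 110 →
      (∃[ m′ ] ∃[ t ] ∃[ s′ ] (Runs colouringCode m₁ m′ t × t ≤ (154 * (n H + e) + 31) * 8 × Represents W m′ s′ × ColouredStore s′)) → Goal
    afterColouring R₁ l₁ (m₂ , t₂ , S , R₂ , l₂ , rep , col) = afterRun R₁ l₁ R₂ l₂ col (output rep col)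

    afterLoad : ∃[ m₁ ] ∃[ t₁ ] (Runs loadInput prepared m₁ t₁ × Set-up m₁ × t₁ ≤ 10 * e + 110) → Goal
    afterLoad (m₁ , t₁ , R₁ , I , l₁) = afterColouring R₁ l₁ (colour-loaded I)

  main-correct : 0 < n H → ∃[ m ] ∃[ t ] (Runs main prepared m t × 3 + t ≤ timeFactor * (n H + e) + timeFactor × ColouredMemory m)
  main-correct n>0 = afterLoad n>0 (e + e) (n H + (e + e)) W e+e≡2e refl refl
    (LoadInput.loadInput-correct n>0 es (e + e) (n H + (e + e)) W e+e≡2e refl refl prepared refl refl (λ _ → refl))
    where
    W : ℕ
    W = e + e + adds * (n H + (e + e))
    e+e≡2e : e + e ≡ 2 * e
    e+e≡2e = cong (e +_) (sym (+-identityʳ e))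

  Solved : (ℕ → ℕ) → Set
  Solved m = ∃[ p ] run program (timeFactor * (n H + e) + timeFactor) (initState H es) ≡ just ⟨ p , m ⟩

  program-runs : ∀ {m t} → Runs main prepared m t → 3 + t ≤ timeFactor * (n H + e) + timeFactor → 0 < n H → Solved m
  program-runs R t≤ n>0 = _ , trans (cong (λ P → run P (timeFactor * (n H + e) + timeFactor) (initState H es)) program≡)
    (boot-runs main (timeFactor * (n H + e) + timeFactor) R t≤ n>0)

  program-halts : n H ≡ 0 → Solved prepared
  program-halts n≡0 = _ , trans (cong (λ P → run P (timeFactor * (n H + e) + timeFactor) (initState H es)) program≡)
    (boot-halts main (timeFactor * (n H + e) + timeFactor) (≤-trans 3≤timeFactor (m≤n+m timeFactor _)) n≡0)

-- Cores of H have degree linear in the number of colours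

module CoreBound (H : Graph) (es : List (Fin (n H) × Fin (n H))) (listing : EdgeListing H es) where

  ascending : All Ascending es
  ascending = All.map proj₁ (proj₂ (proj₁ listing))

  open Neighbours es

  neighbours-unique : ∀ x → Unique (neighbours es x)
  neighbours-unique = linkAll-unique es (λ _ → []) (proj₁ (proj₁ listing)) ascending (λ _ → []) (λ _ _ _ → (λ ()) , (λ ()))

  Near : Fin (n H) → Fin (n H) → Set
  Near u v = toℕ v ∈ neighbours es (toℕ u)

  near? : ∀ u v → Dec (Near u v)
  near? u v = DecMembership._∈?_ _≟_ (toℕ v) (neighbours es (toℕ u))

  near⇒adj : ∀ u v → Near u v → Adj H u v
  near⇒adj u v v∈ with find (neighbours-sound es v∈)
  ... | (x , y) , e∈ , inj₁ (p , q) = subst₂ (Adj H) (sym (Fin.toℕ-injective p)) (sym (Fin.toℕ-injective q)) (proj₂ (All.lookup (proj₂ (proj₁ listing)) e∈))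
  ... | (x , y) , e∈ , inj₂ (p , q) = subst₂ (Adj H) (sym (Fin.toℕ-injective p)) (sym (Fin.toℕ-injective q)) (adj-sym H (proj₂ (All.lookup (proj₂ (proj₁ listing)) e∈)))

  adj⇒near : ∀ u v → Adj H u v → Near u v
  adj⇒near u v a with <-cmp (toℕ u) (toℕ v)
  ... | tri< u<v _ _ = proj₁ (linkAll-complete es (λ _ → []) (proj₂ listing u v a u<v))
  ... | tri≈ _ u≡v _ = contradiction (subst (Adj H u) (sym (Fin.toℕ-injective u≡v)) a) (irrefl H)
  ... | tri> _ _ v<u = proj₂ (linkAll-complete es (λ _ → []) (proj₂ listing v u (adj-sym H a) v<u))

  -- The zero set of `S` becomes a list of vertices of H. `cnt` counts list entries with repetition,
  -- so it takes the distinctness of the adjacency lists to read it as a degree.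
  core≤ : ∀ {G d r b k t} → r + r ≤ d → d ≤ suc (r + r) →
    (∀ M → DepthMinor r M G → ∀ es → EdgeList M es → length es ≤ b * n M) →
    InducedSub H (power G d) → Colourable H k → Core t → t ≤ 2 ^ suc d * b * 2 * k
  core≤ {G} {d} {r} {b} {k} {t} lo hi sparse ind col (S , (v , v<n , Sv) , minS) =
    PowerDensity.minDegree≤ G H d r b lo hi sparse ind k col Near near? near⇒adj
      (Unique.filter⁺ inS? (Unique.allFin⁺ (n H))) nonempty t degree≥
    where
    inS? : ∀ u → Dec (S (toℕ u) ≡ 0)
    inS? u = S (toℕ u) ≟ 0
    U : List (Fin (n H))
    U = filter inS? (allFin (n H))
    ∈U : ∀ {w} (w< : w < n H) → S w ≡ 0 → fromℕ< w< ∈ U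
    ∈U w< e = ∈-filter⁺ inS? (∈-allFin (fromℕ< w<)) (trans (cong S (Fin.toℕ-fromℕ< w<)) e)
    nonempty : 0 < length U
    nonempty with U | ∈U v<n Sv
    ... | _ ∷ _ | _ = z<s
    degree≥ : ∀ u → u ∈ U → t ≤ Σl (λ w → ⟦ near? u w ⟧) U
    degree≥ u u∈ = begin
      t
        ≤⟨ minS (toℕ u) (Fin.toℕ<n u) (proj₂ (∈-filter⁻ inS? {xs = allFin (n H)} u∈)) ⟩
      cnt S F
        ≤⟨ Σl-mono one F ⟩
      Σl (λ w → ⟦ S w ≟ 0 ⟧) F
        ≡⟨ sym (length-filter-Σl (λ w → S w ≟ 0) F) ⟩
      length (filter (λ w → S w ≟ 0) F)
        ≤⟨ unique-⊆-length (Unique.filter⁺ (λ w → S w ≟ 0) (neighbours-unique (toℕ u))) inside ⟩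
      length (map toℕ (filter (near? u) U))
        ≡⟨ length-map toℕ (filter (near? u) U) ⟩
      length (filter (near? u) U)
        ≡⟨ length-filter-Σl (near? u) U ⟩
      Σl (λ w → ⟦ near? u w ⟧) U ∎
      where
      open ≤-Reasoning
      F = neighbours es (toℕ u)
      one : ∀ w → 1 ∸ S w ≤ ⟦ S w ≟ 0 ⟧
      one w with S w
      ... | zero  = ≤-refl
      ... | suc x = ≤-reflexive (0∸n≡0 x)
      inside : ∀ {w} → w ∈ filter (λ w → S w ≟ 0) F → w ∈ map toℕ (filter (near? u) U)
      inside {w} w∈ with ∈-filter⁻ (λ w → S w ≟ 0) {xs = F} w∈
      ... | w∈F , Sw = subst (_∈ map toℕ (filter (near? u) U)) (Fin.toℕ-fromℕ< w<n)
        (∈-map⁺ toℕ (∈-filter⁺ (near? u) (∈U w<n Sw) (subst (_∈ F) (sym (Fin.toℕ-fromℕ< w<n)) w∈F)))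
        where w<n = All.lookup (∈-<n (toℕ u)) w∈F

theorem6p1 : (C : Graph → Set) → BoundedExpansion C → (d : ℕ) →
    ∃[ c ] ∃[ a ] ∃[ prog ]
    (∀ H → InClosurePower C d H → ∀ es → EdgeListing H es →
    ∃[ s ] (run prog (a * (n H + length es) + a) (initState H es) ≡ just s
    × Proper H (outColouring H s)
    × (∀ k → IsChromaticNumber H k → UsesAtMost H (c * k) (outColouring H s))))
theorem6p1 C be d = suc D , timeFactor , program , λ H (G , CG , ind) es listing →
    correct H G CG ind es listing (n H ≟ 0)
  where
  r = proj₁ (halve d)
  b = proj₁ (be r)
  D : ℕ
  -- `2 ^ suc d` is the loss of the averaging, `b` the density of minors of depth ⌊d/2⌋, and 2 comes
  -- from the two classes of each pair.
  D = 2 ^ suc d * b * 2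
  module _ (H G : Graph) (CG : C G) (ind : InducedSub H (power G d)) (es : List (Fin (n H) × Fin (n H)))
    (listing : EdgeListing H es) where
    open CoreBound H es listing
    open Neighbours es
    open Execution H es ascending
    Answer : Set
    Answer = ∃[ s ] (run program (timeFactor * (n H + length es) + timeFactor) (initState H es) ≡ just s
      × Proper H (outColouring H s)
      × (∀ k → IsChromaticNumber H k → UsesAtMost H (suc D * k) (outColouring H s)))
    coloursIn : ∀ {S} → ColouredStore S → ∀ k → IsChromaticNumber H k → ∀ v →
      ar S colour (toℕ v) ∈ map suc (upTo (suc (D * k)))
    coloursIn {S} col k (c , _) v = inRange (coloured (toℕ v) (Fin.toℕ<n v)) (small (toℕ v) (coloured (toℕ v) (Fin.toℕ<n v)))
      where
      open ColouredStore col
      inRange : ∀ {x} → 0 < x → ∃[ t ] (Core t × x ≤ suc t) → x ∈ map suc (upTo (suc (D * k)))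
      inRange {suc x} _ (t , core , s≤s x≤t) = ∈-map⁺ suc (∈-upTo⁺ (s≤s (≤-trans x≤t
        (core≤ {G} {d} {r} {b} {k} (proj₁ (proj₂ (halve d))) (proj₂ (proj₂ (halve d))) (proj₂ (be r) G CG) ind c core))))
    nonempty : 0 < n H → ∀ m S → ColouredStore S → (∀ v → v < n H → m v ≡ ar S colour v) → Solved m → Answer
    nonempty n>0 m S col out (p , ran) = ⟨ p , m ⟩ , ran , proper , colours
      where
      open ColouredStore col renaming (proper to properly)
      at : ∀ v → m (toℕ v) ≡ ar S colour (toℕ v)
      at v = out (toℕ v) (Fin.toℕ<n v)
      proper : Proper H (λ v → m (toℕ v))
      proper u v a e = properly (toℕ u) (toℕ v) (adj⇒near u v a) (coloured (toℕ u) (Fin.toℕ<n u)) (coloured (toℕ v) (Fin.toℕ<n v))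
        (trans (sym (at u)) (trans e (at v)))
      colours : ∀ k → IsChromaticNumber H k → UsesAtMost H (suc D * k) (λ v → m (toℕ v))
      colours zero (c , _) = [] , z≤n , λ v → contradiction (proj₁ c v) λ ()
      -- The colours lie between 1 and `D * χ + 1`. As χ is positive, the additional one is absorbed
      -- by raising the factor from `D` to `suc D`.
      colours (suc k) χ = map suc (upTo (suc (D * suc k))) ,
        ≤-trans (≤-reflexive (trans (length-map suc (upTo (suc (D * suc k)))) (length-upTo (suc (D * suc k))))) (s≤s (m≤n+m (D * suc k) k)) ,
        λ v → subst (_∈ map suc (upTo (suc (D * suc k)))) (sym (at v)) (coloursIn col (suc k) χ v)
    correct : Dec (n H ≡ 0) → Answer
    correct (yes n≡0) = let p , ran = program-halts n≡0 in
      ⟨ p , prepared ⟩ , ran , (λ u → contradiction u noVertex) , λ k _ → [] , z≤n , λ v → contradiction v noVertex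
      where
      noVertex : ¬ Fin (n H)
      noVertex v = n≮0 (subst (toℕ v <_) n≡0 (Fin.toℕ<n v))
    correct (no n≢0) = let m , t , R , t≤ , S , col , out = main-correct (n≢0⇒n>0 n≢0) in
      nonempty (n≢0⇒n>0 n≢0) m S col out (program-runs R t≤ (n≢0⇒n>0 n≢0))
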